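{- Let $n$ and $k$ be nonnegative integers. The following five sets all have the same cardinality: (1) the set $\mathcal{T}_{n,k}$ of rooted trees $T$ on $[n+1]$ whose maximal decreasing subtree $\mathrm{MD}(T)$ has exactly $k+1$ vertices; (2) the set $\mathcal{A}_{n,k}$ of cycles $[T_0,T_1,\dots,T_k]$ of $k+1$ minimally rooted trees whose vertex sets form a partition of $[n+1]$; (3) the set $\mathcal{B}_{n,k}$ of ordered forests $(T_1,\dots,T_\ell,T_{\ell+1},\dots,T_{\ell+k})$ on $[n]$ (with $\ell\ge 0$) such that the last $k$ trees $T_{\ell+1},\dots,T_{\ell+k}$ are minimally rooted; (4) the set $\mathcal{C}_{n,k}$ of finite sequences $(\mathcal{F}_1,\dots,\mathcal{F}_h)$ of $k$-good ordered forests whose vertex sets form a partition of $[n]$; (5) the set $\mathcal{F}_{n,k}$ of rooted trees on $[n+1]$ in which $n+1$ is a leaf and each of $1,2,\dots,k$ is a nonleaf.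
   Context: $[m]=\{1,\dots,m\}$, $[0]=\emptyset$. A tree on a finite set $X$ is a connected acyclic graph with vertex set $X$; a rooted tree has a distinguished vertex, the root. In a rooted tree, the parent of a non-root vertex $v$ is the vertex preceding $v$ on the unique path from the root to $v$, and $v$ is a child of its parent; a leaf is a vertex with no children. A rooted tree is decreasing if every nonleaf is greater than all of its children. The maximal decreasing subtree $\mathrm{MD}(T)$ of a rooted tree $T$ is the maximal subtree of $T$ containing the root of $T$ (as its root) which is decreasing. A rooted tree is minimally rooted if its root has no child smaller than the root. An ordered forest on a finite set $X$ is a tuple of rooted trees whose vertex sets form a partition of $X$. A cycle $[a_0,\dots,a_k]$ is a sequence considered up to cyclic rotation. A vertex is called special if its label is at most $k$. An ordered forest $(T_0,T_1,\dots,T_\ell)$ is $k$-good if: when $\ell=0$, either $T_0$ consists of a single vertex which lies in $[k]$, or $T_0$ contains no vertex of $[k]$; when $\ell\ge1$, the trees $T_1,\dots,T_\ell$ are minimally rooted, and for each $i=0,1,\dots,\ell-1$ the number of vertices of $T_0,\dots,T_i$ lying in $[k]$ is at least $i+1$, while the number of vertices of $T_0,\dots,T_\ell$ lying in $[k]$ equals $\ell$.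
   Formalization: The equality with set (4) is asserted only for k ≤ n, since for k > n the set C_{n,k} has n! elements while the other four sets are empty (e.g. n = 0, k = 1); the other four sets are shown equinumerous for all n and k. -}

module Defs where

open import Data.Bool using (Bool; T)
open import Data.Empty using (⊥)
open import Data.Fin using (Fin; toℕ; fromℕ; _<_)
open import Data.Fin.Subset using (Subset; _∈_; _⊆_; _∩_; ⋃; ⁅_⁆; ∣_∣; ⊤; Nonempty; Empty)
open import Data.List using (List; []; _∷_; _++_; map; take; length)
open import Data.List.Properties using (++-assoc; ++-identityʳ)
open import Data.List.Relation.Binary.Pointwise as Pointwise using (Pointwise; []; _∷_)
open import Data.List.Relation.Unary.All using (All)
open import Data.List.Relation.Unary.AllPairs using (AllPairs)
open import Data.List.Relation.Unary.Unique.Propositional using (Unique)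
open import Data.Nat as ℕ using (ℕ; zero; suc; _+_; _*_; _∸_; _≤_; _≤?_)
open import Data.Nat.GeneralisedArithmetic using (fold; fold-+)
open import Data.Nat.Properties using (+-comm; m∸n+n≡m; m≤m*n)
open import Data.Product using (Σ; ∃; _×_; _,_; proj₁)
open import Data.Sum using (_⊎_)
open import Data.Vec using (tabulate)
open import Level using (Level; 0ℓ; _⊔_)
open import Relation.Binary using (Setoid)
import Relation.Binary.Construct.On as On
open import Relation.Binary.PropositionalEquality
  using (_≡_; refl; sym; trans; cong; subst)
open import Relation.Nullary using (¬_)
open import Relation.Nullary.Decidable using (⌊_⌋)

private variable
  n : ℕ

-- The set {1,…,n} is modelled by Fin n, in its usual order: the element v
-- stands for the integer  label v.

label : Fin n → ℕ
label v = suc (toℕ v)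

Special : ℕ → Fin n → Set
Special k v = label v ≤ k

-- Simple graphs whose vertex set is a subset of {1,…,n}.

record Graph (n : ℕ) : Set where
  field
    vertices : Subset n
    adj      : Fin n → Fin n → Bool

  _~_ : Fin n → Fin n → Set
  u ~ v = T (adj u v)

  field
    ~-sym    : ∀ {u v} → u ~ v → v ~ u
    ~-irrefl : ∀ {v} → ¬ (v ~ v)
    ~-vertex : ∀ {u v} → u ~ v → u ∈ vertices

  -- Walk u v ws : a walk from u to v, where ws lists all vertices visited in
  -- order, both endpoints included.
  data Walk : Fin n → Fin n → List (Fin n) → Set where
    here : ∀ {u} → u ∈ vertices → Walk u u (u ∷ [])
    step : ∀ {u v w ws} → u ~ v → Walk v w ws → Walk u w (u ∷ ws)

  Path : Fin n → Fin n → List (Fin n) → Set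
  Path u v ws = Walk u v ws × Unique ws

  Connected : Set
  Connected = ∀ {u v} → u ∈ vertices → v ∈ vertices → ∃ λ ws → Walk u v ws

  -- A graph cycle is a path on at least three vertices with adjacent endpoints.
  Acyclic : Set
  Acyclic = ∀ {u v ws} → Path u v ws → 3 ≤ length ws → ¬ (v ~ u)

record RootedTree (n : ℕ) : Set where
  field
    graph     : Graph n
  open Graph graph public
  field
    root      : Fin n
    root∈     : root ∈ vertices
    connected : Connected
    acyclic   : Acyclic

  -- IsChild c p : p is the vertex preceding c on the path from the root to c.
  IsChild : Fin n → Fin n → Set
  IsChild c p = ∃ λ ws → Path root c (ws ++ p ∷ c ∷ [])

  Leaf : Fin n → Set
  Leaf v = v ∈ vertices × ¬ (∃ λ c → IsChild c v)

  Nonleaf : Fin n → Set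
  Nonleaf v = v ∈ vertices × ∃ λ c → IsChild c v

  Decreasing : Set
  Decreasing = ∀ {v} → Nonleaf v → ∀ {c} → IsChild c v → c < v

  MinimallyRooted : Set
  MinimallyRooted = ¬ (∃ λ c → IsChild c root × c < root)

open RootedTree

-- Equality of rooted trees ignores the proof components.
_≈_ : RootedTree n → RootedTree n → Set
S ≈ T = vertices S ≡ vertices T × (∀ u v → adj S u v ≡ adj T u v) × root S ≡ root T

treeSetoid : ℕ → Setoid 0ℓ 0ℓ
treeSetoid n = record
  { Carrier       = RootedTree n
  ; _≈_           = _≈_
  ; isEquivalence = record
    { refl  = refl , (λ _ _ → refl) , refl
    ; sym   = λ (p , q , r) → sym p , (λ u v → sym (q u v)) , sym r
    ; trans = λ (p , q , r) (p′ , q′ , r′) →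
        trans p p′ , (λ u v → trans (q u v) (q′ u v)) , trans r r′
    }
  }

_⊑_ : RootedTree n → RootedTree n → Set
S ⊑ T = vertices S ⊆ vertices T × (∀ {u v} → _~_ S u v → _~_ T u v)

IsDecreasingSubtree : RootedTree n → RootedTree n → Set
IsDecreasingSubtree S T = S ⊑ T × root S ≡ root T × Decreasing S

-- IsMD M T : M is the maximal decreasing subtree of T.
IsMD : RootedTree n → RootedTree n → Set
IsMD M T = IsDecreasingSubtree M T × (∀ S → IsDecreasingSubtree S T → M ⊑ S → S ⊑ M)

IsPartition : List (Subset n) → Subset n → Set
IsPartition Xs X = All Nonempty Xs × AllPairs (λ p q → Empty (p ∩ q)) Xs × ⋃ Xs ≡ X

vertexSet : List (RootedTree n) → Subset n
vertexSet Ts = ⋃ (map vertices Ts)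

IsOrderedForest : Subset n → List (RootedTree n) → Set
IsOrderedForest X Ts = IsPartition (map vertices Ts) X

specials : ℕ → Subset n
specials k = tabulate λ v → ⌊ label v ≤? k ⌋

specialCount : ℕ → List (RootedTree n) → ℕ
specialCount k Ts = ∣ vertexSet Ts ∩ specials k ∣

-- The list is (T₀ , T₁ , … , Tℓ), hence has at least one entry.
KGood : ℕ → List (RootedTree n) → Set
KGood k []            = ⊥
KGood k (T₀ ∷ [])     = (∃ λ v → vertices T₀ ≡ ⁅ v ⁆ × Special k v)
                      ⊎ (∀ {v} → v ∈ vertices T₀ → ¬ Special k v)
KGood k (T₀ ∷ T₁ ∷ Ts) =
    All MinimallyRooted (T₁ ∷ Ts)
  × (∀ i → i ℕ.< ℓ → suc i ≤ specialCount k (take (suc i) (T₀ ∷ T₁ ∷ Ts)))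
  × specialCount k (T₀ ∷ T₁ ∷ Ts) ≡ ℓ
  where ℓ = length (T₁ ∷ Ts)

module Rotation {a r : Level} (S : Setoid a r) where
  open Setoid S using () renaming (Carrier to A)
  private
    listSetoid = Pointwise.setoid S
    module L = Setoid listSetoid
  open L using () renaming (_≈_ to _≋_)

  rotate : List A → List A
  rotate []       = []
  rotate (x ∷ xs) = xs ++ x ∷ []

  rotateBy : ℕ → List A → List A
  rotateBy m xs = fold xs rotate m

  _↻_ : List A → List A → Set (a ⊔ r)
  xs ↻ ys = ∃ λ m → rotateBy m xs ≋ ys

  private
    rotateBy-cong : ∀ m {xs ys} → xs ≋ ys → rotateBy m xs ≋ rotateBy m ys
    rotateBy-cong zero    p = p
    rotateBy-cong (suc m) p = rotate-cong (rotateBy-cong m p)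
      where
      rotate-cong : ∀ {xs ys} → xs ≋ ys → rotate xs ≋ rotate ys
      rotate-cong []       = []
      rotate-cong (x ∷ ps) = Pointwise.++⁺ ps (x ∷ [])

    rotateBy-+ : ∀ m m′ xs → rotateBy (m + m′) xs ≡ rotateBy m (rotateBy m′ xs)
    rotateBy-+ m m′ xs = fold-+ xs rotate m

    rotateBy-++ : ∀ xs ys → rotateBy (length xs) (xs ++ ys) ≡ ys ++ xs
    rotateBy-++ []       ys = sym (++-identityʳ ys)
    rotateBy-++ (x ∷ xs) ys =
      trans (cong (λ m → rotateBy m (x ∷ xs ++ ys)) (+-comm 1 (length xs)))
      (trans (rotateBy-+ (length xs) 1 (x ∷ xs ++ ys))
      (trans (cong (rotateBy (length xs)) (++-assoc xs ys (x ∷ [])))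
      (trans (rotateBy-++ xs (ys ++ x ∷ [])) (++-assoc ys (x ∷ []) xs))))

    rotateBy-* : ∀ m xs → rotateBy (m * length xs) xs ≡ xs
    rotateBy-* zero    xs = refl
    rotateBy-* (suc m) xs =
      trans (rotateBy-+ (length xs) (m * length xs) xs)
      (trans (cong (rotateBy (length xs)) (rotateBy-* m xs))
      (trans (cong (rotateBy (length xs)) (sym (++-identityʳ xs)))
             (rotateBy-++ xs [])))

    rotateBy-[] : ∀ m → rotateBy m [] ≡ []
    rotateBy-[] zero    = refl
    rotateBy-[] (suc m) = cong rotate (rotateBy-[] m)

    ↻-sym : ∀ {xs ys} → xs ↻ ys → ys ↻ xs
    ↻-sym {[]} (m , p) = 0 , L.sym (subst (_≋ _) (rotateBy-[] m) p)
    ↻-sym {xs@(_ ∷ _)} (m , p) = m′ , L.trans (rotateBy-cong m′ (L.sym p)) (L.reflexive back)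
      where
      m′ = m * length xs ∸ m
      back : rotateBy m′ (rotateBy m xs) ≡ xs
      back = trans (sym (rotateBy-+ m′ m xs))
             (trans (cong (λ j → rotateBy j xs) (m∸n+n≡m (m≤m*n m (length xs))))
                    (rotateBy-* m xs))

  cycleSetoid : Setoid a (a ⊔ r)
  cycleSetoid = record
    { Carrier       = List A
    ; _≈_           = _↻_
    ; isEquivalence = record
      { refl  = 0 , L.refl
      ; sym   = ↻-sym
      ; trans = λ {xs} (m , p) (m′ , q) →
          m′ + m , L.trans (L.reflexive (rotateBy-+ m′ m xs))
                           (L.trans (rotateBy-cong m′ p) q)
      }
    }

open Rotation using (cycleSetoid)

subsetoid : ∀ {a r p} (S : Setoid a r) → (Setoid.Carrier S → Set p) → Setoid (a ⊔ p) r
subsetoid S P = On.setoid {B = Σ (Setoid.Carrier S) P} S proj₁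

𝒯 : ℕ → ℕ → Setoid 0ℓ 0ℓ
𝒯 n k = subsetoid (treeSetoid (suc n)) λ T →
  vertices T ≡ ⊤ × ∃ λ M → IsMD M T × ∣ vertices M ∣ ≡ suc k

𝒜 : ℕ → ℕ → Setoid 0ℓ 0ℓ
𝒜 n k = subsetoid (cycleSetoid (treeSetoid (suc n))) λ Ts →
  length Ts ≡ suc k × All MinimallyRooted Ts × IsPartition (map vertices Ts) ⊤

ℬ : ℕ → ℕ → Setoid 0ℓ 0ℓ
ℬ n k = subsetoid (Pointwise.setoid (treeSetoid n)) λ Ts →
  IsOrderedForest ⊤ Ts ×
  ∃ λ Us → ∃ λ Vs → Ts ≡ Us ++ Vs × length Vs ≡ k × All MinimallyRooted Vs

-- For k > n every vertex is special and a k-good forest is a single one-vertex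
-- tree, so 𝒞 n k then has n! elements, while 𝒯, 𝒜, ℬ and ℱ are empty.
𝒞 : ℕ → ℕ → Setoid 0ℓ 0ℓ
𝒞 n k = subsetoid (Pointwise.setoid (Pointwise.setoid (treeSetoid n))) λ Fs →
  All (λ F → IsOrderedForest (vertexSet F) F × KGood k F) Fs ×
  IsPartition (map vertexSet Fs) ⊤

-- fromℕ n is the vertex n+1.
ℱ : ℕ → ℕ → Setoid 0ℓ 0ℓ
ℱ n k = subsetoid (treeSetoid (suc n)) λ T →
  vertices T ≡ ⊤ × Leaf T (fromℕ n) × (∀ v → Special k v → Nonleaf T v)

-- Graph-theoretic trees are first replaced by rose trees whose children are listed in ascending order.
--
-- 𝒯 ↔ 𝒜: In a rooted tree every vertex of the maximal decreasing subtree, together with the branches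
-- at its larger children, forms a minimally rooted tree.  What remains is a decreasing tree on these
-- k + 1 pieces, and decreasing forests correspond to linear orders; the piece of the root has the
-- largest root, which singles out a representative of the cycle.
--
-- 𝒜 ↔ ℬ: Rotate the cycle so that the tree containing n + 1 comes first.  For any z, minimally rooted
-- trees on X containing z correspond to ordered forests on X \ {z}: cut the path from the root to z.
--
-- ℬ ↔ 𝒞: An arbitrary first tree is completed to a good forest by the shortest initial segment of the
-- minimally rooted trees that provides one tree for each special vertex of the block.  When only
-- minimally rooted trees are left, their number j equals the number of remaining special vertices.
-- Such a sequence is a cycle together with one of j starting points, the latter encoded by a special
-- vertex z; the tree containing z is cut open as above, which leaves the block {z} and a smaller
-- instance.
--
-- 𝒞 ↔ ℱ: In a good forest the minimally rooted trees are grafted, in preorder, one below each special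
-- vertex, which yields a rooted tree in which all special vertices are nonleaves.  The trees obtained
-- from the blocks are then hung along a path ending in the leaf n + 1.
{-# OPTIONS --safe #-}
module Submission where

open import Data.Bool using (Bool; true; false; T; if_then_else_)
open import Data.Empty using (⊥; ⊥-elim)
open import Data.Fin using (Fin; zero; suc; toℕ; fromℕ; fromℕ<)
open import Data.Fin.Properties using (toℕ<n; toℕ-injective; toℕ-fromℕ<; toℕ-fromℕ; injective⇒≤)
import Data.Fin as Fin
import Data.Fin.Properties as Fin
open import Data.Fin.Subset as Subset using (Subset; _∩_; ⋃; ⁅_⁆; ∣_∣; ⊤; Nonempty; Empty; inside; outside)
import Data.Fin.Subset.Properties as Subset
open import Data.List using (drop; List; []; _∷_; _++_; map; take; length; filter; concat; foldr; reverse; [_]; allFin; lookup)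
open import Data.List.Membership.Propositional using (_∈_; _∉_; find; lose)
open import Data.List.Membership.Propositional.Properties using (∈-lookup; ∈-++⁺ʳ; ∈-filter⁺; ∈-filter⁻; ∈-map⁺; ∈-map⁻; ∈-∃++; ∈-allFin)
open import Data.List.Properties using (take++drop≡id; length-drop; ++-assoc; ++-identityʳ; filter-++; filter-all; filter-none; length-++; unfold-reverse; length-reverse; ∷-injective; ∷-injectiveˡ; ∷-injectiveʳ)
open import Data.List.Relation.Binary.Pointwise as Pointwise using (Pointwise; []; _∷_)
open import Data.List.Relation.Unary.All as All using (All; []; _∷_)
import Data.List.Relation.Unary.All.Properties as All
open import Data.List.Relation.Unary.AllPairs as AllPairs using (AllPairs; []; _∷_)
import Data.List.Relation.Unary.AllPairs.Properties as AllPairs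
open import Data.List.Relation.Unary.Any as Any using (Any; here; there)
import Data.List.Relation.Unary.Any.Properties as Any
open import Data.List.Relation.Unary.Linked using (Linked; []; [-]; _∷_)
open import Data.List.Relation.Unary.Unique.Propositional using (Unique)
open import Data.Nat using (_<ᵇ_; ℕ; zero; suc; _+_; _*_; _∸_; _≤_; _<_; _≤?_; _<?_; _≟_; z≤n; s≤s; s≤s⁻¹)
open import Data.Nat.Properties
open import Data.Nat.Solver using (module +-*-Solver)
open import Data.Product using (∃; ∃₂; _×_; _,_; proj₁; proj₂)
open import Data.Sum using (_⊎_; inj₁; inj₂; [_,_]′; swap)
import Data.Vec as Vec
import Data.Vec.Properties as Vec
open import Function using (_∘_; id; case_of_)
open import Function.Bundles using (Inverse)
import Function.Construct.Composition as Compose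
import Function.Construct.Symmetry as Symmetry
open import Relation.Binary using (Setoid; tri<; tri≈; tri>)
open import Relation.Binary.PropositionalEquality
  using (_≡_; _≢_; refl; sym; trans; cong; cong₂; subst; subst₂; setoid)
open import Relation.Nullary using (¬_; Dec; yes; no; contradiction)
open import Relation.Nullary.Decidable using (T?; ⌊_⌋; toWitness; fromWitness; map′; _×-dec_; _⊎-dec_; ¬?)
open import Defs

-- Each correspondence is a relation on rose trees that is total and single-valued in both
-- directions. Several of the recursions are not structural, and a relation avoids proving that two
-- such functions undo each other. ℬ ↔ 𝒞 rests on one balance: as many minimally rooted trees are
-- left as special vertices. Both numbers are `k` at the start, and a completed block uses one tree
-- for each of its special vertices. When only minimally rooted trees remain, a starting point of
-- the cycle and a special vertex are therefore choices among equally many possibilities, and the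
-- rank of `z` can be matched with a position. In 𝒞 ↔ ℱ the grafting has to be undone from the tree
-- alone, so a grafted tree cannot simply become one more child. It is merged with the forest below
-- the special vertex by `ins`, the step that encodes decreasing forests. As `ins` is a bijection
-- onto nonempty forests, the only trace of grafting is that the vertex is no longer a leaf. The
-- one-vertex blocks supply the trees whose root is a special leaf; this root gets its child from
-- the path to n + 1.

-- Rose trees labelled by natural numbers; the label x stands for the vertex x + 1.
data Tree : Set where
  node : ℕ → List Tree → Tree

top : Tree → ℕ
top (node v _) = v

kids : Tree → List Tree
kids (node _ ts) = ts

-- Two forests have the same labels, with multiplicities, if and only if wts w agrees on them for
-- every weight function w; this is how the operations below are shown to preserve vertex sets.
wt  : (ℕ → ℕ) → Tree → ℕ
wts : (ℕ → ℕ) → List Tree → ℕ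
wt w (node v ts) = w v + wts w ts
wts w []       = 0
wts w (t ∷ ts) = wt w t + wts w ts

δ : ℕ → ℕ → ℕ
δ zero    zero    = 1
δ zero    (suc _) = 0
δ (suc _) zero    = 0
δ (suc v) (suc x) = δ v x

-- The indicator of `x < m`. Labels start at 0, so `wts (χ k)` counts special vertices, the
-- multiplicities of a forest on all of `[n]` are `χ n`, and `wts (χ z)` is the rank of `z`.
χ : ℕ → ℕ → ℕ
χ zero    x       = 0
χ (suc m) zero    = 1
χ (suc m) (suc x) = χ m x

occ : ℕ → Tree → ℕ
occ v = wt (δ v)

occs : ℕ → List Tree → ℕ
occs v = wts (δ v)

-- A record rather than a synonym for `1 ≤ occ v t`, which would reduce on constructors and no
-- longer let `v` and `t` be inferred. The next three records have the same purpose.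
record In (v : ℕ) (t : Tree) : Set where
  constructor mk
  field pos : 1 ≤ occ v t

record Ins (v : ℕ) (ts : List Tree) : Set where
  constructor mk
  field pos : 1 ≤ occs v ts

record Simple (t : Tree) : Set where
  constructor mk
  field once : ∀ v → occ v t ≤ 1

record Simples (ts : List Tree) : Set where
  constructor mk
  field once : ∀ v → occs v ts ≤ 1

open In public
open Ins public
open Simple public
open Simples public

δ-refl : ∀ v → δ v v ≡ 1
δ-refl zero    = refl
δ-refl (suc v) = δ-refl v

δ-≡ : ∀ v x → 1 ≤ δ v x → v ≡ x
δ-≡ zero    zero    _ = refl
δ-≡ (suc v) (suc x) p = cong suc (δ-≡ v x p)

δ-≢ : ∀ {v x} → v ≢ x → δ v x ≡ 0
δ-≢ {v} {x} v≢x = n<1⇒n≡0 (≰⇒> (v≢x ∘ δ-≡ v x))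

χ-< : ∀ {m x} → x < m → χ m x ≡ 1
χ-< {suc m} {zero}  _       = refl
χ-< {suc m} {suc x} (s≤s p) = χ-< p

χ-≥ : ∀ {m x} → m ≤ x → χ m x ≡ 0
χ-≥ {zero}  _       = refl
χ-≥ {suc m} (s≤s p) = χ-≥ {m} p

χ>0 : ∀ m x → 1 ≤ χ m x → x < m
χ>0 (suc m) zero    _ = s≤s z≤n
χ>0 (suc m) (suc x) p = s≤s (χ>0 m x p)

χ≤1 : ∀ m x → χ m x ≤ 1
χ≤1 zero    x       = z≤n
χ≤1 (suc m) zero    = s≤s z≤n
χ≤1 (suc m) (suc x) = χ≤1 m x

χ-suc : ∀ m x → χ (suc m) x ≡ χ m x + δ m x
χ-suc zero    zero    = refl
χ-suc zero    (suc x) = refl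
χ-suc (suc m) zero    = refl
χ-suc (suc m) (suc x) = χ-suc m x

wts-++ : ∀ w xs {ys} → wts w (xs ++ ys) ≡ wts w xs + wts w ys
wts-++ w []       = refl
wts-++ w (x ∷ xs) = trans (cong (wt w x +_) (wts-++ w xs)) (sym (+-assoc (wt w x) _ _))

wts-++-comm : ∀ w xs {ys} → wts w (xs ++ ys) ≡ wts w (ys ++ xs)
wts-++-comm w xs {ys} = trans (wts-++ w xs) (trans (+-comm (wts w xs) _) (sym (wts-++ w ys)))

wts-reverse : ∀ w xs → wts w (reverse xs) ≡ wts w xs
wts-reverse w []       = refl
wts-reverse w (x ∷ xs) = trans (cong (wts w) (unfold-reverse x xs))
  (trans (wts-++-comm w (reverse xs) {[ x ]}) (cong (wt w x +_) (wts-reverse w xs)))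

wts-∈ : ∀ w {t ts} → t ∈ ts → wt w t ≤ wts w ts
wts-∈ w (here refl)        = m≤m+n _ _
wts-∈ w {ts = s ∷ ts} (there p) = ≤-trans (wts-∈ w p) (m≤n+m _ (wt w s))

+-swap : ∀ a b c d → (a + b) + (c + d) ≡ (a + c) + (b + d)
+-swap = solve 4 (λ a b c d → (a :+ b) :+ (c :+ d) := (a :+ c) :+ (b :+ d)) refl
  where open +-*-Solver

module _ (f g h : ℕ → ℕ) (eq : ∀ x → f x ≡ g x + h x) where
  wt-split  : ∀ t → wt f t ≡ wt g t + wt h t
  wts-split : ∀ ts → wts f ts ≡ wts g ts + wts h ts
  wt-split (node v ts) = trans (cong₂ _+_ (eq v) (wts-split ts)) (+-swap (g v) _ _ _)
  wts-split []       = refl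
  wts-split (t ∷ ts) = trans (cong₂ _+_ (wt-split t) (wts-split ts)) (+-swap (wt g t) _ _ _)

In-top : ∀ t → In (top t) t
In-top (node v ts) = mk (≤-trans (≤-reflexive (sym (δ-refl v))) (m≤m+n _ _))

In-node : ∀ {x v ts} → In x (node v ts) → x ≡ v ⊎ Ins x ts
In-node {x} {v} (mk p) with x ≟ v
... | yes eq  = inj₁ eq
... | no  x≢v rewrite δ-≢ x≢v = inj₂ (mk p)

In-kid : ∀ {x v ts} → Ins x ts → In x (node v ts)
In-kid {x} {v} (mk p) = mk (≤-trans p (m≤n+m _ (δ x v)))

In-∈ : ∀ {x t ts} → t ∈ ts → In x t → Ins x ts
In-∈ {x} t∈ (mk p) = mk (≤-trans p (wts-∈ (δ x) t∈))

Ins-here : ∀ {x t ts} → In x t → Ins x (t ∷ ts)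
Ins-here = In-∈ (here refl)

Ins-there : ∀ {x t ts} → Ins x ts → Ins x (t ∷ ts)
Ins-there {x} {t} (mk p) = mk (≤-trans p (m≤n+m _ (occ x t)))

Ins-∷ : ∀ {x} t {ts} → Ins x (t ∷ ts) → In x t ⊎ Ins x ts
Ins-∷ {x} t (mk p) with occ x t in eq
... | zero  = inj₂ (mk p)
... | suc _ = inj₁ (mk (subst (1 ≤_) (sym eq) (s≤s z≤n)))

Ins-∈ : ∀ {x ts} → Ins x ts → ∃ λ t → t ∈ ts × In x t
Ins-∈ {ts = t ∷ ts} p with Ins-∷ t p
... | inj₁ q = t , here refl , q
... | inj₂ q with s , s∈ , r ← Ins-∈ q = s , there s∈ , r
Ins-∈ {ts = []} (mk ())

In? : ∀ x t → Dec (In x t)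
In? x t = map′ mk pos (1 ≤? occ x t)

1≤-+ : ∀ {a b} → 1 ≤ a → 1 ≤ b → a + b ≤ 1 → ⊥
1≤-+ {suc a} {suc b} _ _ (s≤s p) rewrite +-suc a b = case p of λ ()

Simple-kids : ∀ {v ts} → Simple (node v ts) → Simples ts
Simple-kids {v} u = mk λ x → m+n≤o⇒n≤o (δ x v) (once u x)

Simples-tail : ∀ {t ts} → Simples (t ∷ ts) → Simples ts
Simples-tail {t} u = mk λ x → m+n≤o⇒n≤o (occ x t) (once u x)

In-unique : ∀ {x t t′ ts} → Simples ts → t ∈ ts → t′ ∈ ts → In x t → In x t′ → t ≡ t′
In-unique u (here refl) (here refl) p q = refl
In-unique {x} u (here refl) (there j)   p q = ⊥-elim (1≤-+ (pos p) (pos (In-∈ j q)) (once u x))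
In-unique {x} u (there i)   (here refl) p q = ⊥-elim (1≤-+ (pos q) (pos (In-∈ i p)) (once u x))
In-unique u (there i)   (there j)   p q = In-unique (Simples-tail u) i j p q

Simple-∈ : ∀ {t ts} → Simples ts → t ∈ ts → Simple t
Simple-∈ u t∈ = mk λ x → ≤-trans (wts-∈ (δ x) t∈) (once u x)

Simple-top : ∀ {v ts} → Simple (node v ts) → ¬ Ins v ts
Simple-top {v} u (mk p) = 1≤-+ (≤-reflexive (sym (δ-refl v))) p (once u v)

Simples-++ʳ : ∀ xs {ys} → Simples (xs ++ ys) → Simples ys
Simples-++ʳ xs u = mk λ x → m+n≤o⇒n≤o (occs x xs) (subst (_≤ 1) (wts-++ (δ x) xs) (once u x))

Simples-++ˡ : ∀ xs {ys} → Simples (xs ++ ys) → Simples xs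
Simples-++ˡ xs u = mk λ x → m+n≤o⇒m≤o (occs x xs) (subst (_≤ 1) (wts-++ (δ x) xs) (once u x))

-- Ascending forests and their division at a label

_≺_ : Tree → Tree → Set
s ≺ t = top s < top t

Asc : List Tree → Set
Asc = AllPairs _≺_

data Ord : Tree → Set where
  node : ∀ {v ts} → Asc ts → All Ord ts → Ord (node v ts)

Below Above : ℕ → List Tree → Set
Below r = All (λ t → top t < r)
Above r = All (λ t → r < top t)

Min : Tree → Set
Min (node r ts) = Above r ts

below above : ℕ → List Tree → List Tree
below r = filter (λ t → top t <? r)
above r = filter (λ t → r <? top t)

Below-below : ∀ r ts → Below r (below r ts)
Below-below r = All.all-filter (λ t → top t <? r)

Above-above : ∀ r ts → Above r (above r ts)
Above-above r = All.all-filter (λ t → r <? top t)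

below-all : ∀ {r xs} → Below r xs → below r xs ≡ xs
below-all {r} = filter-all (λ t → top t <? r)

below-none : ∀ {r xs} → Above r xs → below r xs ≡ []
below-none {r} p = filter-none (λ t → top t <? r) (All.map <-asym p)

above-all : ∀ {r xs} → Above r xs → above r xs ≡ xs
above-all {r} = filter-all (λ t → r <? top t)

above-none : ∀ {r xs} → Below r xs → above r xs ≡ []
above-none {r} p = filter-none (λ t → r <? top t) (All.map <-asym p)

below-++ : ∀ {r xs ys} → Below r xs → Above r ys → below r (xs ++ ys) ≡ xs
below-++ {r} {xs} {ys} p q = trans (filter-++ (λ t → top t <? r) xs ys)
  (trans (cong₂ _++_ (below-all p) (below-none q)) (++-identityʳ xs))

above-++ : ∀ {r xs ys} → Below r xs → Above r ys → above r (xs ++ ys) ≡ ys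
above-++ {r} {xs} {ys} p q = trans (filter-++ (λ t → r <? top t) xs ys)
  (cong₂ _++_ (above-none p) (above-all q))

below-above : ∀ {r ts} → Asc ts → ¬ Ins r ts → below r ts ++ above r ts ≡ ts
below-above {ts = []} _ _ = refl
below-above {r} {t ∷ ts} (a ∷ as) r∉ with <-cmp (top t) r
... | tri< t<r _ _ =
  trans (cong₂ _++_ (trans (filter-++ (λ s → top s <? r) [ t ] ts)
                           (cong (_++ below r ts) (below-all {r} {[ t ]} (t<r ∷ []))))
                    (trans (filter-++ (λ s → r <? top s) [ t ] ts)
                           (cong (_++ above r ts) (above-none {r} {[ t ]} (t<r ∷ [])))))
        (cong (t ∷_) (below-above as (r∉ ∘ Ins-there)))
... | tri≈ _ refl _ = contradiction (Ins-here (In-top t)) r∉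
... | tri> _ _ r<t = cong₂ _++_ (below-none ab) (above-all ab)
  where
  ab : Above r (t ∷ ts)
  ab = r<t ∷ All.map (<-trans r<t) a

Asc-below : ∀ r {ts} → Asc ts → Asc (below r ts)
Asc-below r = AllPairs.filter⁺ _

Asc-above : ∀ r {ts} → Asc ts → Asc (above r ts)
Asc-above r = AllPairs.filter⁺ _

All-below : ∀ {P : Tree → Set} r {ts} → All P ts → All P (below r ts)
All-below r = All.filter⁺ _

All-above : ∀ {P : Tree → Set} r {ts} → All P ts → All P (above r ts)
All-above r = All.filter⁺ _

Asc-++ : ∀ {r xs ys} → Asc xs → Asc ys → Below r xs → Above r ys → Asc (xs ++ ys)
Asc-++ p q x<r r<y = AllPairs.++⁺ p q (All.map (λ x< → All.map (<-trans x<) r<y) x<r)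

wts-below-above : ∀ w {r ts} → Asc ts → ¬ Ins r ts → wts w (below r ts) + wts w (above r ts) ≡ wts w ts
wts-below-above w {r} {ts} as r∉ = trans (sym (wts-++ w (below r ts))) (cong (wts w) (below-above as r∉))

-- Edges, subtrees and descendants in rose trees

data Edge (p c : ℕ) : Tree → Set where
  here  : ∀ {s ts} → s ∈ ts → top s ≡ c → Edge p c (node p ts)
  there : ∀ {v s ts} → s ∈ ts → Edge p c s → Edge p c (node v ts)

data Sub (s : Tree) : Tree → Set where
  self : Sub s s
  kid  : ∀ {v t ts} → t ∈ ts → Sub s t → Sub s (node v ts)

edge?  : ∀ p c t → Dec (Edge p c t)
edges? : ∀ p c ts → Dec (Any (Edge p c) ts)
edge? p c (node v ts) = map′
  (λ where
    (inj₁ (refl , a)) → let s , s∈ , eq = find a in here s∈ eq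
    (inj₂ a)          → let s , s∈ , e = find a in there s∈ e)
  (λ where
    (here s∈ eq) → inj₁ (refl , lose s∈ eq)
    (there s∈ e) → inj₂ (lose s∈ e))
  ((p ≟ v ×-dec Any.any? (λ s → top s ≟ c) ts) ⊎-dec edges? p c ts)
edges? p c []       = no λ ()
edges? p c (t ∷ ts) = map′ [ here , there ]′
  (λ where
    (here e)  → inj₁ e
    (there a) → inj₂ a)
  (edge? p c t ⊎-dec edges? p c ts)

Edge-parent : ∀ {p c t} → Edge p c t → In p t
Edge-parent (here {ts = ts} s∈ _) = In-top (node _ ts)
Edge-parent (there s∈ e)          = In-kid (In-∈ s∈ (Edge-parent e))

Ins-kids : ∀ {x} t → Ins x (kids t) → In x t
Ins-kids (node v ts) = In-kid

Edge-kids : ∀ {p c t} → Edge p c t → Ins c (kids t)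
Edge-kids (here {s} s∈ refl) = In-∈ s∈ (In-top s)
Edge-kids (there {s = s} s∈ e) = In-∈ s∈ (Ins-kids s (Edge-kids e))

Edge-child : ∀ {p c t} → Edge p c t → In c t
Edge-child {t = t} e = Ins-kids t (Edge-kids e)

Sub-In : ∀ {x s t} → Sub s t → In x s → In x t
Sub-In self       p = p
Sub-In (kid t∈ q) p = In-kid (In-∈ t∈ (Sub-In q p))

Sub-Edge : ∀ {p c s t} → Sub s t → Edge p c s → Edge p c t
Sub-Edge self       e = e
Sub-Edge (kid t∈ q) e = there t∈ (Sub-Edge q e)

Sub-kid : ∀ {v s ts t} → Sub (node v ts) t → s ∈ ts → Sub s t
Sub-kid self       s∈ = kid s∈ self
Sub-kid (kid t∈ q) s∈ = kid t∈ (Sub-kid q s∈)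

Sub-Simple : ∀ {s t} → Simple t → Sub s t → Simple s
Sub-Simple u self       = u
Sub-Simple u (kid t∈ q) = Sub-Simple (Simple-∈ (Simple-kids u) t∈) q

Sub-Ord : ∀ {s t} → Ord t → Sub s t → Ord s
Sub-Ord o          self       = o
Sub-Ord (node _ o) (kid t∈ q) = Sub-Ord (All.lookup o t∈) q

-- Labels are not repeated, so an edge whose parent occurs in the subtree `s` cannot be found
-- elsewhere in `t`.
Edge-in-Sub : ∀ {b c s t} → Simple t → Sub s t → In b s → Edge b c t → Edge b c s
Edge-in-Sub u self       p e = e
Edge-in-Sub u (kid t∈ q) p (here s∈ eq) = ⊥-elim (Simple-top u (In-∈ t∈ (Sub-In q p)))
Edge-in-Sub u (kid t∈ q) p (there s∈ e)
  with refl ← In-unique (Simple-kids u) t∈ s∈ (Sub-In q p) (Edge-parent e)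
  = Edge-in-Sub (Simple-∈ (Simple-kids u) t∈) q p e

Edge-top : ∀ {p t} → Simple t → ¬ Edge p (top t) t
Edge-top {t = node v ts} u e = Simple-top u (Edge-kids e)

Edge-unique : ∀ {p q c t} → Simple t → Edge p c t → Edge q c t → p ≡ q
Edge-unique u (here _ _) (here _ _) = refl
Edge-unique u (here {s} i refl) (there j e)
  with refl ← In-unique (Simple-kids u) i j (In-top s) (Edge-child e)
  = ⊥-elim (Edge-top (Simple-∈ (Simple-kids u) i) e)
Edge-unique u (there i e) (here {s} j refl)
  with refl ← In-unique (Simple-kids u) i j (Edge-child e) (In-top s)
  = ⊥-elim (Edge-top (Simple-∈ (Simple-kids u) i) e)
Edge-unique u (there i e) (there j f)
  with refl ← In-unique (Simple-kids u) i j (Edge-child e) (Edge-child f)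
  = Edge-unique (Simple-∈ (Simple-kids u) i) e f

In-edge  : ∀ {x} t → In x t → x ≡ top t ⊎ (∃ λ p → Edge p x t)
Ins-edge : ∀ {x} ts → Ins x ts → ∃ λ s → s ∈ ts × (x ≡ top s ⊎ (∃ λ p → Edge p x s))
In-edge (node v ts) i with In-node i
... | inj₁ refl = inj₁ refl
... | inj₂ j with Ins-edge ts j
... | s , s∈ , inj₁ eq      = inj₂ (v , here s∈ (sym eq))
... | s , s∈ , inj₂ (p , e) = inj₂ (p , there s∈ e)
Ins-edge []       (mk ())
Ins-edge (t ∷ ts) i with Ins-∷ t i
... | inj₁ j = t , here refl , In-edge t j
... | inj₂ j with s , s∈ , r ← Ins-edge ts j = s , there s∈ , r

-- Proper descent, phrased through subtrees instead of chains of edges, so that irreflexivity is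
-- just the absence of repeated labels.
Desc : ℕ → ℕ → Tree → Set
Desc a b t = ∃ λ s → Sub s t × top s ≡ a × Ins b (kids s)

Desc-step : ∀ {a b c t} → Simple t → Desc a b t → Edge b c t → Desc a c t
Desc-step u (s , q , eq , i) e = s , q , eq , Edge-kids (Edge-in-Sub u q (Ins-kids s i) e)

Edge-Desc : ∀ {p c t} → Edge p c t → Desc p c t
Edge-Desc (here {ts = ts} s∈ refl) = node _ ts , self , refl , In-∈ s∈ (In-top _)
Edge-Desc (there s∈ e) with s , q , r ← Edge-Desc e = s , kid s∈ q , r

Desc-irrefl : ∀ {a t} → Simple t → ¬ Desc a a t
Desc-irrefl u (node _ _ , q , refl , i) = Simple-top (Sub-Simple u q) i

Asc-ext : ∀ {xs ys} → Asc xs → Asc ys → (∀ {x} → x ∈ xs → x ∈ ys) → (∀ {y} → y ∈ ys → y ∈ xs) → xs ≡ ys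
Asc-ext {[]}    {[]}    _ _ _ _ = refl
Asc-ext {[]}    {_ ∷ _} _ _ _ g = case g (here refl) of λ ()
Asc-ext {_ ∷ _} {[]}    _ _ f _ = case f (here refl) of λ ()
Asc-ext {x ∷ xs} {y ∷ ys} (a ∷ as) (b ∷ bs) f g = go (f (here refl)) (g (here refl))
  where
  go : x ∈ y ∷ ys → y ∈ x ∷ xs → x ∷ xs ≡ y ∷ ys
  go (there i)   (there j)   = ⊥-elim (<-asym (All.lookup a j) (All.lookup b i))
  go (there i)   (here refl) = ⊥-elim (<-irrefl refl (All.lookup b i))
  go (here refl) _           = cong (x ∷_) (Asc-ext as bs
    (λ z∈ → case f (there z∈) of λ where
      (here refl) → ⊥-elim (<-irrefl refl (All.lookup a z∈))
      (there z∈′) → z∈′)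
    (λ z∈ → case g (there z∈) of λ where
      (here refl) → ⊥-elim (<-irrefl refl (All.lookup b z∈))
      (there z∈′) → z∈′))

Sub-child : ∀ {s t c} → Simple t → Sub s t → Edge (top s) c t → ∃ λ s′ → s′ ∈ kids s × top s′ ≡ c
Sub-child {node v ts} u q e with Edge-in-Sub u q (In-top (node v ts)) e
... | here s∈ eq  = _ , s∈ , eq
... | there s∈ e′ = ⊥-elim (Simple-top (Sub-Simple u q) (In-∈ s∈ (Edge-parent e′)))

size : Tree → ℕ
size = wt (λ _ → 1)

-- Edges give the set of children of each vertex, and the ascending order turns the set into the
-- list. The size bounds the recursion because children are reached only through membership proofs.
tree-ext : ∀ {t t′} → Ord t → Ord t′ → Simple t → Simple t′ → top t ≡ top t′ →
  (∀ {p c} → Edge p c t → Edge p c t′) → (∀ {p c} → Edge p c t′ → Edge p c t) → t ≡ t′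
tree-ext {t} {t′} o o′ u u′ eq f g = go (size t) t t′ ≤-refl self self eq
  where
  go : ∀ m s s′ → size s ≤ m → Sub s t → Sub s′ t′ → top s ≡ top s′ → s ≡ s′
  go (suc m) (node v ts) (node v ts′) (s≤s le) q q′ refl
    with node a _ ← Sub-Ord o q | node a′ _ ← Sub-Ord o′ q′
    = cong (node v) (Asc-ext a a′ there⇒ back)
    where
    le-∈ : ∀ {s} → s ∈ ts → size s ≤ m
    le-∈ s∈ = ≤-trans (wts-∈ (λ _ → 1) s∈) le
    there⇒ : ∀ {s} → s ∈ ts → s ∈ ts′
    there⇒ {s} s∈ with s′ , s′∈ , e ← Sub-child u′ q′ (f (Sub-Edge q (here s∈ refl)))
      = subst (_∈ ts′) (sym (go m s s′ (le-∈ s∈) (Sub-kid q s∈) (Sub-kid q′ s′∈) (sym e))) s′∈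
    back : ∀ {s} → s ∈ ts′ → s ∈ ts
    back {s′} s′∈ with s , s∈ , e ← Sub-child u q (g (Sub-Edge q′ (here s′∈ refl)))
      = subst (_∈ ts) (go m s s′ (le-∈ s∈) (Sub-kid q s∈) (Sub-kid q′ s′∈) e) s∈

-- Walks in a graph represented by a rose tree

Unique-reverse : ∀ {A : Set} {xs : List A} → Unique xs → Unique (reverse xs)
Unique-reverse {xs = []}     []       = []
Unique-reverse {xs = x ∷ xs} (a ∷ as) = subst Unique (sym (unfold-reverse x xs))
  (AllPairs.++⁺ (Unique-reverse as) ([] ∷ [])
    (All.tabulate λ y∈ → (λ { refl → All.lookup a (Any.reverse⁻ y∈) refl }) ∷ []))

lookup-injective : ∀ {A : Set} {xs : List A} → Unique xs → ∀ {i j} → lookup xs i ≡ lookup xs j → i ≡ j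
lookup-injective (a ∷ as) {zero}  {zero}  eq = refl
lookup-injective (a ∷ as) {zero}  {suc j} eq = ⊥-elim (All.lookup a (∈-lookup j) eq)
lookup-injective (a ∷ as) {suc i} {zero}  eq = ⊥-elim (All.lookup a (∈-lookup i) (sym eq))
lookup-injective (a ∷ as) {suc i} {suc j} eq = cong suc (lookup-injective as eq)

Unique-length : ∀ {n} {xs : List (Fin n)} → Unique xs → length xs ≤ n
Unique-length u = injective⇒≤ (lookup-injective u)

Linked-last : ∀ {A : Set} {R : A → A → Set} ws {p c} → Linked R (ws ++ p ∷ c ∷ []) → R p c
Linked-last []           (r ∷ _)  = r
Linked-last (_ ∷ [])     (_ ∷ rs) = Linked-last [] rs
Linked-last (_ ∷ w ∷ ws) (_ ∷ rs) = Linked-last (w ∷ ws) rs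

module _ {n} (g : Graph n) where
  open Graph g

  Walk-last : ∀ {u v ws} → Walk u v ws → v ∈ ws
  Walk-last (here _)   = here refl
  Walk-last (step _ w) = there (Walk-last w)

  Walk-snoc : ∀ {u v w ws} → Walk u v ws → v ~ w → Walk u w (ws ++ [ w ])
  Walk-snoc (here _)   a = step a (here (~-vertex (~-sym a)))
  Walk-snoc (step b w) a = step b (Walk-snoc w a)

  Walk-reverse : ∀ {u v ws} → Walk u v ws → Walk v u (reverse ws)
  Walk-reverse (here u∈) = here u∈
  Walk-reverse (step {u} {ws = ws} a w) = subst (Walk _ _) (sym (unfold-reverse u ws))
    (Walk-snoc (Walk-reverse w) (~-sym a))

  Walk-trans : ∀ {u v w ws ws′} → Walk u v ws → Walk v w ws′ → ∃ λ ws″ → Walk u w ws″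
  Walk-trans (here _)   w′ = _ , w′
  Walk-trans (step a w) w′ = _ , step a (proj₂ (Walk-trans w w′))

  Path-loop : ∀ {v ws} → Path v v ws → length ws ≤ 1
  Path-loop (here _   , _)     = s≤s z≤n
  Path-loop (step _ w , a ∷ _) = ⊥-elim (All.lookup a (Walk-last w) refl)

-- No root of `g` is mentioned: `toGraph` satisfies this before any `RootedTree` exists, and
-- connectedness and acyclicity are then derived from it.
record GRep {n} (g : Graph n) (t : Tree) : Set where
  open Graph g
  field
    ord    : Ord t
    simple : Simple t
    bound  : ∀ {x} → In x t → x < n
    vert→  : ∀ {v} → v Subset.∈ vertices → In (toℕ v) t
    vert←  : ∀ {v} → In (toℕ v) t → v Subset.∈ vertices
    adj→   : ∀ {u v} → u ~ v → Edge (toℕ u) (toℕ v) t ⊎ Edge (toℕ v) (toℕ u) t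
    adj←   : ∀ {u v} → Edge (toℕ u) (toℕ v) t → u ~ v

module _ {n} {g : Graph n} {t : Tree} (R : GRep g t) where
  open Graph g
  open GRep R

  private
    E : Fin n → Fin n → Set
    E u v = Edge (toℕ u) (toℕ v) t

  vertex : ∀ {x} → In x t → ∃ λ v → toℕ v ≡ x
  vertex i = fromℕ< (bound i) , toℕ-fromℕ< (bound i)

  E-unique : ∀ {u v c} → E u c → E v c → u ≡ v
  E-unique e f = toℕ-injective (Edge-unique simple e f)

  -- In a tree a path that does not start with a step towards the root never turns back to it.
  downhill : ∀ {u v ws} → Walk u v ws → Unique ws → (∀ {x} → E x u → x ∉ ws) → Linked E ws
  downhill (here _) _ _ = [-]
  downhill (step a (here w∈)) _ nb with adj→ a
  ... | inj₁ e = e ∷ [-]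
  ... | inj₂ e = ⊥-elim (nb e (there (here refl)))
  downhill (step a w@(step b _)) (u≢ ∷ uq) nb with adj→ a
  ... | inj₁ e = e ∷ downhill w uq (λ f x∈ → All.lookup u≢ x∈ (E-unique e f))
  ... | inj₂ e = ⊥-elim (nb e (there (here refl)))

  Desc-walk : ∀ {a u v ws} → Walk u v ws → Linked E ws → Desc a (toℕ u) t → Desc a (toℕ v) t
  Desc-walk (here _)               _        d = d
  Desc-walk (step _ w@(here _))    (e ∷ es) d = Desc-walk w es (Desc-step simple d e)
  Desc-walk (step _ w@(step _ _))  (e ∷ es) d = Desc-walk w es (Desc-step simple d e)

  -- If the path starts downwards, it never turns back, so `v` descends from `u` and the edge to `u`
  -- makes `u` its own descendant. If it starts upwards, it goes to the only parent of `u`, which is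
  -- `v`, and cannot continue.
  acyclic-down : ∀ {u v ws} → Path u v ws → 3 ≤ length ws → ¬ E v u
  acyclic-down (here _ , _) (s≤s ())
  acyclic-down (step a w , u≢ ∷ uq) (s≤s le) e with adj→ a
  ... | inj₁ f = Desc-irrefl simple
    (Desc-step simple (Desc-walk w (downhill w uq λ h x∈ → All.lookup u≢ x∈ (E-unique f h)) (Edge-Desc f)) e)
  ... | inj₂ f with refl ← E-unique e f = <-irrefl refl (≤-trans le (Path-loop g (w , uq)))

  GRep-acyclic : Acyclic
  GRep-acyclic {ws = ws} (w , uq) le a with adj→ a
  ... | inj₁ e = acyclic-down (w , uq) le e
  ... | inj₂ e = acyclic-down (Walk-reverse g w , Unique-reverse uq) (subst (3 ≤_) (sym (length-reverse ws)) le) e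

  descend : ∀ {p c s} → Edge (toℕ p) (toℕ c) s → Sub s t → ∀ v → toℕ v ≡ top s →
    ∃ λ ws → Path v c (ws ++ p ∷ c ∷ []) × All (λ x → In (toℕ x) s) (ws ++ p ∷ c ∷ [])
  descend {p} {c} e@(here s∈ eq) q v eqv with refl ← toℕ-injective eqv =
    [] , (step (adj← (Sub-Edge q e)) (here (vert← (Sub-In q (Edge-child e))))
       , ((λ { refl → Edge-top (Sub-Simple simple q) e }) ∷ []) ∷ [] ∷ [])
       , Edge-parent e ∷ Edge-child e ∷ []
  descend {s = node _ _} (there {s = s} s∈ e) q v eqv
    with v′ , eqv′ ← vertex (Sub-In (Sub-kid q s∈) (In-top s))
    with ws , (w , uq) , ins ← descend e (Sub-kid q s∈) v′ eqv′
    = v ∷ ws , (step (adj← (Sub-Edge q (subst (λ x → Edge x (toℕ v′) _) (sym eqv) (here s∈ (sym eqv′))))) w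
      , All.map (λ { i refl → Simple-top (Sub-Simple simple q) (In-∈ s∈ (subst (λ x → In x s) eqv i)) }) ins ∷ uq)
    , subst (λ x → In x _) (sym eqv) (In-top (node _ _)) ∷ All.map (In-kid ∘ In-∈ s∈) ins

  from-root : ∀ {r v} → toℕ r ≡ top t → v Subset.∈ vertices → ∃ λ ws → Walk r v ws
  from-root {r} {v} eq v∈ with In-edge t (vert→ v∈)
  ... | inj₁ eq′ with refl ← toℕ-injective (trans eq (sym eq′)) = _ , here v∈
  ... | inj₂ (p , e) with p′ , refl ← vertex (Edge-parent e)
    with ws , (w , _) , _ ← descend e self r eq = _ , w

  GRep-connected : Connected
  GRep-connected u∈ v∈ with r , eq ← vertex (In-top t)
    = Walk-trans g (Walk-reverse g (proj₂ (from-root eq u∈))) (proj₂ (from-root eq v∈))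

record Rep {n} (G : RootedTree n) (t : Tree) : Set where
  field
    grep  : GRep (RootedTree.graph G) t
    root≡ : toℕ (RootedTree.root G) ≡ top t
  open GRep grep public

module _ {n} {G : RootedTree n} {t : Tree} (R : Rep G t) where
  open RootedTree G
  open Rep R

  Edge⇒IsChild : ∀ {p c} → Edge (toℕ p) (toℕ c) t → IsChild c p
  Edge⇒IsChild e with ws , w , _ ← descend grep e self root root≡ = ws , w

  -- The root has no parent, so a path from it only goes down, and its last step is the edge in
  -- question.
  IsChild⇒Edge : ∀ {p c} → IsChild c p → Edge (toℕ p) (toℕ c) t
  IsChild⇒Edge (ws , w , uq) = Linked-last ws
    (downhill grep w uq λ e _ → Edge-top simple (subst (λ x → Edge _ x t) root≡ e))

-- From rose trees to rooted trees

record Good (n : ℕ) (t : Tree) : Set where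
  constructor good
  field
    ord    : Ord t
    simple : Simple t
    bound  : ∀ {x} → In x t → x < n

∈-tabulate⁺ : ∀ {n} {f : Fin n → Bool} {i} → f i ≡ true → i Subset.∈ Vec.tabulate f
∈-tabulate⁺ {f = f} {i} eq = Vec.lookup⇒[]= i _ (trans (Vec.lookup∘tabulate f i) eq)

∈-tabulate⁻ : ∀ {n} {f : Fin n → Bool} {i} → i Subset.∈ Vec.tabulate f → f i ≡ true
∈-tabulate⁻ {f = f} {i} i∈ = trans (sym (Vec.lookup∘tabulate f i)) (Vec.[]=⇒lookup i∈)

does-true : ∀ {A : Set} (d : Dec A) → A → ⌊ d ⌋ ≡ true
does-true (yes _) _ = refl
does-true (no ¬a) a = contradiction a ¬a

does-true⁻ : ∀ {A : Set} (d : Dec A) → ⌊ d ⌋ ≡ true → A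
does-true⁻ (yes a) _ = a

toGraph : ∀ {n t} → Good n t → Graph n
toGraph {n} {t} (good o u b) = record
  { vertices = Vec.tabulate λ v → ⌊ In? (toℕ v) t ⌋
  ; adj      = λ u v → ⌊ edge? (toℕ u) (toℕ v) t ⊎-dec edge? (toℕ v) (toℕ u) t ⌋
  ; ~-sym    = λ e → fromWitness (swap (toWitness e))
  ; ~-irrefl = λ e → [ irr , irr ]′ (toWitness e)
  ; ~-vertex = λ e → ∈-tabulate⁺ (does-true (In? _ t) ([ Edge-parent , Edge-child ]′ (toWitness e)))
  }
  where
  irr : ∀ {x} → ¬ Edge x x t
  irr e = Desc-irrefl u (Edge-Desc e)

toGraph-GRep : ∀ {n t} (G : Good n t) → GRep (toGraph G) t
toGraph-GRep {t = t} (good o u b) = record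
  { ord    = o
  ; simple = u
  ; bound  = b
  ; vert→  = λ v∈ → does-true⁻ (In? _ t) (∈-tabulate⁻ v∈)
  ; vert←  = λ i → ∈-tabulate⁺ (does-true (In? _ t) i)
  ; adj→   = toWitness
  ; adj←   = λ e → fromWitness (inj₁ e)
  }

toRootedTree : ∀ {n t} → Good n t → RootedTree n
toRootedTree {t = t} G@(good o u b) = record
  { graph     = toGraph G
  ; root      = fromℕ< (b (In-top t))
  ; root∈     = GRep.vert← (toGraph-GRep G) (subst (λ x → In x t) (sym (toℕ-fromℕ< (b (In-top t)))) (In-top t))
  ; connected = GRep-connected (toGraph-GRep G)
  ; acyclic   = GRep-acyclic (toGraph-GRep G)
  }

toRootedTree-Rep : ∀ {n t} (G : Good n t) → Rep (toRootedTree G) t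
toRootedTree-Rep {t = t} G@(good o u b) = record { grep = toGraph-GRep G ; root≡ = toℕ-fromℕ< (b (In-top t)) }

-- From rooted trees to rose trees

δ≤1 : ∀ v x → δ v x ≤ 1
δ≤1 v x with v ≟ x
... | yes refl = ≤-reflexive (δ-refl v)
... | no  v≢x  = ≤-trans (≤-reflexive (δ-≢ v≢x)) z≤n

¬In⇒0 : ∀ {x t} → ¬ In x t → occ x t ≡ 0
¬In⇒0 ¬i = n<1⇒n≡0 (≰⇒> (¬i ∘ mk))

¬Ins⇒0 : ∀ {x ts} → ¬ Ins x ts → occs x ts ≡ 0
¬Ins⇒0 ¬i = n<1⇒n≡0 (≰⇒> (¬i ∘ mk))

module _ {n} (G : RootedTree n) where
  open RootedTree G

  -- NB p v ws: the list ws is a walk without immediate backtracking, read backwards from its last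
  -- vertex v, whose predecessor is p.  By acyclicity such a walk repeats no vertex.
  data NB : Fin n → Fin n → List (Fin n) → Set where
    edge : ∀ {u v} → u ~ v → NB u v (v ∷ u ∷ [])
    step : ∀ {p v c ws} → NB p v ws → v ~ c → c ≢ p → NB v c (c ∷ ws)

  NB-head : ∀ {p v ws} → NB p v ws → ∃ λ zs → ws ≡ v ∷ p ∷ zs
  NB-head (edge _)     = _ , refl
  NB-head (step r _ _) with _ , refl ← NB-head r = _ , refl

  NB-Walk : ∀ {p v c ws} → NB p v ws → c ∈ ws → ∃₂ λ us zs → ws ≡ us ++ zs × Walk v c us
  NB-Walk (edge a) (here refl)         = _ , _ , refl , here (~-vertex (~-sym a))
  NB-Walk (edge a) (there (here refl)) = _ , [] , refl , step (~-sym a) (here (~-vertex a))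
  NB-Walk (step r a _) (here refl) = _ , _ , refl , here (~-vertex (~-sym a))
  NB-Walk (step r a _) (there c∈) with us , zs , refl , w ← NB-Walk r c∈ = _ , zs , refl , step (~-sym a) w

  Unique-++ˡ : ∀ us {zs : List (Fin n)} → Unique (us ++ zs) → Unique us
  Unique-++ˡ []       _        = []
  Unique-++ˡ (u ∷ us) (a ∷ as) = All.++⁻ˡ us a ∷ Unique-++ˡ us as

  -- If the new vertex `c` had been visited before, it would be `v`, giving a loop, or `p`, giving a
  -- step back, or an earlier vertex, giving a graph cycle.
  NB-Unique : ∀ {p v ws} → NB p v ws → Unique ws
  NB-Unique (edge a) = ((λ { refl → ~-irrefl a }) ∷ []) ∷ [] ∷ []
  NB-Unique (step {p} {v} {c} r a c≢p) = All.tabulate (λ x∈ → λ { refl → c∉ x∈ }) ∷ NB-Unique r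
    where
    c∉ : c ∉ _
    c∉ c∈ with NB-head r | NB-Walk r c∈
    ... | _ | _ , _ , _ , here _ = ~-irrefl a
    ... | _ , refl | _ , _ , eq , step _ (here _) = c≢p (sym (∷-injectiveˡ (∷-injectiveʳ eq)))
    ... | _ | us , zs , refl , w@(step _ (step _ w′)) =
      acyclic (w , Unique-++ˡ us (NB-Unique r)) (long w′) (~-sym a)
      where
      long : ∀ {x y ws} → Walk x y ws → 3 ≤ suc (suc (length ws))
      long (here _)   = ≤-refl
      long (step _ _) = s≤s (s≤s (s≤s z≤n))

  nbrs : Fin n → Fin n → List (Fin n)
  nbrs p v = filter (λ c → T? (adj v c) ×-dec ¬? (c Fin.≟ p)) (allFin n)

  ∈-nbrs⁻ : ∀ {p v c} → c ∈ nbrs p v → v ~ c × c ≢ p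
  ∈-nbrs⁻ {p} {v} c∈ = proj₂ (∈-filter⁻ (λ c → T? (adj v c) ×-dec ¬? (c Fin.≟ p)) {xs = allFin n} c∈)

  ∈-nbrs⁺ : ∀ {p v c} → v ~ c → c ≢ p → c ∈ nbrs p v
  ∈-nbrs⁺ {p} {v} {c} a c≢p = ∈-filter⁺ (λ c → T? (adj v c) ×-dec ¬? (c Fin.≟ p)) (∈-allFin c) (a , c≢p)

  -- The first argument is fuel: the depth up to which the branch at v, seen from p, is explored.
  build : ℕ → Fin n → Fin n → Tree
  build zero    p v = node (toℕ v) []
  build (suc m) p v = node (toℕ v) (map (build m v) (nbrs p v))

  build-top : ∀ m p v → top (build m p v) ≡ toℕ v
  build-top zero    p v = refl
  build-top (suc m) p v = refl

  data InBuild (x : ℕ) : ℕ → Fin n → Fin n → Set where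
    this : ∀ {m p v} → x ≡ toℕ v → InBuild x m p v
    next : ∀ {m p v c} → v ~ c → c ≢ p → InBuild x m v c → InBuild x (suc m) p v

  Ins-build : ∀ {x m v cs} → Ins x (map (build m v) cs) → ∃ λ c → c ∈ cs × In x (build m v c)
  Ins-build i with _ , t∈ , j ← Ins-∈ i with c , c∈ , refl ← ∈-map⁻ _ t∈ = c , c∈ , j

  inBuild : ∀ {x} m p v → In x (build m p v) → InBuild x m p v
  inBuild zero p v i with In-node i
  ... | inj₁ eq     = this eq
  ... | inj₂ (mk ())
  inBuild (suc m) p v i with In-node i
  ... | inj₁ eq = this eq
  ... | inj₂ j with c , c∈ , k ← Ins-build j with a , c≢p ← ∈-nbrs⁻ c∈ = next a c≢p (inBuild m v c k)

  build-up : ∀ {x m p v} → p ~ v → InBuild x m p v → ∃₂ λ i ws → toℕ i ≡ x × NB v p ws × i ∈ ws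
  build-up a (this eq) = _ , _ , sym eq , edge (~-sym a) , there (here refl)
  build-up a (next b c≢p r) with i , ws , eq , w , i∈ ← build-up b r
    = i , _ , eq , step w (~-sym a) (c≢p ∘ sym) , there i∈

  build-down : ∀ {x m p v y zs} → NB p v (v ∷ zs) → y ∈ zs → InBuild x m p v →
    ∃ λ i → toℕ i ≡ x × ∃₂ λ q us → NB q i (i ∷ us) × y ∈ us
  build-down w y∈ (this eq)      = _ , sym eq , _ , _ , w , y∈
  build-down w y∈ (next a c≢p r) = build-down (step w a c≢p) (there y∈) r

  -- Continuing the walk inside the branch down to `x` would visit `x` twice.
  NB-again : ∀ {x p v zs m} → NB p v (v ∷ zs) → InBuild (toℕ x) m p v → x ∉ zs
  NB-again w r x∈ with i , eq , q , us , w′ , i∈ ← build-down w x∈ r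
    with refl ← toℕ-injective eq | a ∷ _ ← NB-Unique w′ = All.lookup a i∈ refl

  build-parent : ∀ {m v c} → v ~ c → ¬ In (toℕ v) (build m v c)
  build-parent {m} {v} {c} a i = NB-again (edge a) (inBuild m v c i) (here refl)

  -- From a common label a walk leads up through `c` to `v` and down through `c′` to the same label
  -- again, never stepping back.
  build-disjoint : ∀ {x m m′ v c c′} → v ~ c → v ~ c′ → c ≢ c′ → In x (build m v c) → ¬ In x (build m′ v c′)
  build-disjoint {m = m} {m′} a a′ c≢ i j with i , ws , refl , w , i∈ ← build-up a (inBuild m _ _ i)
    = NB-again (step w a′ (c≢ ∘ sym)) (inBuild m′ _ _ j) i∈

  allFin-Unique : Unique (allFin n)
  allFin-Unique = AllPairs.tabulate⁺ id

  build-Simple : ∀ m p v → Simple (build m p v)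
  build-Simple zero p v = mk λ x → subst (_≤ 1) (sym (+-identityʳ _)) (δ≤1 x (toℕ v))
  build-Simple (suc m) p v = mk go
    where
    sum : ∀ x cs → Unique cs → (∀ {c} → c ∈ cs → v ~ c) → occs x (map (build m v) cs) ≤ 1
    sum x []       _        _ = z≤n
    sum x (c ∷ cs) (a ∷ as) f with In? x (build m v c)
    ... | no ¬i rewrite ¬In⇒0 ¬i = sum x cs as (f ∘ there)
    ... | yes i = subst (λ z → occ x (build m v c) + z ≤ 1)
      (sym (¬Ins⇒0 λ j → let c′ , c′∈ , k = Ins-build {m = m} {v} {cs} j in
        build-disjoint {m = m} {m} (f (here refl)) (f (there c′∈)) (All.lookup a c′∈) i k))
      (subst (_≤ 1) (sym (+-identityʳ _)) (once (build-Simple m v c) x))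
    go : ∀ x → occ x (build (suc m) p v) ≤ 1
    go x with x ≟ toℕ v
    ... | yes refl = subst (λ z → δ x x + z ≤ 1)
      (sym (¬Ins⇒0 λ j → let c , c∈ , k = Ins-build {m = m} {v} {nbrs p v} j in
        build-parent {m} (proj₁ (∈-nbrs⁻ {p} c∈)) k))
      (subst (_≤ 1) (sym (+-identityʳ _)) (δ≤1 x x))
    ... | no x≢v rewrite δ-≢ x≢v = sum x (nbrs p v) (AllPairs.filter⁺ _ allFin-Unique) (proj₁ ∘ ∈-nbrs⁻)

  build-Ord : ∀ m p v → Ord (build m p v)
  build-Ord zero    p v = node [] []
  build-Ord (suc m) p v = node
    (AllPairs.map⁺ (AllPairs.filter⁺ _ (AllPairs.map
      (λ {i} {j} → subst₂ _<_ (sym (build-top m v i)) (sym (build-top m v j))) ascending)))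
    (All.map⁺ (All.tabulate λ {c} _ → build-Ord m v c))
    where
    ascending : AllPairs Fin._<_ (allFin n)
    ascending = AllPairs.tabulate⁺-< id

  build-vertex : ∀ {x m p v} → v Subset.∈ vertices → InBuild x m p v → ∃ λ i → toℕ i ≡ x × i Subset.∈ vertices
  build-vertex v∈ (this eq)    = _ , sym eq , v∈
  build-vertex v∈ (next a _ r) = build-vertex (~-vertex (~-sym a)) r

  build-adj : ∀ {a b} m p v → Edge a b (build m p v) → ∃₂ λ u w → toℕ u ≡ a × toℕ w ≡ b × u ~ w
  build-adj zero p v (here () _)
  build-adj zero p v (there () _)
  build-adj (suc m) p v (here s∈ eq) with c , c∈ , refl ← ∈-map⁻ _ s∈
    = v , c , refl , trans (sym (build-top m v c)) eq , proj₁ (∈-nbrs⁻ c∈)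
  build-adj (suc m) p v (there s∈ e) with c , c∈ , refl ← ∈-map⁻ _ s∈ = build-adj m v c e

  build-edge : ∀ {m p v c} → v ~ c → c ≢ p → Edge (toℕ v) (toℕ c) (build (suc m) p v)
  build-edge {m} {p} {v} {c} a c≢p = here (∈-map⁺ (build m v) (∈-nbrs⁺ a c≢p)) (build-top m v c)

  -- The walk `ws` repeats no vertex, so it has length at most `n`, and `n < length ws + m` prevents
  -- the fuel from running out before the branch is complete. Only the edge from `v` back to `p`
  -- lies outside the branch.
  build-closed : ∀ {m p v ws x y} → NB p v ws → n < length ws + m → InBuild (toℕ x) m p v → x ~ y →
    (Edge (toℕ x) (toℕ y) (build m p v) ⊎ Edge (toℕ y) (toℕ x) (build m p v)) ⊎ (x ≡ v × y ≡ p)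
  build-closed {zero} w lt _ _ = ⊥-elim (<⇒≱ lt (subst (_≤ n) (sym (+-identityʳ _)) (Unique-length (NB-Unique w))))
  build-closed {suc m} {p} {v} {y = y} w lt (this eq) a with refl ← toℕ-injective eq with y Fin.≟ p
  ... | yes y≡p = inj₂ (refl , y≡p)
  ... | no  y≢p = inj₁ (inj₁ (build-edge a y≢p))
  build-closed {suc m} {p} {v} {ws} w lt (next {c = c} b c≢p r) a
    with build-closed (step w b c≢p) (subst (n <_) (+-suc (length ws) m) lt) r a
  ... | inj₁ (inj₁ e) = inj₁ (inj₁ (there (∈-map⁺ (build m v) (∈-nbrs⁺ b c≢p)) e))
  ... | inj₁ (inj₂ e) = inj₁ (inj₂ (there (∈-map⁺ (build m v) (∈-nbrs⁺ b c≢p)) e))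
  ... | inj₂ (refl , refl) = inj₁ (inj₂ (build-edge b c≢p))

  -- The root serves as its own predecessor; this excludes none of its neighbours, as there are no
  -- loops.
  toTree : Tree
  toTree = build (suc n) root root

  toTree-closed : ∀ {x y} → In (toℕ x) toTree → x ~ y → Edge (toℕ x) (toℕ y) toTree ⊎ Edge (toℕ y) (toℕ x) toTree
  toTree-closed i a with inBuild (suc n) root root i
  ... | this eq with refl ← toℕ-injective eq = inj₁ (build-edge a λ { refl → ~-irrefl a })
  ... | next b c≢p r with build-closed (edge b) (≤-trans (n≤1+n _) ≤-refl) r a
  ... | inj₁ (inj₁ e) = inj₁ (there (∈-map⁺ (build n root) (∈-nbrs⁺ b c≢p)) e)
  ... | inj₁ (inj₂ e) = inj₂ (there (∈-map⁺ (build n root) (∈-nbrs⁺ b c≢p)) e)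
  ... | inj₂ (refl , refl) = inj₂ (build-edge b c≢p)

  toTree-walk : ∀ {u v ws} → Walk u v ws → In (toℕ u) toTree → In (toℕ v) toTree
  toTree-walk (here _)   i = i
  toTree-walk (step a w) i = toTree-walk w ([ Edge-child , Edge-parent ]′ (toTree-closed i a))

  toTree-complete : ∀ {v} → v Subset.∈ vertices → In (toℕ v) toTree
  toTree-complete v∈ = toTree-walk (proj₂ (connected root∈ v∈)) (In-top toTree)

  toTree-vertex : ∀ {x} → In x toTree → ∃ λ i → toℕ i ≡ x × i Subset.∈ vertices
  toTree-vertex i = build-vertex root∈ (inBuild (suc n) root root i)

  toTree-Rep : Rep G toTree
  toTree-Rep = record
    { grep = record
      { ord    = build-Ord (suc n) root root
      ; simple = build-Simple (suc n) root root
      ; bound  = λ i → let j , eq , _ = toTree-vertex i in subst (_< n) eq (toℕ<n j)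
      ; vert→  = toTree-complete
      ; vert←  = λ i → let j , eq , j∈ = toTree-vertex i in subst (Subset._∈ vertices) (toℕ-injective eq) j∈
      ; adj→   = λ a → toTree-closed (toTree-complete (~-vertex a)) a
      ; adj←   = λ e → let u , w , eq , eq′ , a = build-adj (suc n) root root e in
                   subst₂ _~_ (toℕ-injective eq) (toℕ-injective eq′) a
      }
    ; root≡ = refl
    }

Simples-[_] : ∀ {t} → Simple t → Simples [ t ]
Simples-[ u ] = mk λ x → subst (_≤ 1) (sym (+-identityʳ _)) (once u x)

Simples-resp : ∀ {xs ys} → (∀ w → wts w xs ≡ wts w ys) → Simples xs → Simples ys
Simples-resp eq u = mk λ x → subst (_≤ 1) (eq (δ x)) (once u x)

Ins-resp : ∀ {x xs ys} → (∀ w → wts w xs ≡ wts w ys) → Ins x xs → Ins x ys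
Ins-resp eq (mk p) = mk (subst (1 ≤_) (eq _) p)

Simples-disjoint : ∀ {x} xs {ys} → Simples (xs ++ ys) → Ins x xs → ¬ Ins x ys
Simples-disjoint {x} xs u (mk p) (mk q) = 1≤-+ p q (subst (_≤ 1) (wts-++ (δ x) xs) (once u x))

Simples-∷ : ∀ {x t ts} → Simples (t ∷ ts) → In x t → ¬ Ins x ts
Simples-∷ {t = t} u i = Simples-disjoint [ t ] u (Ins-here i)

top∈ : ∀ {t ts} → t ∈ ts → Ins (top t) ts
top∈ {t} t∈ = In-∈ t∈ (In-top t)

-- Decreasing forests of minimally rooted trees

-- The roots of F below the root of N become children of N.  This identifies the pairs of a minimally
-- rooted tree and an ascending forest with the nonempty ascending forests, so that dec identifies
-- the sequences of minimally rooted trees with the ascending forests.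
ins : Tree → List Tree → List Tree
ins (node r ls) F = node r (below r F ++ ls) ∷ above r F

dec : List Tree → List Tree
dec = foldr ins []

-- Inverse to `dec` on one tree: the root keeps its larger children, and the codes of the smaller
-- ones follow. `encB r` fuses `encs` with `below r`, which makes the recursion structural.
enc  : Tree → List Tree
encB : ℕ → List Tree → List Tree
enc (node r cs) = node r (above r cs) ∷ encB r cs
encB r []       = []
encB r (c ∷ cs) = if top c <ᵇ r then enc c ++ encB r cs else encB r cs

encs : List Tree → List Tree
encs []       = []
encs (t ∷ ts) = enc t ++ encs ts

encB-below : ∀ r cs → encB r cs ≡ encs (below r cs)
encB-below r []       = refl
encB-below r (c ∷ cs) with top c <ᵇ r
... | true  = cong (enc c ++_) (encB-below r cs)
... | false = encB-below r cs

encs-++ : ∀ xs ys → encs (xs ++ ys) ≡ encs xs ++ encs ys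
encs-++ []       ys = refl
encs-++ (x ∷ xs) ys = trans (cong (enc x ++_) (encs-++ xs ys)) (sym (++-assoc (enc x) _ _))

wts-ins : ∀ w N {F} → Asc F → ¬ Ins (top N) F → wts w (ins N F) ≡ wt w N + wts w F
wts-ins w (node r ls) {F} as r∉ = trans
  (cong (λ x → w r + x + wts w (above r F)) (wts-++ w (below r F)))
  (trans (lemma (w r) (wts w (below r F)) (wts w ls) (wts w (above r F)))
         (cong (w r + wts w ls +_) (wts-below-above w as r∉)))
  where
  open +-*-Solver
  lemma : ∀ a b c d → a + (b + c) + d ≡ a + c + (b + d)
  lemma = solve 4 (λ a b c d → a :+ (b :+ c) :+ d := a :+ c :+ (b :+ d)) refl

Asc-ins : ∀ N {F} → Asc F → Asc (ins N F)
Asc-ins (node r ls) {F} as = Above-above r F ∷ Asc-above r as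

Ord-ins : ∀ {N F} → Ord N → Min N → Asc F → All Ord F → All Ord (ins N F)
Ord-ins {node r ls} {F} (node a o) m as os =
  node (Asc-++ (Asc-below r as) a (Below-below r F) m) (All.++⁺ (All-below r os) o) ∷ All-above r os

-- Undoes `ins`: the children of `t` below its root are released. They precede the roots of `ts`, so
-- the released forest is again ascending.
cut : ∀ {t ts} → Ord t → Simple t → Asc (t ∷ ts) → All Ord ts →
  ∃₂ λ N F → t ∷ ts ≡ ins N F × Min N × Ord N × Asc F × All Ord F × (∀ w → wt w N + wts w F ≡ wts w (t ∷ ts))
cut {node r cs} {ts} (node a o) u (b ∷ bs) os =
  node r (above r cs) , below r cs ++ ts ,
  cong₂ (λ x y → node r x ∷ y)
    (sym (trans (cong (_++ above r cs) (below-++ (Below-below r cs) b)) (below-above a (Simple-top u))))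
    (sym (above-++ (Below-below r cs) b)) ,
  Above-above r cs , node (Asc-above r a) (All-above r o) ,
  Asc-++ (Asc-below r a) bs (Below-below r cs) b , All.++⁺ (All-below r o) os ,
  λ w → trans (cong (w r + wts w (above r cs) +_) (wts-++ w (below r cs)))
    (trans (lemma (w r) (wts w (above r cs)) (wts w (below r cs)) (wts w ts))
           (cong (λ x → w r + x + wts w ts) (wts-below-above w a (Simple-top u))))
  where
  open +-*-Solver
  lemma : ∀ a b c d → a + b + (c + d) ≡ a + (c + b) + d
  lemma = solve 4 (λ a b c d → a :+ b :+ (c :+ d) := a :+ (c :+ b) :+ d) refl

node-injective : ∀ {u v ts us} → _≡_ {A = Tree} (node u ts) (node v us) → u ≡ v × ts ≡ us
node-injective refl = refl , refl

ins-injective : ∀ {N N′ F F′} → Min N → Min N′ → Asc F → Asc F′ → ¬ Ins (top N) F → ¬ Ins (top N′) F′ →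
  ins N F ≡ ins N′ F′ → N ≡ N′ × F ≡ F′
ins-injective {node r ls} {node _ ls′} {F} {F′} m m′ a a′ i i′ eq
  with eq₁ , eq₂ ← ∷-injective eq with refl , eq₃ ← node-injective eq₁
  = cong (node r) (trans (sym (above-++ (Below-below r F) m))
      (trans (cong (above r) eq₃) (above-++ (Below-below r F′) m′)))
  , trans (sym (below-above a i)) (trans (cong₂ _++_
      (trans (sym (below-++ (Below-below r F) m)) (trans (cong (below r) eq₃) (below-++ (Below-below r F′) m′)))
      eq₂) (below-above a′ i′))

record Dec-OK (ms F : List Tree) : Set where
  field
    asc : Asc F
    ord : All Ord F
    wts-eq : ∀ w → wts w F ≡ wts w ms

dec-OK : ∀ {ms} → All Min ms → All Ord ms → Simples ms → Dec-OK ms (dec ms)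
dec-OK {[]} _ _ _ = record { asc = [] ; ord = [] ; wts-eq = λ _ → refl }
dec-OK {N ∷ ms} (m ∷ mins) (o ∷ os) u = record
  { asc    = Asc-ins N (asc ih)
  ; ord    = Ord-ins o m (asc ih) (ord ih)
  ; wts-eq = λ w → trans (wts-ins w N (asc ih) (Simples-∷ u (In-top N) ∘ Ins-resp (wts-eq ih)))
                         (cong (wt w N +_) (wts-eq ih w))
  }
  where
  open Dec-OK
  ih : Dec-OK ms (dec ms)
  ih = dec-OK mins os (Simples-tail u)

encs-ins : ∀ {N F} → Min N → encs (ins N F) ≡ N ∷ encs (below (top N) F ++ above (top N) F)
encs-ins {node r ls} {F} m = cong₂ (λ x y → node r x ∷ y)
  (above-++ (Below-below r F) m)
  (trans (cong (_++ encs (above r F)) (trans (encB-below r (below r F ++ ls)) (cong encs (below-++ (Below-below r F) m))))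
         (sym (encs-++ (below r F) _)))

encs-dec : ∀ {ms} → All Min ms → All Ord ms → Simples ms → encs (dec ms) ≡ ms
encs-dec {[]} _ _ _ = refl
encs-dec {N ∷ ms} (m ∷ mins) (o ∷ os) u = trans (encs-ins {N} {dec ms} m) (cong (N ∷_)
  (trans (cong encs (below-above asc (Simples-∷ u (In-top N) ∘ Ins-resp wts-eq)))
         (encs-dec mins os (Simples-tail u))))
  where open Dec-OK (dec-OK mins os (Simples-tail u))

<ᵇ-true : ∀ {a b} → (a <ᵇ b) ≡ true → a < b
<ᵇ-true {a} eq = <ᵇ⇒< a _ (subst T (sym eq) _)

-- Since `ms` decodes to larger roots only, the last `ins` takes exactly the former smaller children
-- of `t` below its root and leaves the rest alone.
dec-enc  : ∀ {t ms} → Ord t → Simple t → Above (top t) (dec ms) → dec (enc t ++ ms) ≡ t ∷ dec ms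
dec-encB : ∀ {r cs ms} → Asc cs → All Ord cs → Simples cs → Above r (dec ms) →
  dec (encB r cs ++ ms) ≡ below r cs ++ dec ms
dec-enc {node r cs} {ms} (node a o) u b = trans (cong (ins (node r (above r cs))) (dec-encB a o (Simple-kids u) b))
  (cong₂ (λ x y → node r x ∷ y)
    (trans (cong (_++ above r cs) (below-++ (Below-below r cs) b)) (below-above a (Simple-top u)))
    (above-++ (Below-below r cs) b))
dec-encB {cs = []} _ _ _ _ = refl
dec-encB {r} {c ∷ cs} {ms} (a ∷ as) (o ∷ os) u b with top c <ᵇ r in eq
... | false = dec-encB as os (Simples-tail u) b
... | true  = trans (cong dec (++-assoc (enc c) (encB r cs) ms))
  (trans (dec-enc {c} {encB r cs ++ ms} o (Simple-∈ u (here refl))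
    (subst (Above (top c)) (sym ih) (All.++⁺ (All-below r a) (All.map (<-trans (<ᵇ-true {top c} eq)) b))))
    (cong (c ∷_) ih))
  where
  ih : dec (encB r cs ++ ms) ≡ below r cs ++ dec ms
  ih = dec-encB as os (Simples-tail u) b

enc-max  : ∀ {t} → Ord t → All (λ s → top s ≤ top t) (enc t)
encB-max : ∀ {r cs} → All Ord cs → Below r (encB r cs)
enc-max (node _ o) = ≤-refl ∷ All.map <⇒≤ (encB-max o)
encB-max [] = []
encB-max {r} {c ∷ cs} (o ∷ os) with top c <ᵇ r in eq
... | false = encB-max os
... | true  = All.++⁺ (All.map (λ le → ≤-<-trans le (<ᵇ-true {top c} eq)) (enc-max o)) (encB-max os)

enc-Min  : ∀ t → All Min (enc t)
encB-Min : ∀ r cs → All Min (encB r cs)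
enc-Min (node r cs) = Above-above r cs ∷ encB-Min r cs
encB-Min r [] = []
encB-Min r (c ∷ cs) with top c <ᵇ r
... | false = encB-Min r cs
... | true  = All.++⁺ (enc-Min c) (encB-Min r cs)

enc-Ord  : ∀ {t} → Ord t → All Ord (enc t)
encB-Ord : ∀ {r cs} → All Ord cs → All Ord (encB r cs)
enc-Ord {node r cs} (node a o) = node (Asc-above r a) (All-above r o) ∷ encB-Ord o
encB-Ord [] = []
encB-Ord {r} {c ∷ cs} (o ∷ os) with top c <ᵇ r
... | false = encB-Ord os
... | true  = All.++⁺ (enc-Ord o) (encB-Ord os)

wts-enc  : ∀ w {t} → Ord t → Simple t → wts w (enc t) ≡ wt w t
wts-encB : ∀ w {r cs} → All Ord cs → Simples cs → wts w (encB r cs) ≡ wts w (below r cs)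
wts-enc w {node r cs} (node a o) u = trans (cong (w r + wts w (above r cs) +_) (wts-encB w o (Simple-kids u)))
  (trans (lemma (w r) _ _) (cong (w r +_) (wts-below-above w a (Simple-top u))))
  where
  open +-*-Solver
  lemma : ∀ a b c → a + b + c ≡ a + (c + b)
  lemma = solve 3 (λ a b c → a :+ b :+ c := a :+ (c :+ b)) refl
wts-encB w [] _ = refl
wts-encB w {r} {c ∷ cs} (o ∷ os) u with top c <ᵇ r
... | false = wts-encB w os (Simples-tail u)
... | true  = trans (wts-++ w (enc c)) (cong₂ _+_ (wts-enc w o (Simple-∈ u (here refl))) (wts-encB w os (Simples-tail u)))

Below-dec : ∀ {r ms} → Below r ms → Below r (dec ms)
Below-dec [] = []
Below-dec {ms = node r ls ∷ ms} (b ∷ bs) = b ∷ All-above r (Below-dec bs)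

-- All other roots are below the root of `N`, so the last `ins` takes in the whole forest and a
-- single tree results.
dec-single : ∀ {N ms} → All Min (N ∷ ms) → All Ord (N ∷ ms) → Simples (N ∷ ms) → Below (top N) ms →
  ∃ λ t → Ord t × (∀ w → wt w t ≡ wts w (N ∷ ms)) × enc t ≡ N ∷ ms
dec-single {node r ls} {ms} m o u b = go (dec (node r ls ∷ ms)) refl (dec-OK m o u) (encs-dec m o u)
  where
  go : ∀ F → dec (node r ls ∷ ms) ≡ F → Dec-OK (node r ls ∷ ms) F → encs F ≡ node r ls ∷ ms →
    ∃ λ t → Ord t × (∀ w → wt w t ≡ wts w (node r ls ∷ ms)) × enc t ≡ node r ls ∷ ms
  go (t ∷ []) _ ok e = t , All.head (Dec-OK.ord ok) ,
    (λ w → trans (sym (+-identityʳ _)) (Dec-OK.wts-eq ok w)) , trans (sym (++-identityʳ (enc t))) e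
  go (t ∷ s ∷ F) eq _ _ = case trans (sym (above-none (Below-dec b))) (∷-injectiveʳ eq) of λ ()

enc-injective : ∀ {t t′} → Ord t → Ord t′ → Simple t → Simple t′ → enc t ≡ enc t′ → t ≡ t′
enc-injective {t} {t′} o o′ u u′ eq = ∷-injectiveˡ (trans (sym (dec-enc {t} {[]} o u []))
  (trans (cong (λ x → dec (x ++ [])) eq) (dec-enc {t′} {[]} o′ u′ [])))

-- Rotations

-- A cut replaces the iterated `rotate`: rotations are composed by comparing two cuts, without
-- arithmetic modulo the length.
Cyc : ∀ {A : Set} → List A → List A → Set
Cyc xs ys = ∃₂ λ a b → xs ≡ a ++ b × ys ≡ b ++ a

Cyc-All : ∀ {A : Set} {P : A → Set} {xs ys} → Cyc xs ys → All P xs → All P ys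
Cyc-All (a , b , refl , refl) ps = All.++⁺ (All.++⁻ʳ a ps) (All.++⁻ˡ a ps)

Cyc-wts : ∀ {xs ys} → Cyc xs ys → ∀ w → wts w xs ≡ wts w ys
Cyc-wts (a , b , refl , refl) w = wts-++-comm w a

Cyc-length : ∀ {A : Set} {xs ys : List A} → Cyc xs ys → length xs ≡ length ys
Cyc-length (a , b , refl , refl) = trans (length-++ a) (trans (+-comm (length a) _) (sym (length-++ b)))

Cyc-sym : ∀ {A : Set} {xs ys : List A} → Cyc xs ys → Cyc ys xs
Cyc-sym (a , b , eq , eq′) = b , a , eq′ , eq

-- Were the heads at different places, each would lie in the tail of the other. It is applied with
-- two relations `D`: having the larger root, and containing a given vertex that the other tree
-- lacks.
Cyc-heads : ∀ {A : Set} (D : A → A → Set) → (∀ {x y} → D x y → ¬ D y x) →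
  ∀ {x y xs ys} → All (D x) xs → All (D y) ys → Cyc (x ∷ xs) (y ∷ ys) → x ∷ xs ≡ y ∷ ys
Cyc-heads D asym p q ([] , b , refl , refl) = sym (++-identityʳ b)
Cyc-heads D asym p q (x ∷ a , [] , refl , refl) = ++-identityʳ (x ∷ a)
Cyc-heads D asym p q (x ∷ a , y ∷ b , refl , refl) =
  ⊥-elim (asym (All.lookup p (∈-++⁺ʳ a (here refl))) (All.lookup q (∈-++⁺ʳ b (here refl))))

max-split : ∀ x xs → Simples (x ∷ xs) → ∃ λ P → ∃₂ λ M Q → x ∷ xs ≡ P ++ M ∷ Q × Below (top M) (Q ++ P)
max-split x [] u = [] , x , [] , refl , []
max-split x (y ∷ ys) u with max-split y ys (Simples-tail u)
... | P , M , Q , eq , b with <-cmp (top x) (top M)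
... | tri< lt _ _ = x ∷ P , M , Q , cong (x ∷_) eq , All.++⁺ (All.++⁻ˡ Q b) (lt ∷ All.++⁻ʳ Q b)
... | tri≈ _ e _ = ⊥-elim (Simples-∷ u (In-top x)
  (subst₂ Ins (sym e) (sym eq) (In-∈ (∈-++⁺ʳ P (here refl)) (In-top M))))
... | tri> _ _ gt = [] , x , y ∷ ys , refl , subst (Below (top x)) (sym (trans (++-identityʳ _) eq))
  (All.++⁺ (All.map (λ lt → <-trans lt gt) (All.++⁻ʳ Q b)) (gt ∷ All.map (λ lt → <-trans lt gt) (All.++⁻ˡ Q b)))

-- Trees with a marked vertex

insert : Tree → List Tree → List Tree
insert t ts = below (top t) ts ++ t ∷ above (top t) ts

wts-mid : ∀ w xs {t ys} → wts w (xs ++ t ∷ ys) ≡ wt w t + (wts w xs + wts w ys)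
wts-mid w xs {t} {ys} = trans (wts-++ w xs) (lemma (wts w xs) (wt w t) (wts w ys))
  where
  open +-*-Solver
  lemma : ∀ a b c → a + (b + c) ≡ b + (a + c)
  lemma = solve 3 (λ a b c → a :+ (b :+ c) := b :+ (a :+ c)) refl

wts-insert : ∀ w t {ts} → Asc ts → ¬ Ins (top t) ts → wts w (insert t ts) ≡ wt w t + wts w ts
wts-insert w t {ts} as t∉ = trans (wts-mid w (below (top t) ts)) (cong (wt w t +_) (wts-below-above w as t∉))

Asc-insert : ∀ t {ts} → Asc ts → Asc (insert t ts)
Asc-insert t {ts} as = AllPairs.++⁺ (Asc-below _ as) (Above-above _ ts ∷ Asc-above _ as)
  (All.map (λ lt → lt ∷ All.map (<-trans lt) (Above-above (top t) ts)) (Below-below _ ts))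

All-insert : ∀ {P : Tree → Set} t {ts} → P t → All P ts → All P (insert t ts)
All-insert t p ps = All.++⁺ (All-below _ ps) (p ∷ All-above _ ps)

below-insert : ∀ t ts → below (top t) (insert t ts) ≡ below (top t) ts
below-insert t ts = trans (filter-++ (λ s → top s <? top t) (below (top t) ts) _)
  (trans (cong₂ _++_ (below-all (Below-below _ ts))
    (filter-none (λ s → top s <? top t) (<-irrefl refl ∷ All.map <-asym (Above-above (top t) ts))))
    (++-identityʳ _))

above-insert : ∀ t ts → above (top t) (insert t ts) ≡ above (top t) ts
above-insert t ts = trans (filter-++ (λ s → top t <? top s) (below (top t) ts) _)
  (cong₂ _++_ (above-none (Below-below _ ts))
    (trans (filter-++ (λ s → top t <? top s) [ t ] _)
      (cong₂ _++_ (filter-none (λ s → top t <? top s) {xs = [ t ]} (<-irrefl refl ∷ []))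
                  (above-all (Above-above _ ts)))))

insert-cancel : ∀ t {ts us} → Asc ts → Asc us → ¬ Ins (top t) ts → ¬ Ins (top t) us →
  insert t ts ≡ insert t us → ts ≡ us
insert-cancel t {ts} {us} a b i j eq = trans (sym (below-above a i)) (trans (cong₂ _++_
  (trans (sym (below-insert t ts)) (trans (cong (below (top t)) eq) (below-insert t us)))
  (trans (sym (above-insert t ts)) (trans (cong (above (top t)) eq) (above-insert t us))))
  (below-above b j))

∈-insert : ∀ t ts → t ∈ insert t ts
∈-insert t ts = ∈-++⁺ʳ (below (top t) ts) (here refl)

-- The tree with the path u₁ … uₗ z from its root, where Ts are the trees with roots u₁ … uₗ that
-- hang off this path, and F are the subtrees below z.
spine : ℕ → List Tree → List Tree → Tree
spine z F []               = node z F
spine z F (node u cs ∷ Ts) = node u (insert (spine z F Ts) cs)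

next-top : ℕ → List Tree → ℕ
next-top z []       = z
next-top z (t ∷ _) = top t

spine-top : ∀ z F Ts → top (spine z F Ts) ≡ next-top z Ts
spine-top z F []              = refl
spine-top z F (node u cs ∷ _) = refl

record Spine (z : ℕ) (F Ts : List Tree) : Set where
  constructor spn
  field
    asc    : Asc F
    ordF   : All Ord F
    ord    : All Ord Ts
    simple : Simples (node z F ∷ Ts)

Simples-swap : ∀ {a b ts} → Simples (a ∷ b ∷ ts) → Simples (b ∷ a ∷ ts)
Simples-swap {a} {b} {ts} = Simples-resp λ w → lemma (wt w a) (wt w b) (wts w ts)
  where
  open +-*-Solver
  lemma : ∀ a b c → a + (b + c) ≡ b + (a + c)
  lemma = solve 3 (λ a b c → a :+ (b :+ c) := b :+ (a :+ c)) refl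

Spine-tail : ∀ {z F t Ts} → Spine z F (t ∷ Ts) → Spine z F Ts
Spine-tail (spn a o (_ ∷ os) u) = spn a o os (Simples-tail (Simples-swap u))

next-top∈ : ∀ z F Ts → Ins (next-top z Ts) (node z F ∷ Ts)
next-top∈ z F []       = Ins-here (In-top _)
next-top∈ z F (t ∷ Ts) = Ins-there (Ins-here (In-top t))

spine-fresh : ∀ {z F u cs Ts} → Spine z F (node u cs ∷ Ts) → ¬ Ins (top (spine z F Ts)) cs
spine-fresh {z} {F} {u} {cs} {Ts} (spn _ _ _ s) i = Simples-∷ (Simples-swap s) (In-kid i)
  (subst (λ x → Ins x (node z F ∷ Ts)) (sym (spine-top z F Ts)) (next-top∈ z F Ts))

wt-spine : ∀ w {z F Ts} → Spine z F Ts → wt w (spine z F Ts) ≡ wts w (node z F ∷ Ts)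
wt-spine w {Ts = []} _ = sym (+-identityʳ _)
wt-spine w {z} {F} {node u cs ∷ Ts} s@(spn _ _ (node a _ ∷ _) _) =
  trans (cong (w u +_) (trans (wts-insert w (spine z F Ts) a (spine-fresh s))
                              (cong (_+ wts w cs) (wt-spine w (Spine-tail s)))))
        (lemma (w u) (wt w (node z F)) (wts w Ts) (wts w cs))
  where
  open +-*-Solver
  lemma : ∀ a b c d → a + (b + c + d) ≡ b + (a + d + c)
  lemma = solve 4 (λ a b c d → a :+ (b :+ c :+ d) := b :+ (a :+ d :+ c)) refl

spine-Ord : ∀ {z F Ts} → Spine z F Ts → Ord (spine z F Ts)
spine-Ord {Ts = []} (spn a o _ _) = node a o
spine-Ord {z} {F} {node u cs ∷ Ts} s@(spn _ _ (node a o ∷ _) _) =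
  node (Asc-insert (spine z F Ts) a) (All-insert (spine z F Ts) (spine-Ord (Spine-tail s)) o)

spine-Simple : ∀ {z F Ts} → Spine z F Ts → Simple (spine z F Ts)
spine-Simple s = mk λ x → subst (_≤ 1) (sym (wt-spine (δ x) s)) (once (Spine.simple s) x)

spine-In : ∀ {z F Ts} → Spine z F Ts → In z (spine z F Ts)
spine-In {z} {F} {Ts} s =
  mk (subst (1 ≤_) (sym (wt-spine (δ z) s)) (pos (Ins-here {z} {node z F} {Ts} (In-top (node z F)))))

-- The child with which the path continues is recognised as the only one containing `z`.
spine-injective : ∀ {z F F′ Ts Ts′} → Spine z F Ts → Spine z F′ Ts′ → spine z F Ts ≡ spine z F′ Ts′ →
  F ≡ F′ × Ts ≡ Ts′
spine-injective {Ts = []} {[]} _ _ refl = refl , refl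
spine-injective {Ts = []} {node u _ ∷ _} _ (spn _ _ _ u′) eq with refl , _ ← node-injective eq =
  ⊥-elim (Simples-∷ u′ (In-top (node u _)) (Ins-here (In-top (node u _))))
spine-injective {Ts = node u _ ∷ _} {[]} (spn _ _ _ u′) _ eq with refl , _ ← node-injective eq =
  ⊥-elim (Simples-∷ u′ (In-top (node u _)) (Ins-here (In-top (node u _))))
spine-injective {z} {F} {F′} {node u cs ∷ Ts} {node u′ cs′ ∷ Ts′} s s′ eq
  with refl , eq′ ← node-injective eq
  with node a _ ∷ _ ← Spine.ord s | node a′ _ ∷ _ ← Spine.ord s′
  with e ← In-unique (Simple-kids (spine-Simple s)) (∈-insert (spine z F Ts) cs)
       (subst (spine z F′ Ts′ ∈_) (sym eq′) (∈-insert (spine z F′ Ts′) cs′))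
       (spine-In (Spine-tail s)) (spine-In (Spine-tail s′))
  with refl , refl ← spine-injective (Spine-tail s) (Spine-tail s′) e
  = refl , cong (λ x → node u x ∷ Ts) (insert-cancel (spine z F Ts) a a′ (spine-fresh s) (spine-fresh s′) eq′)

insert-remove : ∀ xs {t ys} → Asc (xs ++ t ∷ ys) → insert t (xs ++ ys) ≡ xs ++ t ∷ ys
insert-remove xs {t} {ys} as = cong₂ (λ x y → x ++ t ∷ y) (below-++ b a) (above-++ b a)
  where
  b : Below (top t) xs
  b = go xs as
    where
    go : ∀ xs → Asc (xs ++ t ∷ ys) → Below (top t) xs
    go []       _        = []
    go (x ∷ xs) (a ∷ as) = All.lookup a (∈-++⁺ʳ xs (here refl)) ∷ go xs as
  a : Above (top t) ys
  a = go xs as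
    where
    go : ∀ xs → Asc (xs ++ t ∷ ys) → Above (top t) ys
    go []       (a ∷ _)  = a
    go (x ∷ xs) (_ ∷ as) = go xs as

Asc-remove : ∀ xs {t ys} → Asc (xs ++ t ∷ ys) → Asc (xs ++ ys)
Asc-remove []       (_ ∷ as) = as
Asc-remove (x ∷ xs) (a ∷ as) = All.++⁺ (All.++⁻ˡ xs a) (All.tail (All.++⁻ʳ xs a)) ∷ Asc-remove xs as

spine-exists  : ∀ {z t} → Ord t → Simple t → In z t → ∃₂ λ F Ts → Spine z F Ts × t ≡ spine z F Ts
spine-exists∈ : ∀ {z ts} → All Ord ts → Simples ts → Ins z ts →
  ∃₂ λ xs ys → ∃₂ λ F Ts → Spine z F Ts × ts ≡ xs ++ spine z F Ts ∷ ys
spine-exists {z} {node u cs} (node a o) s i with z ≟ u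
... | yes refl = cs , [] , spn a o [] Simples-[ s ] , refl
... | no z≢u with In-node i
... | inj₁ eq = contradiction eq z≢u
... | inj₂ j with xs , ys , F , Ts , sp , refl ← spine-exists∈ o (Simple-kids s) j =
  F , node u (xs ++ ys) ∷ Ts ,
  spn (Spine.asc sp) (Spine.ordF sp)
    (node (Asc-remove xs a) (All.++⁺ (All.++⁻ˡ xs o) (All.tail (All.++⁻ʳ xs o))) ∷ Spine.ord sp)
    (Simples-resp weight Simples-[ s ]) ,
  cong (node u) (sym (insert-remove xs a))
  where
  open +-*-Solver
  lemma : ∀ a b c d e → a + (b + c + (d + e)) + 0 ≡ b + (a + (d + e) + c)
  lemma = solve 5 (λ a b c d e → a :+ (b :+ c :+ (d :+ e)) :+ con 0 := b :+ (a :+ (d :+ e) :+ c)) refl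
  weight : ∀ w → wts w [ node u (xs ++ spine z F Ts ∷ ys) ] ≡ wts w (node z F ∷ node u (xs ++ ys) ∷ Ts)
  weight w rewrite wts-mid w xs {spine z F Ts} {ys} | wts-++ w xs {ys} | wt-spine w sp
    = lemma (w u) (wt w (node z F)) (wts w Ts) (wts w xs) (wts w ys)
spine-exists∈ {ts = []} _ _ (mk ())
spine-exists∈ {z} {ts = t ∷ ts} (o ∷ os) u i with Ins-∷ t i
... | inj₁ j with F , Ts , sp , refl ← spine-exists o (Simple-∈ u (here refl)) j = [] , ts , F , Ts , sp , refl
... | inj₂ j with xs , ys , F , Ts , sp , refl ← spine-exists∈ os (Simples-tail u) j = t ∷ xs , ys , F , Ts , sp , refl

-- `Min (spine z F Ts)` without the inserted subtree: of the vertices on the path only the second is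
-- a child of the root.
MinSpine : ℕ → List Tree → List Tree → Set
MinSpine z F []               = Above z F
MinSpine z F (node r cs ∷ Ts) = Above r cs × r < next-top z Ts

MinSpine⇒Min : ∀ {z F} Ts → MinSpine z F Ts → Min (spine z F Ts)
MinSpine⇒Min [] m = m
MinSpine⇒Min {z} {F} (node r cs ∷ Ts) (m , lt) =
  All-insert {λ t → r < top t} (spine z F Ts) (subst (r <_) (sym (spine-top z F Ts)) lt) m

Min⇒MinSpine : ∀ {z F Ts} → Spine z F Ts → Min (spine z F Ts) → MinSpine z F Ts
Min⇒MinSpine {Ts = []} _ m = m
Min⇒MinSpine {z} {F} {node r cs ∷ Ts} s@(spn _ _ (node a _ ∷ _) _) m =
  subst (Above r) (below-above a (spine-fresh s))
    (All.++⁺ (All.++⁻ˡ (below x cs) m) (All.tail (All.++⁻ʳ (below x cs) m))) ,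
  subst (r <_) (spine-top z F Ts) (All.lookup m (∈-insert (spine z F Ts) cs))
  where
  x = top (spine z F Ts)

-- A minimally rooted tree with a marked vertex z is turned into an ordered forest on the other
-- vertices: with r the root and r ≠ z, the subtrees of z with root above r become the first trees,
-- in decreasing order of their roots, and those with root below r become subtrees of r.  The
-- forest determines r as the end of the first decreasing run of its roots followed by z.
unmark : List Tree → List Tree → List Tree
unmark F []               = reverse F
unmark F (node r cs ∷ Ts) = reverse (above r F) ++ node r (below r F ++ cs) ∷ Ts

-- `acc` is the part of the run already read, in reverse and hence ascending, as the children of `z`
-- must be. At the last tree its root is compared with `z`.
mark : ℕ → List Tree → List Tree → List Tree × List Tree
mark z acc []               = acc , []
mark z acc (node r cs ∷ Us) =
  if next-top z Us <ᵇ r then mark z (node r cs ∷ acc) Us else (below r cs ++ acc , node r (above r cs) ∷ Us)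

<ᵇ-false : ∀ {a b} → a < b → (b <ᵇ a) ≡ false
<ᵇ-false {a} {b} lt with b <ᵇ a in eq
... | false = refl
... | true  = ⊥-elim (<-asym lt (<ᵇ-true {b} eq))

<⇒<ᵇ-true : ∀ {a b} → a < b → (a <ᵇ b) ≡ true
<⇒<ᵇ-true {a} {b} lt with a <ᵇ b | <⇒<ᵇ lt
... | true | _ = refl

mark-run : ∀ z acc xs Us → Asc xs → Above (next-top z Us) xs → mark z acc (reverse xs ++ Us) ≡ mark z (xs ++ acc) Us
mark-run z acc [] Us _ _ = refl
mark-run z acc (x@(node u cs) ∷ xs) Us (a ∷ as) (lt ∷ _) = trans
  (cong (mark z acc) (trans (cong (_++ Us) (unfold-reverse x xs)) (++-assoc (reverse xs) [ x ] Us)))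
  (trans (mark-run z acc xs (x ∷ Us) as a) last)
  where
  last : mark z (xs ++ acc) (x ∷ Us) ≡ mark z (x ∷ xs ++ acc) Us
  last rewrite <⇒<ᵇ-true lt = refl

mark-unmark : ∀ {z F Ts} → Spine z F Ts → MinSpine z F Ts → mark z [] (unmark F Ts) ≡ (F , Ts)
mark-unmark {z} {F} {[]} (spn a _ _ _) m = trans (cong (mark z []) (sym (++-identityʳ (reverse F))))
  (trans (mark-run z [] F [] a m) (cong (_, []) (++-identityʳ F)))
mark-unmark {z} {F} {node r cs ∷ Ts} (spn a _ _ u) (m , lt) = trans
  (mark-run z [] (above r F) (node r (below r F ++ cs) ∷ Ts) (Asc-above r a) (Above-above r F)) last
  where
  r∉F : ¬ Ins r F
  r∉F i = Simples-∷ u (In-kid i) (Ins-here (In-top (node r cs)))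
  last : mark z (above r F ++ []) (node r (below r F ++ cs) ∷ Ts) ≡ (F , node r cs ∷ Ts)
  last rewrite <ᵇ-false lt = cong₂ (λ x y → x , node r y ∷ Ts)
    (trans (cong₂ _++_ (below-++ (Below-below r F) m) (++-identityʳ (above r F))) (below-above a r∉F))
    (above-++ (Below-below r F) m)

record Marked (z : ℕ) (Us : List Tree) (M : Tree) : Set where
  constructor marked
  field
    {F Ts} : List Tree
    ok     : Spine z F Ts
    min    : MinSpine z F Ts
    forest : Us ≡ unmark F Ts
    tree   : M ≡ spine z F Ts

wts-unmark : ∀ w {z F Ts} → Spine z F Ts → wts w (unmark F Ts) ≡ wts w F + wts w Ts
wts-unmark w {F = F} {[]} _ = trans (wts-reverse w F) (sym (+-identityʳ _))
wts-unmark w {z} {F} {node r cs ∷ Ts} (spn a _ _ u) = trans (wts-++ w (reverse (above r F)))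
  (trans (cong₂ (λ x y → x + (w r + y + wts w Ts)) (wts-reverse w (above r F)) (wts-++ w (below r F)))
  (trans (lemma (wts w (above r F)) (w r) (wts w (below r F)) (wts w cs) (wts w Ts))
         (cong (_+ (w r + wts w cs + wts w Ts)) (wts-below-above w a
           λ i → Simples-∷ u (In-kid i) (Ins-here (In-top (node r cs)))))))
  where
  open +-*-Solver
  lemma : ∀ a b c d e → a + (b + (c + d) + e) ≡ c + a + (b + d + e)
  lemma = solve 5 (λ a b c d e → a :+ (b :+ (c :+ d) :+ e) := c :+ a :+ (b :+ d :+ e)) refl

module _ {z Us M} (p : Marked z Us M) where
  open Marked p

  Marked-wt : ∀ w → wt w M ≡ wts w (node z [] ∷ Us)
  Marked-wt w rewrite forest | tree = trans (wt-spine w ok)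
    (trans (lemma (w z) (wts w F) (wts w Ts)) (cong (w z + 0 +_) (sym (wts-unmark w ok))))
    where
    open +-*-Solver
    lemma : ∀ a b c → a + b + c ≡ a + 0 + (b + c)
    lemma = solve 3 (λ a b c → a :+ b :+ c := a :+ con 0 :+ (b :+ c)) refl

  Marked-Ord : Ord M
  Marked-Ord rewrite tree = spine-Ord ok

  Marked-Min : Min M
  Marked-Min rewrite tree = MinSpine⇒Min Ts min

  Marked-In : In z M
  Marked-In rewrite tree = spine-In ok

  Marked-All : All Ord Us
  Marked-All rewrite forest = go Ts ok min
    where
    All-reverse : ∀ {xs} → All Ord xs → All Ord (reverse xs)
    All-reverse os = All.tabulate λ x∈ → All.lookup os (Any.reverse⁻ x∈)
    go : ∀ Ts → Spine z F Ts → MinSpine z F Ts → All Ord (unmark F Ts)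
    go [] (spn _ o _ _) _ = All-reverse o
    go (node r cs ∷ Ts) (spn a o (node b o′ ∷ os) _) (m , _) = All.++⁺ (All-reverse (All-above r o))
      (node (Asc-++ (Asc-below r a) b (Below-below r F) m) (All.++⁺ (All-below r o) o′) ∷ os)

Marked-fun : ∀ {z Us M M′} → Marked z Us M → Marked z Us M′ → M ≡ M′
Marked-fun (marked s m refl refl) (marked s′ m′ eq refl)
  with refl ← trans (sym (mark-unmark s m)) (trans (cong (mark _ []) eq) (mark-unmark s′ m′)) = refl

Marked-inj : ∀ {z Us Us′ M} → Marked z Us M → Marked z Us′ M → Us ≡ Us′
Marked-inj (marked s m refl refl) (marked s′ m′ refl eq) with refl , refl ← spine-injective s s′ eq = refl

Marked-forest : ∀ {z M} → Ord M → Simple M → Min M → In z M → ∃ λ Us → Marked z Us M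
Marked-forest o u m i with F , Ts , s , refl ← spine-exists o u i = _ , marked s (Min⇒MinSpine s m) refl refl

move-tree : ∀ a b c d e → a + b + (c + d + e) ≡ a + (c + d + b) + e
move-tree = solve 5 (λ a b c d e → a :+ b :+ (c :+ d :+ e) := a :+ (c :+ d :+ b) :+ e) refl
  where open +-*-Solver

-- Retraces `mark` with `reverse acc ++ Us` as the fixed forest. The accumulator stays ascending and
-- above the next root, so it can be placed below `z`, and the smaller children of `r` fit in front
-- of it.
mark-exists : ∀ {z} acc Us → Asc acc → Above (next-top z Us) acc → All Ord acc → All Ord Us →
  Simples (node z acc ∷ Us) → ∃₂ λ F Ts → Spine z F Ts × MinSpine z F Ts × reverse acc ++ Us ≡ unmark F Ts
mark-exists acc [] a b o os u = acc , [] , spn a o [] u , b , ++-identityʳ _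
mark-exists {z} acc (node r cs ∷ Us) a b o (node c o′ ∷ os) u with <-cmp (next-top z Us) r
... | tri< lt _ _ with F , Ts , s , m , eq ← mark-exists {z} (node r cs ∷ acc) Us (b ∷ a)
      (lt ∷ All.map (<-trans lt) b) (node c o′ ∷ o) os (Simples-resp
        (λ w → move-tree (w z) (wts w acc) (w r) (wts w cs) (wts w Us)) u)
  = F , Ts , s , m , trans (sym (++-assoc (reverse acc) [ node r cs ] Us))
      (trans (cong (_++ Us) (sym (unfold-reverse (node r cs) acc))) eq)
... | tri≈ _ e _ = ⊥-elim (case next-top∈′ of λ i → Simples-∷ (Simples-swap u) (In-top (node r cs)) i)
  where
  next-top∈′ : Ins r (node z acc ∷ Us)
  next-top∈′ = subst (λ x → Ins x (node z acc ∷ Us)) e (next-top∈ z acc Us)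
... | tri> _ _ gt = below r cs ++ acc , node r (above r cs) ∷ Us ,
  spn (Asc-++ (Asc-below r c) a (Below-below r cs) b) (All.++⁺ (All-below r o′) o) (node (Asc-above r c) (All-above r o′) ∷ os)
    (Simples-resp (λ w → trans (cong (λ x → w z + wts w acc + (w r + x + wts w Us)) (sym (wts-below-above w c r∉)))
      (trans (lemma (w z) (wts w acc) (w r) (wts w (below r cs)) (wts w (above r cs)) (wts w Us))
             (cong (λ x → w z + x + (w r + wts w (above r cs) + wts w Us)) (sym (wts-++ w (below r cs)))))) u) ,
  (Above-above r cs , gt) ,
  cong₂ (λ x y → reverse x ++ node r y ∷ Us) (sym (above-++ (Below-below r cs) b))
    (sym (trans (cong (_++ above r cs) (below-++ (Below-below r cs) b)) (below-above c r∉)))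
  where
  open +-*-Solver
  lemma : ∀ a b c d e f → a + b + (c + (d + e) + f) ≡ a + (d + b) + (c + e + f)
  lemma = solve 6 (λ a b c d e f → a :+ b :+ (c :+ (d :+ e) :+ f) := a :+ (d :+ b) :+ (c :+ e :+ f)) refl
  r∉ : ¬ Ins r cs
  r∉ = Simple-top (Simple-∈ u (there (here refl)))

Marked-tree : ∀ {z Us} → All Ord Us → Simples (node z [] ∷ Us) → ∃ λ M → Marked z Us M
Marked-tree {z} {Us} os u with F , Ts , s , m , eq ← mark-exists {z} [] Us [] [] [] os u = _ , marked s m eq refl

-- Blocks and trees all of whose special vertices are nonleaves

data NL (k : ℕ) : Tree → Set where
  node : ∀ {v ts} → (v < k → ts ≢ []) → All (NL k) ts → NL k (node v ts)

-- Lukasiewicz condition: c counts the special vertices that still have to be given a tree.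
data Luk (k : ℕ) : ℕ → List Tree → Set where
  done : Luk k 0 []
  next : ∀ {c M q} → Luk k (c + wt (χ k) M) q → Luk k (suc c) (M ∷ q)

-- Unfold k t t′ q: visiting the special vertices v of t bottom-up, one minimally rooted tree is
-- split off the forest below v (inverse to ins); t′ remains of t, and q lists the trees split off
-- in the preorder of their vertices v.
data Unfold (k : ℕ) : Tree → Tree → List Tree → Set
data Unfolds (k : ℕ) : List Tree → List Tree → List Tree → Set
data Unfold k where
  plain : ∀ {v F F′ q} → ¬ v < k → Unfolds k F F′ q → Unfold k (node v F) (node v F′) q
  split : ∀ {v F M F′ q} → v < k → Min M → Asc F′ → ¬ Ins (top M) F′ → Unfolds k F (ins M F′) q →
          Unfold k (node v F) (node v F′) (M ∷ q)
data Unfolds k where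
  []  : Unfolds k [] [] []
  _∷_ : ∀ {t t′ q ts ts′ q′} → Unfold k t t′ q → Unfolds k ts ts′ q′ → Unfolds k (t ∷ ts) (t′ ∷ ts′) (q ++ q′)

++-cancel-assoc : ∀ {A : Set} (p q : List A) {r p′ q′ r′} → (p ++ q) ++ r ≡ (p′ ++ q′) ++ r′ →
  p ++ (q ++ r) ≡ p′ ++ (q′ ++ r′)
++-cancel-assoc p q {r} {p′} {q′} {r′} eq = trans (sym (++-assoc p q r)) (trans eq (++-assoc p′ q′ r′))

-- The queue needs no separators. At a special vertex its head `M` restores the forest `ins M F′`,
-- and this forest directs the reading of what follows; `r` and `r′` are the parts not yet read.
Unfold-parse  : ∀ {k t t′ s q p r r′} → Unfold k t t′ q → Unfold k s t′ p → q ++ r ≡ p ++ r′ → t ≡ s × q ≡ p × r ≡ r′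
Unfolds-parse : ∀ {k t t′ s q p r r′} → Unfolds k t t′ q → Unfolds k s t′ p → q ++ r ≡ p ++ r′ → t ≡ s × q ≡ p × r ≡ r′
Unfold-parse (plain _ a) (plain _ b) eq with refl , eq′ ← Unfolds-parse a b eq = refl , eq′
Unfold-parse (plain ¬s _) (split s _ _ _ _) _ = contradiction s ¬s
Unfold-parse (split s _ _ _ _) (plain ¬s _) _ = contradiction s ¬s
Unfold-parse (split _ _ _ _ a) (split _ _ _ _ b) eq with refl ← ∷-injectiveˡ eq
  with refl , refl , eq′ ← Unfolds-parse a b (∷-injectiveʳ eq) = refl , refl , eq′
Unfolds-parse [] [] eq = refl , refl , eq
Unfolds-parse {r = r} {r′} (_∷_ {q = q} {q′ = q′} a as) (_∷_ {q = p} {q′ = p′} b bs) eq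
  with refl , refl , eq₁ ← Unfold-parse a b (++-cancel-assoc q q′ {r} {p} {p′} {r′} eq)
  with refl , refl , eq₂ ← Unfolds-parse as bs eq₁ = refl , refl , eq₂

Unfold-fun  : ∀ {k t t′ s′ q p} → Unfold k t t′ q → Unfold k t s′ p → t′ ≡ s′ × q ≡ p
Unfolds-fun : ∀ {k t t′ s′ q p} → Unfolds k t t′ q → Unfolds k t s′ p → t′ ≡ s′ × q ≡ p
Unfold-fun (plain _ a) (plain _ b) with refl , eq ← Unfolds-fun a b = refl , eq
Unfold-fun (plain ¬s _) (split s _ _ _ _) = contradiction s ¬s
Unfold-fun (split s _ _ _ _) (plain ¬s _) = contradiction s ¬s
Unfold-fun (split _ m a i us) (split _ m′ a′ i′ us′) with eq , refl ← Unfolds-fun us us′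
  with refl , refl ← ins-injective m m′ a a′ i i′ eq = refl , refl
Unfolds-fun [] [] = refl , refl
Unfolds-fun (a ∷ as) (b ∷ bs) with refl , refl ← Unfold-fun a b | refl , refl ← Unfolds-fun as bs = refl , refl

-- Each special vertex waiting takes one tree, and the special vertices of that tree join those
-- waiting, because it is merged into the forest visited next.
Unfold-Luk  : ∀ {k t t′ q c r} → Unfold k t t′ q → Luk k c r → Luk k (wt (χ k) t′ + c) (q ++ r)
Unfolds-Luk : ∀ {k t t′ q c r} → Unfolds k t t′ q → Luk k c r → Luk k (wts (χ k) t′ + c) (q ++ r)
Unfold-Luk {k} (plain {v} ¬s a) l rewrite χ-≥ {k} {v} (≮⇒≥ ¬s) = Unfolds-Luk a l
Unfold-Luk {k} {c = c} {r} (split {v} {M = M} {F′} {q} s m a i us) l rewrite χ-< {k} {v} s =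
  next (subst (λ x → Luk k x (q ++ r)) (trans (cong (_+ c) (wts-ins (χ k) M a i)) (lemma (wt (χ k) M) (wts (χ k) F′) c))
    (Unfolds-Luk us l))
  where
  open +-*-Solver
  lemma : ∀ a b c → a + b + c ≡ b + c + a
  lemma = solve 3 (λ a b c → a :+ b :+ c := b :+ c :+ a) refl
Unfolds-Luk [] l = l
Unfolds-Luk {k} {c = c} {r} (_∷_ {t′ = t′} {q} {ts′ = ts′} {q′} a as) l =
  subst₂ (Luk k) (sym (+-assoc (wt (χ k) t′) _ c)) (sym (++-assoc q q′ r)) (Unfold-Luk a (Unfolds-Luk as l))

Below-tops : ∀ {r xs ys} → map top xs ≡ map top ys → Above r xs → Above r ys
Below-tops {ys = []} _ _ = []
Below-tops {r} {x ∷ xs} {y ∷ ys} eq (a ∷ as) = subst (r <_) (∷-injectiveˡ eq) a ∷ Below-tops (∷-injectiveʳ eq) as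

Asc-tops : ∀ {xs ys} → map top xs ≡ map top ys → Asc xs → Asc ys
Asc-tops {ys = []} _ _ = []
Asc-tops {x ∷ xs} {y ∷ ys} eq (a ∷ as) =
  subst (λ r → Above r ys) (∷-injectiveˡ eq) (Below-tops (∷-injectiveʳ eq) a) ∷ Asc-tops (∷-injectiveʳ eq) as

record Unfolded (k : ℕ) (t : Tree) : Set where
  field
    {rest}  : Tree
    {queue} : List Tree
    unfold  : Unfold k t rest queue
    top-eq  : top t ≡ top rest
    ord     : Ord rest
    ordQ    : All Ord queue
    minQ    : All Min queue
    weight  : ∀ w → wt w t ≡ wts w (rest ∷ queue)

record Unfoldeds (k : ℕ) (ts : List Tree) : Set where
  field
    {rest}  : List Tree
    {queue} : List Tree
    unfold  : Unfolds k ts rest queue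
    top-eq  : map top ts ≡ map top rest
    ord     : All Ord rest
    ordQ    : All Ord queue
    minQ    : All Min queue
    weight  : ∀ w → wts w ts ≡ wts w (rest ++ queue)

-- `NL` makes the forest below a special vertex nonempty. Unfolding the children first does not
-- change their roots, so the remaining forest is still nonempty and ascending and `cut` applies.
unfold-exists  : ∀ {k t} → Ord t → Simple t → NL k t → Unfolded k t
unfolds-exists : ∀ {k ts} → All Ord ts → Simples ts → All (NL k) ts → Unfoldeds k ts
unfold-exists {k} {node v ts} (node a o) u (node nl nls) with unfolds-exists {k} o (Simple-kids u) nls | v <? k
... | U | no ¬s = record
  { unfold = plain ¬s (unfold U) ; top-eq = refl ; ord = node (Asc-tops (top-eq U) a) (ord U)
  ; ordQ = ordQ U ; minQ = minQ U
  ; weight = λ w → trans (cong (w v +_) (trans (weight U w) (wts-++ w (rest U)))) (sym (+-assoc (w v) _ _)) }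
  where open Unfoldeds
... | U | yes s = go (rest U) refl
  where
  open Unfoldeds
  go : ∀ F → rest U ≡ F → Unfolded k (node v ts)
  go [] eq = ⊥-elim (empty ts (trans (top-eq U) (cong (map top) eq)) (nl s))
    where
    empty : ∀ ts → map top ts ≡ [] → ts ≢ [] → ⊥
    empty [] _ ne = ne refl
  go (t₁ ∷ F) refl
    with o₁ ∷ os ← ord U
    with N , F′ , eq , m , oN , aF , oF , wts-eq ← cut o₁
      (Simple-∈ (Simples-++ˡ (rest U) (Simples-resp (weight U) (Simple-kids u))) (here refl))
      (Asc-tops (top-eq U) a) os
    = record
    { unfold = split s m aF (Simples-∷ (Simples-resp (sym ∘ wts-eq)
        (Simples-++ˡ (rest U) (Simples-resp (weight U) (Simple-kids u)))) (In-top N))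
        (subst (λ F → Unfolds k ts F (queue U)) eq (unfold U))
    ; top-eq = refl ; ord = node aF oF ; ordQ = oN ∷ ordQ U ; minQ = m ∷ minQ U
    ; weight = λ w → trans (cong (w v +_) (trans (weight U w) (trans (wts-++ w (rest U)) (cong (_+ wts w (queue U)) (sym (wts-eq w))))))
        (lemma (w v) (wt w N) (wts w F′) (wts w (queue U))) }
    where
    open +-*-Solver
    lemma : ∀ a b c d → a + (b + c + d) ≡ a + c + (b + d)
    lemma = solve 4 (λ a b c d → a :+ (b :+ c :+ d) := a :+ c :+ (b :+ d)) refl
unfolds-exists [] _ _ = record
  { unfold = [] ; top-eq = refl ; ord = [] ; ordQ = [] ; minQ = [] ; weight = λ _ → refl }
unfolds-exists {ts = t ∷ ts} (o ∷ os) u (n ∷ ns) = record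
  { unfold = T.unfold ∷ Ts.unfold ; top-eq = cong₂ _∷_ T.top-eq Ts.top-eq ; ord = T.ord ∷ Ts.ord
  ; ordQ = All.++⁺ T.ordQ Ts.ordQ ; minQ = All.++⁺ T.minQ Ts.minQ
  ; weight = λ w → trans (cong₂ _+_ (T.weight w) (trans (Ts.weight w) (wts-++ w Ts.rest)))
      (trans (lemma (wt w T.rest) (wts w T.queue) (wts w Ts.rest) (wts w Ts.queue))
        (sym (cong (wt w T.rest +_) (trans (wts-++ w Ts.rest) (cong (wts w Ts.rest +_) (wts-++ w T.queue))))))
  }
  where
  module T = Unfolded (unfold-exists o (Simple-∈ u (here refl)) n)
  module Ts = Unfoldeds (unfolds-exists os (Simples-tail u) ns)
  open +-*-Solver
  lemma : ∀ a b c d → a + b + (c + d) ≡ a + (c + (b + d))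
  lemma = solve 4 (λ a b c d → a :+ b :+ (c :+ d) := a :+ (c :+ (b :+ d))) refl

record Folded (k : ℕ) (t′ : Tree) (c : ℕ) (q : List Tree) : Set where
  constructor folded
  field
    {tree}   : Tree
    {used}   : List Tree
    {unused} : List Tree
    unfold   : Unfold k tree t′ used
    queue    : q ≡ used ++ unused
    luk      : Luk k c unused
    ord      : Ord tree
    nl       : NL k tree
    top-eq   : top t′ ≡ top tree
    weight   : ∀ w → wt w tree ≡ wts w (t′ ∷ used)

record Foldeds (k : ℕ) (ts′ : List Tree) (c : ℕ) (q : List Tree) : Set where
  constructor folded
  field
    {trees}  : List Tree
    {used}   : List Tree
    {unused} : List Tree
    unfold   : Unfolds k trees ts′ used
    queue    : q ≡ used ++ unused
    luk      : Luk k c unused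
    ord      : All Ord trees
    nl       : All (NL k) trees
    top-eq   : map top ts′ ≡ map top trees
    weight   : ∀ w → wts w trees ≡ wts w (ts′ ++ used)

Simples-⊆ : ∀ {xs ys} → (∀ w → wts w xs ≤ wts w ys) → Simples ys → Simples xs
Simples-⊆ le u = mk λ x → ≤-trans (le (δ x)) (once u x)

-- `ins M F` is not a subterm of the tree, so the recursion is bounded by the length of the queue,
-- which drops whenever a tree is taken. `Luk` ensures that a special vertex never meets an empty
-- queue.
fold-exists  : ∀ {k} m {t′ c q} → length q ≤ m → Ord t′ → All Ord q → All Min q → Simples (t′ ∷ q) →
  Luk k (wt (χ k) t′ + c) q → Folded k t′ c q
fold-split   : ∀ {k} m {v F c M q} → length q ≤ m → v < k → Ord (node v F) → Ord M → All Ord q → Min M → All Min q →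
  Simples (node v F ∷ M ∷ q) → Luk k (wts (χ k) F + c + wt (χ k) M) q → Folded k (node v F) c (M ∷ q)
folds-exists : ∀ {k} m {ts′ c q} → length q ≤ m → All Ord ts′ → All Ord q → All Min q → Simples (ts′ ++ q) →
  Luk k (wts (χ k) ts′ + c) q → Foldeds k ts′ c q
fold-exists {k} m {node v F} {c} {q} le (node a o) oq mq u l with v <? k
... | no ¬s rewrite χ-≥ {k} {v} (≮⇒≥ ¬s)
  with folded U eq l′ o′ nls te wte ← folds-exists m {F} le o oq mq
    (Simples-⊆ (λ w → ≤-trans (≤-trans (≤-reflexive (wts-++ w F)) (m≤n+m _ (w v)))
                              (≤-reflexive (sym (+-assoc (w v) _ _)))) u) l
  = folded (plain ¬s U) eq l′ (node (Asc-tops te a) o′) (node (λ s → contradiction s ¬s) nls) refl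
    (λ w → trans (cong (w v +_) (trans (wte w) (wts-++ w F))) (sym (+-assoc (w v) _ _)))
fold-exists {k} (suc m) {node v F} {c} {M ∷ q} (s≤s le) o (oM ∷ oq) (mM ∷ mq) u l | yes s
  rewrite χ-< {k} {v} s with next l ← l = fold-split m le s o oM oq mM mq u l
fold-exists zero {node v F} {c} {[]} _ _ _ _ _ l | yes s rewrite χ-< {_} {v} s = case l of λ ()
fold-exists (suc m) {node v F} {c} {[]} _ _ _ _ _ l | yes s rewrite χ-< {_} {v} s = case l of λ ()
fold-split {k} m {v} {F} {c} {M} {q} le s (node a o) oM oq mM mq u l = result (folds-exists m {ins M F} {c} {q} le
    (Ord-ins oM mM a o) oq mq
    (Simples-⊆ (λ w → ≤-trans (≤-reflexive (trans (wts-++ w (ins M F)) (trans (cong (_+ wts w q) (wts-ins w M a M∉))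
      (lemma₃ (wt w M) (wts w F) (wts w q))))) (≤-trans (m≤n+m _ (w v)) (≤-reflexive (sym (+-assoc (w v) _ _))))) u)
    (subst (λ x → Luk k x q) (trans (lemma₁ (wts (χ k) F) c (wt (χ k) M)) (cong (_+ c) (sym (wts-ins (χ k) M a M∉)))) l))
  where
  open +-*-Solver
  lemma₁ : ∀ a b c → a + b + c ≡ c + a + b
  lemma₁ = solve 3 (λ a b c → a :+ b :+ c := c :+ a :+ b) refl
  lemma₂ : ∀ a b c d → a + (b + c + d) ≡ a + c + (b + d)
  lemma₂ = solve 4 (λ a b c d → a :+ (b :+ c :+ d) := a :+ c :+ (b :+ d)) refl
  lemma₃ : ∀ a b c → a + b + c ≡ b + (a + c)
  lemma₃ = solve 3 (λ a b c → a :+ b :+ c := b :+ (a :+ c)) refl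
  nonempty : ∀ M trees → map top (ins M F) ≡ map top trees → trees ≢ []
  nonempty (node _ _) _ eq refl = case eq of λ ()
  M∉ : ¬ Ins (top M) F
  M∉ i = Simples-∷ u (In-kid i) (Ins-here (In-top M))
  result : Foldeds k (ins M F) c q → Folded k (node v F) c (M ∷ q)
  result (folded {trees} {used} U eq l′ o′ nls te wte) =
    folded (split s mM a M∉ U) (cong (M ∷_) eq) l′ (node (Asc-tops te (Asc-ins M a)) o′)
      (node (λ _ → nonempty M trees te) nls) refl
      (λ w → trans (cong (w v +_) (trans (wte w) (trans (wts-++ w (ins M F)) (cong (_+ wts w used) (wts-ins w M a M∉)))))
        (lemma₂ (w v) (wt w M) (wts w F) (wts w used)))
folds-exists m {[]} _ _ _ _ _ l = folded [] refl l [] [] refl λ _ → refl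
folds-exists {k} m {t′ ∷ ts′} {c} {q} le (o ∷ os) oq mq u l
  with folded {used = q₁} {q₂} U refl l₁ o₁ n₁ te₁ w₁ ← fold-exists m {t′} {wts (χ k) ts′ + c} {q} le o oq mq
    (Simples-⊆ (λ w → +-monoʳ-≤ (wt w t′) (≤-trans (m≤n+m _ (wts w ts′)) (≤-reflexive (sym (wts-++ w ts′))))) u)
    (subst (λ x → Luk k x q) (+-assoc (wt (χ k) t′) _ c) l)
  with folded {used = q₃} Us refl l₂ o₂ n₂ te₂ w₂ ← folds-exists m {ts′} {c} {q₂}
    (≤-trans (≤-trans (m≤n+m _ (length q₁)) (≤-reflexive (sym (length-++ q₁)))) le)
    os (All.++⁻ʳ q₁ oq) (All.++⁻ʳ q₁ mq)
    (Simples-⊆ (λ w → ≤-trans (≤-reflexive (wts-++ w ts′)) (≤-trans (+-monoʳ-≤ (wts w ts′)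
      (≤-trans (m≤n+m _ (wts w q₁)) (≤-reflexive (sym (wts-++ w q₁)))))
      (≤-trans (≤-reflexive (sym (wts-++ w ts′))) (m≤n+m _ (wt w t′))))) u) l₁
  = folded (U ∷ Us) (sym (++-assoc q₁ q₃ _)) l₂ (o₁ ∷ o₂) (n₁ ∷ n₂) (cong₂ _∷_ te₁ te₂)
    λ w → trans (cong₂ _+_ (w₁ w) (trans (w₂ w) (wts-++ w ts′)))
      (trans (lemma (wt w t′) (wts w q₁) (wts w ts′) (wts w q₃))
        (sym (cong (wt w t′ +_) (trans (wts-++ w ts′) (cong (wts w ts′ +_) (wts-++ w q₁))))))
  where
  open +-*-Solver
  lemma : ∀ a b c d → a + b + (c + d) ≡ a + (c + (b + d))
  lemma = solve 4 (λ a b c d → a :+ b :+ (c :+ d) := a :+ (c :+ (b :+ d))) refl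

-- Good forests on `[n]` and the trees obtained from them

record Cover (n : ℕ) (ts : List Tree) : Set where
  constructor mk
  field covers : ∀ x → occs x ts ≡ χ n x

open Cover public

Cover-Simples : ∀ {n ts} → Cover n ts → Simples ts
Cover-Simples {n} (mk c) = mk λ x → subst (_≤ 1) (sym (c x)) (χ≤1 n x)

Cover-resp : ∀ {n xs ys} → (∀ w → wts w xs ≡ wts w ys) → Cover n xs → Cover n ys
Cover-resp eq (mk c) = mk λ x → trans (sym (eq (δ x))) (c x)

Cover-Ins : ∀ {n ts x} → Cover n ts → x < n → Ins x ts
Cover-Ins {x = x} (mk c) lt = mk (≤-reflexive (sym (trans (c x) (χ-< lt))))

Cover-bound : ∀ {n ts x} → Cover n ts → Ins x ts → x < n
Cover-bound {n} {x = x} (mk c) (mk p) = χ>0 n x (subst (1 ≤_) (c x) p)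

NL⇒edge : ∀ {k t v} → NL k t → v < k → In v t → ∃ λ c → Edge v c t
NLs⇒edge : ∀ {k ts v} → All (NL k) ts → v < k → Ins v ts → ∃₂ λ t c → t ∈ ts × Edge v c t
NL⇒edge {v = v} (node {u} {[]} nl _) lt i with In-node i
... | inj₁ refl   = ⊥-elim (nl lt refl)
... | inj₂ (mk ())
NL⇒edge {v = v} (node {u} {t ∷ ts} nl nls) lt i with In-node i
... | inj₁ refl = top t , here (here refl) refl
... | inj₂ j with s , c , s∈ , e ← NLs⇒edge nls lt j = c , there s∈ e
NLs⇒edge [] _ (mk ())
NLs⇒edge {ts = t ∷ ts} (n ∷ ns) lt i with Ins-∷ t i
... | inj₁ j with c , e ← NL⇒edge n lt j = t , c , here refl , e
... | inj₂ j with s , c , s∈ , e ← NLs⇒edge ns lt j = s , c , there s∈ , e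

edge⇒NL : ∀ {k} t → Simple t → (∀ {v} → v < k → In v t → ∃ λ c → Edge v c t) → NL k t
edges⇒NL : ∀ {k} ts → Simples ts → (∀ {v s} → s ∈ ts → v < k → In v s → ∃ λ c → Edge v c s) → All (NL k) ts
edge⇒NL (node u ts) s f = node
  (λ lt → λ { refl → case proj₂ (f lt (In-top (node u []))) of λ { (here () _) ; (there () _) } })
  (edges⇒NL ts (Simple-kids s) λ s∈ lt i → let c , e = f lt (In-kid (In-∈ s∈ i)) in c , Edge-in-Sub s (kid s∈ self) i e)
edges⇒NL [] _ _ = []
edges⇒NL (t ∷ ts) u f = edge⇒NL t (Simple-∈ u (here refl)) (f (here refl)) ∷ edges⇒NL ts (Simples-tail u) (f ∘ there)

-- `Luk` combines the inequalities for initial segments with the final equality; for empty `Q` it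
-- says that `A` has no special vertex, so `proper` also covers the second kind of one-tree forest.
data KG (k : ℕ) : List Tree → Set where
  single : ∀ {z} → z < k → KG k [ node z [] ]
  proper : ∀ {A Q} → All Min Q → Luk k (wt (χ k) A) Q → KG k (A ∷ Q)

data Block (k : ℕ) : List Tree → Tree → Set where
  single : ∀ {z} → z < k → Block k [ node z [] ] (node z [])
  block  : ∀ {A Q t} → Luk k (wt (χ k) A) Q → Unfold k t A Q → Block k (A ∷ Q) t

-- The root is exempt: once the tree hangs on the path, the next vertex of the path is a child of
-- its root.
NLkids : ℕ → Tree → Set
NLkids k t = All (NL k) (kids t)

single-Luk : ∀ {k z} → z < k → ¬ Luk k (wt (χ k) (node z [])) []
single-Luk {k} {z} lt l rewrite χ-< {k} {z} lt = case l of λ ()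

Block-fun : ∀ {k F t s} → Block k F t → Block k F s → t ≡ s
Block-fun (single _)  (single _)   = refl
Block-fun (single lt) (block l _)  = ⊥-elim (single-Luk lt l)
Block-fun (block l _) (single lt)  = ⊥-elim (single-Luk lt l)
Block-fun (block _ u) (block _ u′) = proj₁ (Unfold-parse {r = []} {r′ = []} u u′ refl)

single-Unfold : ∀ {k z A Q} → z < k → ¬ Unfold k (node z []) A Q
single-Unfold lt (plain ¬lt _) = ¬lt lt
single-Unfold lt (split {M = node _ _} _ _ _ _ ())

Block-inj : ∀ {k F F′ t} → Block k F t → Block k F′ t → F ≡ F′
Block-inj (single _)  (single _)   = refl
Block-inj (single lt) (block _ u)  = ⊥-elim (single-Unfold lt u)
Block-inj (block _ u) (single lt)  = ⊥-elim (single-Unfold lt u)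
Block-inj (block _ u) (block _ u′) with refl , refl ← Unfold-fun u u′ = refl

block-tree : ∀ {k F} → KG k F → All Ord F → Simples F →
  ∃ λ t → Block k F t × Ord t × NLkids k t × (∀ w → wt w t ≡ wts w F)
block-tree (single lt) (o ∷ []) _ = _ , single lt , o , [] , λ w → sym (+-identityʳ _)
block-tree {k} (proper {A} {Q} m l) (o ∷ os) u
  with folded {used = q} U refl done oT (node _ nls) _ we ←
    fold-exists (length Q) {A} {0} ≤-refl o os m u (subst (λ x → Luk k x Q) (sym (+-identityʳ _)) l)
  = _ , block l (subst (Unfold k _ A) (sym (++-identityʳ _)) U) , oT , nls ,
    λ w → trans (we w) (cong (λ x → wt w A + wts w x) (sym (++-identityʳ q)))

BlockOf : ℕ → Tree → Set
BlockOf k t = ∃ λ F → Block k F t × KG k F × All Ord F × (∀ w → wt w t ≡ wts w F)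

unfolded-block : ∀ {k t} → Unfolded k t → BlockOf k t
unfolded-block {k} U = _ , block l unfold , proper minQ l , ord ∷ ordQ , weight
  where
  open Unfolded U
  l : Luk k (wt (χ k) rest) queue
  l = subst₂ (Luk k) (+-identityʳ _) (++-identityʳ _) (Unfold-Luk unfold done)

-- When the children satisfy `NL`, the tree violates it only if its root is special and childless,
-- which is the one-vertex block.
block-forest : ∀ {k t} → Ord t → Simple t → NLkids k t → BlockOf k t
block-forest {k} {node v ts} o u nls with v <? k
... | no ¬lt = unfolded-block (unfold-exists o u (node (λ lt → contradiction lt ¬lt) nls))
block-forest {t = node v []} o _ _ | yes lt = _ , single lt , single lt , o ∷ [] , λ w → sym (+-identityʳ _)
block-forest {t = node v (_ ∷ _)} o u nls | yes _ = unfolded-block (unfold-exists o u (node (λ _ ()) nls))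

Pointwise-fun : ∀ {A B : Set} {R : A → B → Set} → (∀ {x y y′} → R x y → R x y′ → y ≡ y′) →
  ∀ {xs ys ys′} → Pointwise R xs ys → Pointwise R xs ys′ → ys ≡ ys′
Pointwise-fun f []       []       = refl
Pointwise-fun f (r ∷ rs) (s ∷ ss) = cong₂ _∷_ (f r s) (Pointwise-fun f rs ss)

Pointwise-inj : ∀ {A B : Set} {R : A → B → Set} → (∀ {x x′ y} → R x y → R x′ y → x ≡ x′) →
  ∀ {xs xs′ ys} → Pointwise R xs ys → Pointwise R xs′ ys → xs ≡ xs′
Pointwise-inj f []       []       = refl
Pointwise-inj f (r ∷ rs) (s ∷ ss) = cong₂ _∷_ (f r s) (Pointwise-inj f rs ss)

blocks-tree : ∀ {k Fs} → All (KG k) Fs → All (All Ord) Fs → Simples (concat Fs) →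
  ∃ λ Ts → Pointwise (Block k) Fs Ts × All Ord Ts × All (NLkids k) Ts × (∀ w → wts w Ts ≡ wts w (concat Fs))
blocks-tree [] [] _ = [] , [] , [] , [] , λ _ → refl
blocks-tree {Fs = F ∷ Fs} (g ∷ gs) (o ∷ os) u
  with t , b , oT , n , we ← block-tree g o (Simples-++ˡ F u)
     | Ts , bs , oTs , ns , wes ← blocks-tree gs os (Simples-++ʳ F u)
  = t ∷ Ts , b ∷ bs , oT ∷ oTs , n ∷ ns , λ w → trans (cong₂ _+_ (we w) (wes w)) (sym (wts-++ w F))

blocks-forest : ∀ {k Ts} → All Ord Ts → Simples Ts → All (NLkids k) Ts →
  ∃ λ Fs → Pointwise (Block k) Fs Ts × All (KG k) Fs × All (All Ord) Fs × (∀ w → wts w Ts ≡ wts w (concat Fs))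
blocks-forest [] _ [] = [] , [] , [] , [] , λ _ → refl
blocks-forest {Ts = t ∷ Ts} (o ∷ os) u (n ∷ ns)
  with F , b , g , oF , we ← block-forest o (Simple-∈ u (here refl)) n
     | Fs , bs , gs , oFs , wes ← blocks-forest os (Simples-tail u) ns
  = F ∷ Fs , b ∷ bs , g ∷ gs , oF ∷ oFs , λ w → trans (cong₂ _+_ (we w) (wes w)) (sym (wts-++ w F))

All-insert⁻ : ∀ {P : Tree → Set} t {ts} → Asc ts → ¬ Ins (top t) ts → All P (insert t ts) → P t × All P ts
All-insert⁻ {P} t {ts} a i ps with p ∷ qs ← All.++⁻ʳ (below (top t) ts) ps =
  p , subst (All P) (below-above a i) (All.++⁺ (All.++⁻ˡ (below (top t) ts) ps) qs)

NL-spine⁺ : ∀ {k z Ts} → ¬ z < k → All (NLkids k) Ts → NL k (spine z [] Ts)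
NL-spine⁺ ¬lt [] = node (λ lt → contradiction lt ¬lt) []
NL-spine⁺ {k} {z} {node u cs ∷ Ts} ¬lt (n ∷ ns) =
  node (λ _ eq → case subst (spine z [] Ts ∈_) eq (∈-insert (spine z [] Ts) cs) of λ ())
       (All-insert (spine z [] Ts) (NL-spine⁺ ¬lt ns) n)

NL-spine⁻ : ∀ {k z Ts} → Spine z [] Ts → NL k (spine z [] Ts) → All (NLkids k) Ts
NL-spine⁻ {Ts = []} _ _ = []
NL-spine⁻ {z = z} {node u cs ∷ Ts} s (node _ nls) with node a _ ∷ _ ← Spine.ord s
  with n , ns ← All-insert⁻ (spine z [] Ts) a (spine-fresh s) nls = ns ∷ NL-spine⁻ (Spine-tail s) n

spine-Sub : ∀ z F Ts → Sub (node z F) (spine z F Ts)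
spine-Sub z F []               = self
spine-Sub z F (node u cs ∷ Ts) = kid (∈-insert (spine z F Ts) cs) (spine-Sub z F Ts)

record IsC (n k : ℕ) (Fs : List (List Tree)) : Set where
  field
    kgood : All (KG k) Fs
    ord   : All (All Ord) Fs
    cover : Cover n (concat Fs)

record IsF (n k : ℕ) (t : Tree) : Set where
  field
    ord     : Ord t
    cover   : Cover (suc n) [ t ]
    leaf    : ∀ {c} → ¬ Edge n c t
    nonleaf : ∀ {v} → v < k → ∃ λ c → Edge v c t

record CF (n k : ℕ) (Fs : List (List Tree)) (t : Tree) : Set where
  constructor cf
  field
    {Ts}   : List Tree
    blocks : Pointwise (Block k) Fs Ts
    ok     : Spine n [] Ts
    tree   : t ≡ spine n [] Ts

CF-fun : ∀ {n k Fs t t′} → CF n k Fs t → CF n k Fs t′ → t ≡ t′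
CF-fun (cf b _ refl) (cf b′ _ refl) with refl ← Pointwise-fun Block-fun b b′ = refl

CF-inj : ∀ {n k Fs Fs′ t} → CF n k Fs t → CF n k Fs′ t → Fs ≡ Fs′
CF-inj (cf b s refl) (cf b′ s′ eq) with _ , refl ← spine-injective s s′ eq = Pointwise-inj Block-inj b b′

χ-top : ∀ n x → δ x n + χ n x ≡ χ (suc n) x
χ-top zero    zero    = refl
χ-top zero    (suc x) = refl
χ-top (suc n) zero    = refl
χ-top (suc n) (suc x) = χ-top n x

Cover-∷ : ∀ {n ts} → Cover n ts → Cover (suc n) (node n [] ∷ ts)
Cover-∷ {n} (mk c) = mk λ x → trans (cong₂ _+_ (+-identityʳ (δ x n)) (c x)) (χ-top n x)

Cover-∷⁻ : ∀ {n ts} → Cover (suc n) (node n [] ∷ ts) → Cover n ts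
Cover-∷⁻ {n} (mk c) = mk λ x → +-cancelˡ-≡ (δ x n) _ _
  (trans (cong (_+ _) (sym (+-identityʳ (δ x n)))) (trans (c x) (sym (χ-top n x))))

wts-[_] : ∀ {t ts} → (∀ w → wt w t ≡ wts w ts) → ∀ w → wts w [ t ] ≡ wts w ts
wts-[ eq ] w = trans (+-identityʳ _) (eq w)

-- By `k ≤ n` the label `n` at the end of the path is not special, so it may be a leaf.
C⇒F : ∀ {n k Fs} → k ≤ n → IsC n k Fs → ∃ λ t → IsF n k t × CF n k Fs t
C⇒F {n} {k} {Fs} k≤n c with Ts , bs , os , ns , we ← blocks-tree (IsC.kgood c) (IsC.ord c) (Cover-Simples (IsC.cover c))
  = spine n [] Ts , record
    { ord = spine-Ord s ; cover = cov
    ; leaf = λ e → case Edge-in-Sub (spine-Simple s) (spine-Sub n [] Ts) (In-top (node n [])) e of λ { (here () _) ; (there () _) }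
    ; nonleaf = λ lt → NL⇒edge (NL-spine⁺ (≤⇒≯ k≤n) ns) lt
        (Ins-[] (Cover-Ins {ts = [ spine n [] Ts ]} cov (≤-trans lt (≤-trans k≤n (n≤1+n n))))) }
  , cf bs s refl
  where
  Ins-[] : ∀ {x t} → Ins x [ t ] → In x t
  Ins-[] {t = t} i with Ins-∷ t i
  ... | inj₁ j = j
  ... | inj₂ (mk ())
  covT : Cover (suc n) (node n [] ∷ Ts)
  covT = Cover-∷ (Cover-resp (sym ∘ we) (IsC.cover c))
  s : Spine n [] Ts
  s = spn [] [] os (Cover-Simples covT)
  cov : Cover (suc n) [ spine n [] Ts ]
  cov = Cover-resp (sym ∘ wts-[_] {spine n [] Ts} {node n [] ∷ Ts} (λ w → wt-spine w s)) covT

F⇒C : ∀ {n k t} → k ≤ n → IsF n k t → ∃ λ Fs → IsC n k Fs × CF n k Fs t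
F⇒C {n} {k} {t} k≤n f = go (spine-exists ord simple n∈)
  where
  open IsF f
  simple : Simple t
  simple = Simple-∈ (Cover-Simples cover) (here refl)
  n∈ : In n t
  n∈ with Ins-∷ t (Cover-Ins {ts = [ t ]} cover (n<1+n n))
  ... | inj₁ j = j
  ... | inj₂ (mk ())
  go : (∃₂ λ F Ts → Spine n F Ts × t ≡ spine n F Ts) → ∃ λ Fs → IsC n k Fs × CF n k Fs t
  go (s ∷ F , Ts , sp , refl) = ⊥-elim (leaf (Sub-Edge (spine-Sub n (s ∷ F) Ts) (here (here refl) refl)))
  go ([] , Ts , sp , refl)
    with Fs , bs , gs , oFs , we ← blocks-forest (Spine.ord sp) (Simples-tail (Spine.simple sp))
      (NL-spine⁻ sp (edge⇒NL _ simple λ lt _ → nonleaf lt))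
    = Fs , record { kgood = gs ; ord = oFs
                  ; cover = Cover-resp {xs = Ts} we
                      (Cover-∷⁻ (Cover-resp (wts-[_] {spine n [] Ts} {node n [] ∷ Ts} (λ w → wt-spine w sp)) cover)) }
    , cf bs sp refl

-- Ordered forests as sequences of blocks

++-equal : ∀ {A : Set} (a : List A) {b c d} → a ++ b ≡ c ++ d →
  (∃ λ e → c ≡ a ++ e × b ≡ e ++ d) ⊎ (∃ λ e → a ≡ c ++ e × d ≡ e ++ b)
++-equal [] {c = c} eq = inj₁ (c , refl , eq)
++-equal (x ∷ a) {c = []} eq = inj₂ (x ∷ a , refl , sym eq)
++-equal (x ∷ a) {c = y ∷ c} eq with refl , eq′ ← ∷-injective eq with ++-equal a {c = c} eq′
... | inj₁ (e , refl , r) = inj₁ (e , refl , r)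
... | inj₂ (e , refl , r) = inj₂ (e , refl , r)

Cyc-trans : ∀ {A : Set} {xs ys zs : List A} → Cyc xs ys → Cyc ys zs → Cyc xs zs
Cyc-trans (a , b , refl , refl) (c , d , eq , refl) with ++-equal b {c = c} eq
... | inj₁ (e , refl , refl) = e , d ++ b , ++-assoc e d b , sym (++-assoc d b e)
... | inj₂ (e , refl , refl) = a ++ c , e , sym (++-assoc a c e) , ++-assoc e a c

length-++-injective : ∀ {A : Set} (a : List A) {b c d} → a ++ b ≡ c ++ d → length b ≡ length d → a ≡ c × b ≡ d
length-++-injective [] {c = []} eq _ = refl , eq
length-++-injective [] {b} {x ∷ c} {d} refl l = ⊥-elim (<-irrefl (sym l) (s≤s (≤-trans (m≤n+m (length d) (length c))
  (≤-reflexive (sym (length-++ c))))))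
length-++-injective (x ∷ a) {b} {[]} refl l = ⊥-elim (<-irrefl l (s≤s (≤-trans (m≤n+m (length b) (length a))
  (≤-reflexive (sym (length-++ a))))))
length-++-injective (x ∷ a) {c = y ∷ c} eq l with refl , eq′ ← ∷-injective eq
  with refl , refl ← length-++-injective a {c = c} eq′ l = refl , refl

split-suffix : ∀ {A : Set} (xs : List A) i → i ≤ length xs → ∃₂ λ a b → xs ≡ a ++ b × length b ≡ i
split-suffix xs i le = take m xs , drop m xs , sym (take++drop≡id m xs) ,
  trans (length-drop m xs) (m∸[m∸n]≡n le)
  where m = length xs ∸ i

max-position : ∀ P {N Q P′ N′ Q′} → P ++ N ∷ Q ≡ P′ ++ N′ ∷ Q′ → Below (top N) Q → Below (top N) P →
  Below (top N′) Q′ → Below (top N′) P′ → P ≡ P′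
max-position [] {P′ = []} _ _ _ _ _ = refl
max-position [] {P′ = x ∷ P′} refl q _ _ (p ∷ _) = ⊥-elim (<-asym p (All.lookup q (∈-++⁺ʳ P′ (here refl))))
max-position (x ∷ P) {P′ = []} refl _ (p ∷ _) q _ = ⊥-elim (<-asym p (All.lookup q (∈-++⁺ʳ P (here refl))))
max-position (x ∷ P) {P′ = y ∷ P′} eq q (_ ∷ p) q′ (_ ∷ p′) =
  cong₂ _∷_ (∷-injectiveˡ eq) (max-position P (∷-injectiveʳ eq) q p q′ p′)

-- Ranks among the special vertices

wt-zero  : ∀ t → wt (χ 0) t ≡ 0
wts-zero : ∀ ts → wts (χ 0) ts ≡ 0
wt-zero (node v ts) = wts-zero ts
wts-zero []       = refl
wts-zero (t ∷ ts) = cong₂ _+_ (wt-zero t) (wts-zero ts)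

count-suc : ∀ m ts → wts (χ (suc m)) ts ≡ wts (χ m) ts + occs m ts
count-suc m = wts-split (χ (suc m)) (χ m) (δ m) (χ-suc m)

count-all : ∀ {n k ts} → Cover n ts → k ≤ n → wts (χ k) ts ≡ k
count-all {k = zero} {ts} c _ = wts-zero ts
count-all {n} {suc k} {ts} c lt = trans (count-suc k ts)
  (trans (cong₂ _+_ (count-all c (≤-trans (n≤1+n k) lt)) (trans (covers c k) (χ-< lt))) (+-comm k 1))

-- The count starts at 0 and grows by at most one with `m`, so at some label `z` it passes from `i`
-- to `i + 1`; then `z` occurs and has rank `i`.
count-exists : ∀ m ts {i} → Simples ts → i < wts (χ m) ts → ∃ λ z → z < m × wts (χ z) ts ≡ i × Ins z ts
count-exists zero ts u lt = ⊥-elim (<⇒≱ lt (subst (_≤ _) (sym (wts-zero ts)) z≤n))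
count-exists (suc m) ts {i} u lt with i <? wts (χ m) ts
... | yes lt′ with z , z<m , eq , p ← count-exists m ts u lt′ = z , ≤-trans z<m (n≤1+n m) , eq , p
... | no ¬lt = m , ≤-refl , sym (≤-antisym i≤ (≮⇒≥ ¬lt)) , mk (+-cancelˡ-≤ (wts (χ m) ts) 1 _
    (≤-trans (≤-reflexive (+-comm _ 1)) (≤-trans (s≤s (≮⇒≥ ¬lt)) (≤-trans lt (≤-reflexive (count-suc m ts))))))
  where
  i≤ : i ≤ wts (χ m) ts
  i≤ = s≤s⁻¹ (≤-trans lt (≤-trans (≤-reflexive (count-suc m ts))
    (≤-trans (+-monoʳ-≤ (wts (χ m) ts) (once u m)) (≤-reflexive (+-comm _ 1)))))

count-mono : ∀ {z m} ts → z < m → Ins z ts → wts (χ z) ts < wts (χ m) ts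
count-mono {z} {suc m} ts (s≤s z≤m) (mk p) with z ≟ m
... | yes refl = ≤-trans (≤-trans (≤-reflexive (+-comm 1 _)) (+-monoʳ-≤ (wts (χ z) ts) p)) (≤-reflexive (sym (count-suc z ts)))
... | no z≢m = ≤-trans (count-mono ts (≤∧≢⇒< z≤m z≢m) (mk p)) (≤-trans (m≤m+n _ _) (≤-reflexive (sym (count-suc m ts))))

count-injective : ∀ {z z′} ts → Ins z ts → Ins z′ ts → wts (χ z) ts ≡ wts (χ z′) ts → z ≡ z′
count-injective {z} {z′} ts p p′ eq with <-cmp z z′
... | tri< lt _ _ = ⊥-elim (<-irrefl eq (count-mono ts lt p))
... | tri≈ _ e _ = e
... | tri> _ _ gt = ⊥-elim (<-irrefl (sym eq) (count-mono ts gt p′))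

-- The forests Ms of as many minimally rooted trees as special vertices correspond to the triples of
-- a special vertex z and forests As and Ms′ on the remaining vertices: the position in Ms of the
-- tree with the largest root is the rank of z among the special vertices, so it may be forgotten;
-- then Ms is rotated so that it begins with the tree containing z, which is replaced by As.
record Loop (k z : ℕ) (As Ms′ Ms : List Tree) : Set where
  constructor loop
  field
    {M N}  : Tree
    {P Q}  : List Tree
    simple : Simples Ms
    z<k    : z < k
    cyc    : Cyc Ms (M ∷ Ms′)
    marking : Marked z As M
    at-max : Ms ≡ P ++ N ∷ Q
    max    : Below (top N) (Q ++ P)
    rank   : wts (χ z) Ms ≡ length P

module _ {k z As Ms′ Ms} (l : Loop k z As Ms′ Ms) where
  open Loop l

  Loop-wts : ∀ w → wts w Ms ≡ wts w (node z [] ∷ As ++ Ms′)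
  Loop-wts w = trans (Cyc-wts cyc w) (trans (cong (_+ wts w Ms′) (Marked-wt marking w))
    (trans (+-assoc (w z + 0) _ _) (cong (w z + 0 +_) (sym (wts-++ w As)))))

  Loop-Ins : Ins z Ms
  Loop-Ins = Ins-resp {ys = Ms} (λ w → sym (Cyc-wts cyc w)) (Ins-here {ts = Ms′} (Marked-In marking))

  Loop-cyc : Cyc Ms (N ∷ Q ++ P)
  Loop-cyc = P , N ∷ Q , at-max , refl

  Loop-head : All (λ y → In z M × ¬ In z y) Ms′
  Loop-head = All.tabulate λ y∈ → Marked-In marking , λ i →
    Simples-∷ (Simples-resp (Cyc-wts cyc) simple) (Marked-In marking) (In-∈ y∈ i)

Loop-fun : ∀ {k z z′ As As′ Ms₁ Ms₂ Ms} → Loop k z As Ms₁ Ms → Loop k z′ As′ Ms₂ Ms → z ≡ z′ × As ≡ As′ × Ms₁ ≡ Ms₂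
Loop-fun {Ms₁ = Ms₁} {Ms₂} {Ms} l@(loop {M} {N} {P} {Q} u _ c mk₁ e b r) l′@(loop {M′} {N′} {P′} {Q′} _ _ c′ mk₂ e′ b′ r′)
  with refl ← max-position P (trans (sym e) e′) (All.++⁻ˡ Q b) (All.++⁻ʳ Q b) (All.++⁻ˡ Q′ b′) (All.++⁻ʳ Q′ b′)
  with refl ← count-injective Ms (Loop-Ins l) (Loop-Ins l′) (trans r (sym r′))
  with refl ← Cyc-heads (λ x y → In _ x × ¬ In _ y) (λ { (i , _) (_ , ¬i) → ¬i i })
    (Loop-head l) (Loop-head l′) (Cyc-trans (Cyc-sym c) c′)
  with refl ← Marked-inj mk₁ mk₂ = refl , refl , refl

-- The cycle is known up to rotation, and the rank of `z` says how many trees stand before the one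
-- with the largest root, which fixes where the cycle is cut.
Loop-inj : ∀ {k z As Ms₁ Ms Ms′} → Loop k z As Ms₁ Ms → Loop k z As Ms₁ Ms′ → Ms ≡ Ms′
Loop-inj {z = z} l@(loop {M} {N} {P} {Q} u _ c mk₁ e b r) l′@(loop {M′} {N′} {P′} {Q′} _ _ c′ mk₂ e′ b′ r′)
  with refl ← Marked-fun mk₁ mk₂
  with eq ← Cyc-heads (λ x y → top y < top x) <-asym b b′
    (Cyc-trans (Cyc-sym (Loop-cyc l)) (Cyc-trans c (Cyc-trans (Cyc-sym c′) (Loop-cyc l′))))
  with refl ← ∷-injectiveˡ eq
  with refl , refl ← length-++-injective Q {c = Q′} (∷-injectiveʳ eq)
    (trans (sym r) (trans (Cyc-wts (Cyc-trans c (Cyc-sym c′)) (χ z)) r′))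
  = trans e (sym e′)

loop-open : ∀ {k Ms} → All Ord Ms → All Min Ms → Simples Ms → length Ms ≡ wts (χ k) Ms → Ms ≢ [] →
  ∃ λ z → ∃₂ λ As Ms′ → Loop k z As Ms′ Ms × All Ord As × All Ord Ms′ × All Min Ms′
loop-open {Ms = []} _ _ _ _ ne = ⊥-elim (ne refl)
loop-open {k} {Ms@(m ∷ ms)} o mins u len _
  with P , N , Q , eq , b ← max-split m ms u
  -- There are as many trees as special vertices, so every position is the rank of a special vertex.
  with z , z<k , rk , z∈ ← count-exists k Ms {length P} u (subst (length P <_) (trans (sym (trans (cong length eq) (length-++ P))) len)
    (subst (length P <_) (sym (+-suc (length P) (length Q))) (s≤s (m≤m+n _ _))))
  with M , M∈ , i ← Ins-∈ z∈
  with a , c , eq′ ← ∈-∃++ M∈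
  with cyc ← (a , M ∷ c , eq′ , refl)
  with oM ∷ oMs ← Cyc-All cyc o | mM ∷ mMs ← Cyc-All cyc mins
  with As , mk₁ ← Marked-forest oM (Simple-∈ u M∈) mM i
  = z , As , c ++ a , loop u z<k cyc mk₁ eq b rk , Marked-All mk₁ , oMs , mMs

loop-close : ∀ {k z As Ms′} → z < k → All Ord As → All Ord Ms′ → All Min Ms′ → Simples (node z [] ∷ As ++ Ms′) →
  length Ms′ ≡ wts (χ k) (As ++ Ms′) →
  ∃ λ Ms → Loop k z As Ms′ Ms × All Ord Ms × All Min Ms × length Ms ≡ wts (χ k) Ms
loop-close {k} {z} {As} {Ms′} z<k oA oM mM u len
  with M , mk₁ ← Marked-tree oA (Simples-⊆ (λ w → +-monoʳ-≤ _ (≤-trans (m≤m+n _ _) (≤-reflexive (sym (wts-++ w As))))) u)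
  = close mk₁ (max-split M Ms′ (u′ mk₁))
  where
  module _ {M} (mk₁ : Marked z As M) where
    weights : ∀ w → wts w (node z [] ∷ As ++ Ms′) ≡ wts w (M ∷ Ms′)
    weights w = trans (cong (w z + 0 +_) (wts-++ w As)) (trans (sym (+-assoc (w z + 0) _ _)) (cong (_+ wts w Ms′) (sym (Marked-wt mk₁ w))))
    u′ : Simples (M ∷ Ms′)
    u′ = Simples-resp weights u
    z∈ : Ins z (M ∷ Ms′)
    z∈ = Ins-here (Marked-In mk₁)
    len′ : suc (length Ms′) ≡ wts (χ k) (M ∷ Ms′)
    len′ = trans (cong₂ _+_ (trans (sym (χ-< z<k)) (sym (+-identityʳ _))) len) (weights (χ k))
    close : (∃ λ P → ∃₂ λ N Q → M ∷ Ms′ ≡ P ++ N ∷ Q × Below (top N) (Q ++ P)) →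
      ∃ λ Ms → Loop k z As Ms′ Ms × All Ord Ms × All Min Ms × length Ms ≡ wts (χ k) Ms
    close (P , N , Q , eq , b)
      -- Read from `N` onwards, the trees to be placed before `N` are the last ones of the cycle, in
      -- the number given by the rank of `z`. Being special itself, `z` has a rank smaller than the
      -- number of trees, so there are enough besides `N`.
      with Q′ , P′ , eq′ , lP ← split-suffix (Q ++ P) (wts (χ z) (M ∷ Ms′)) (s≤s⁻¹ (≤-trans (count-mono (M ∷ Ms′) z<k z∈)
        (≤-reflexive (trans (sym len′) (trans (cong length eq) (trans (length-++ P) (trans (+-suc (length P) (length Q))
          (cong suc (trans (+-comm (length P) _) (sym (length-++ Q)))))))))))
      = P′ ++ N ∷ Q′ ,
        loop (Simples-resp (sym ∘ Cyc-wts cyc) u′) z<k cyc mk₁ refl (subst (Below (top N)) eq′ b)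
          (trans (Cyc-wts cyc (χ z)) (sym lP)) ,
        Cyc-All (Cyc-sym cyc) (Marked-Ord mk₁ ∷ oM) , Cyc-All (Cyc-sym cyc) (Marked-Min mk₁ ∷ mM) ,
        trans (Cyc-length cyc) (trans len′ (sym (Cyc-wts cyc (χ k))))
      where
      cyc : Cyc (P′ ++ N ∷ Q′) (M ∷ Ms′)
      cyc = Cyc-trans (P′ , N ∷ Q′ , refl , cong (N ∷_) eq′) (N ∷ Q , P , refl , eq)

-- Blocks k As Ms Fs: the arbitrary trees As become the first trees of blocks, completed by initial
-- segments of Ms; when As is used up, a singleton block is produced by Loop.
data Blocks (k : ℕ) : List Tree → List Tree → List (List Tree) → Set where
  done : Blocks k [] [] []
  tree : ∀ {A Q As Ms Fs} → Luk k (wt (χ k) A) Q → Blocks k As Ms Fs → Blocks k (A ∷ As) (Q ++ Ms) ((A ∷ Q) ∷ Fs)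
  one  : ∀ {z As Ms′ Ms Fs} → Loop k z As Ms′ Ms → Blocks k As Ms′ Fs → Blocks k [] Ms ([ node z [] ] ∷ Fs)

-- A prefix code: the trees read so far determine the count, and the list ends exactly when the
-- count reaches 0.
Luk-prefix : ∀ {k c Q Q′ Ms Ms′} → Luk k c Q → Luk k c Q′ → Q ++ Ms ≡ Q′ ++ Ms′ → Q ≡ Q′ × Ms ≡ Ms′
Luk-prefix done done eq = refl , eq
Luk-prefix (next l) (next l′) eq with refl , eq′ ← ∷-injective eq
  with refl , eq″ ← Luk-prefix l l′ eq′ = refl , eq″

Loop-nonempty : ∀ {k z As Ms′} → ¬ Loop k z As Ms′ []
Loop-nonempty (loop {P = []} _ _ _ _ () _ _)
Loop-nonempty (loop {P = _ ∷ _} _ _ _ _ () _ _)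

-- An equation links the two queues because two indices of the form `Q ++ Ms` do not unify;
-- `Luk-prefix` resolves it.
Blocks-fun : ∀ {k As Ms Ms′ Fs Fs′} → Ms ≡ Ms′ → Blocks k As Ms Fs → Blocks k As Ms′ Fs′ → Fs ≡ Fs′
Blocks-fun _ done done = refl
Blocks-fun refl done (one l _) = ⊥-elim (Loop-nonempty l)
Blocks-fun refl (one l _) done = ⊥-elim (Loop-nonempty l)
Blocks-fun eq (tree l b) (tree l′ b′) with refl , eq′ ← Luk-prefix l l′ eq = cong (_ ∷_) (Blocks-fun eq′ b b′)
Blocks-fun refl (one l b) (one l′ b′) with refl , refl , refl ← Loop-fun l l′ = cong (_ ∷_) (Blocks-fun refl b b′)

Blocks-inj : ∀ {k As As′ Ms Ms′ Fs} → Blocks k As Ms Fs → Blocks k As′ Ms′ Fs → As ≡ As′ × Ms ≡ Ms′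
Blocks-inj done done = refl , refl
Blocks-inj (tree _ b) (tree _ b′) with refl , refl ← Blocks-inj b b′ = refl , refl
Blocks-inj (tree l b) (one l′ b′) = ⊥-elim (single-Luk (Loop.z<k l′) l)
Blocks-inj (one l′ b) (tree l b′) = ⊥-elim (single-Luk (Loop.z<k l′) l)
Blocks-inj (one l b) (one l′ b′) with refl , refl ← Blocks-inj b b′ = refl , Loop-inj l l′

Luk-length : ∀ {k c Q} → Luk k c Q → length Q ≡ c + wts (χ k) Q
Luk-length done = refl
Luk-length {k} (next {c} {M} l) = cong suc (trans (Luk-length l) (+-assoc c (wt (χ k) M) _))

+-exchange : ∀ a b c d → a + b + (c + d) ≡ a + c + b + d
+-exchange = solve 4 (λ a b c d → a :+ b :+ (c :+ d) := a :+ c :+ b :+ d) refl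
  where open +-*-Solver

-- `c` counts what the current block still needs, `d` the special vertices of the later arbitrary
-- trees. The balance excludes an empty queue while `c` is positive, and it is inherited by the
-- rest.
luk-split : ∀ {k} c d Ms → length Ms ≡ c + d + wts (χ k) Ms →
  ∃₂ λ Q Ms′ → Ms ≡ Q ++ Ms′ × Luk k c Q × length Ms′ ≡ d + wts (χ k) Ms′
luk-split zero d Ms eq = [] , Ms , refl , done , eq
luk-split (suc c) d [] ()
luk-split {k} (suc c) d (M ∷ Ms) eq
  with Q , Ms′ , refl , l , e ← luk-split {k} (c + wt (χ k) M) d Ms (trans (suc-injective eq) (+-exchange c d _ _))
  = M ∷ Q , Ms′ , refl , next l , e

record Blocked (k : ℕ) (Fs : List (List Tree)) : Set where
  constructor blocked
  field
    {As Ms} : List Tree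
    blocks  : Blocks k As Ms Fs
    ordA    : All Ord As
    ordM    : All Ord Ms
    minM    : All Min Ms
    weight  : ∀ w → wts w (As ++ Ms) ≡ wts w (concat Fs)
    length≡ : length Ms ≡ wts (χ k) (As ++ Ms)

wts-shift : ∀ w As Q {Ms′} → wts w (As ++ Q ++ Ms′) ≡ wts w Q + wts w (As ++ Ms′)
wts-shift w As Q {Ms′} = trans (wts-++ w As) (trans (cong (wts w As +_) (wts-++ w Q))
  (trans (swp (wts w As) (wts w Q) (wts w Ms′)) (cong (wts w Q +_) (sym (wts-++ w As)))))
  where
  open +-*-Solver
  swp : ∀ a b c → a + (b + c) ≡ b + (a + c)
  swp = solve 3 (λ a b c → a :+ (b :+ c) := b :+ (a :+ c)) refl
wts-omit : ∀ w As Q {Ms′} → wts w (As ++ Ms′) ≤ wts w (As ++ Q ++ Ms′)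
wts-omit w As Q = ≤-trans (m≤n+m _ (wts w Q)) (≤-reflexive (sym (wts-shift w As Q)))

unblock-one : ∀ {k z Fs} → z < k → Simples (node z [] ∷ concat Fs) → Blocked k Fs → Blocked k ([ node z [] ] ∷ Fs)
unblock-one {k} {z} z<k u (blocked {As} {Ms} b oA oM mM we le) =
  let Ms′ , l , oM′ , mM′ , le′ = loop-close {As = As} z<k oA oM mM
        (Simples-resp {node z [] ∷ _} (λ w → cong (w z + 0 +_) (sym (we w))) u) le
  in blocked (one l b) [] oM′ mM′ (λ w → trans (Loop-wts l w) (cong (w z + 0 +_) (we w))) le′

unblock-tree : ∀ {k A Q Fs} → Ord A → All Ord Q → All Min Q → Luk k (wt (χ k) A) Q → Blocked k Fs → Blocked k ((A ∷ Q) ∷ Fs)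
unblock-tree {k} {A} {Q} {Fs} oA′ oQ m l (blocked {As} {Ms} b oA oM mM we le) =
  blocked (tree l b) (oA′ ∷ oA) (All.++⁺ oQ oM) (All.++⁺ m mM)
    (λ w → cong (wt w A +_) (trans (weights w) (sym (wts-++ w Q))))
    (trans (length-++ Q) (trans (cong₂ _+_ (Luk-length l) (trans le (we (χ k))))
      (trans (+-assoc (wt (χ k) A) (wts (χ k) Q) _) (cong (wt (χ k) A +_) (sym (weights (χ k)))))))
  where
  weights : ∀ w → wts w (As ++ Q ++ Ms) ≡ wts w Q + wts w (concat Fs)
  weights w = trans (wts-shift w As Q) (cong (wts w Q +_) (we w))

unblock : ∀ {k Fs} → All (KG k) Fs → All (All Ord) Fs → Simples (concat Fs) → Blocked k Fs
unblock [] [] _ = blocked done [] [] [] (λ _ → refl) refl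
unblock (single z<k ∷ gs) (_ ∷ os) u = unblock-one z<k u (unblock gs os (Simples-tail u))
unblock (proper {A} {Q} m l ∷ gs) ((o ∷ oQ) ∷ os) u =
  unblock-tree o oQ m l (unblock gs os (Simples-++ʳ (A ∷ Q) u))

record Unblocked (k : ℕ) (As Ms : List Tree) : Set where
  constructor unblocked
  field
    {Fs}   : List (List Tree)
    blocks : Blocks k As Ms Fs
    kgood  : All (KG k) Fs
    ord    : All (All Ord) Fs
    weight : ∀ w → wts w (As ++ Ms) ≡ wts w (concat Fs)

size≥1 : ∀ t → 1 ≤ size t
size≥1 (node _ _) = s≤s z≤n

-- Recursion on the number of vertices, since `Loop` replaces both lists by new ones. The last
-- hypothesis is the balance, preserved by both kinds of steps.
block-up : ∀ {k} m As Ms → wts (λ _ → 1) (As ++ Ms) ≤ m → All Ord As → All Ord Ms → All Min Ms → Simples (As ++ Ms) →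
  length Ms ≡ wts (χ k) (As ++ Ms) → Unblocked k As Ms
block-up m [] [] _ _ _ _ _ _ = unblocked done [] [] λ _ → refl
block-up zero [] (M ∷ Ms) le _ _ _ _ _ = ⊥-elim (<⇒≱ (≤-trans (size≥1 M) (m≤m+n _ _)) le)
block-up {k} (suc m) [] Ms@(_ ∷ _) le _ oM mM u len
  with z , As , Ms′ , l , oA , oM′ , mM′ ← loop-open oM mM u len (λ ())
  with unblocked b gs os we ← block-up {k} m As Ms′
    (s≤s⁻¹ (≤-trans (≤-reflexive (sym (Loop-wts l (λ _ → 1)))) le)) oA oM′ mM′
    (Simples-tail {node z []} (Simples-resp (Loop-wts l) u))
    (suc-injective (trans (sym (Cyc-length (Loop.cyc l))) (trans len (trans (Loop-wts l (χ k))
      (cong (λ x → x + 0 + wts (χ k) (As ++ Ms′)) (χ-< (Loop.z<k l)))))))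
  = unblocked (one l b) (single (Loop.z<k l) ∷ gs) ((node [] [] ∷ []) ∷ os)
    (λ w → trans (Loop-wts l w) (cong (w z + 0 +_) (we w)))
block-up zero (A ∷ As) Ms le _ _ _ _ _ = ⊥-elim (<⇒≱ (≤-trans (size≥1 A) (m≤m+n _ _)) le)
block-up {k} (suc m) (A ∷ As) Ms le (oA ∷ oAs) oM mM u len
  with Q , Ms′ , refl , l , len′ ← luk-split {k} (wt (χ k) A) (wts (χ k) As) Ms
    (trans len (trans (cong (wt (χ k) A +_) (wts-++ (χ k) As)) (sym (+-assoc (wt (χ k) A) _ _))))
  with unblocked b gs os we ← block-up {k} m As Ms′
    (s≤s⁻¹ (≤-trans (+-mono-≤ (size≥1 A) (wts-omit (λ _ → 1) As Q)) le)) oAs (All.++⁻ʳ Q oM) (All.++⁻ʳ Q mM)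
    (Simples-⊆ (λ w → wts-omit w As Q) (Simples-tail u)) (trans len′ (sym (wts-++ (χ k) As)))
  = unblocked (tree l b) (proper (All.++⁻ˡ Q mM) l ∷ gs) ((oA ∷ All.++⁻ˡ Q oM) ∷ os)
    λ w → cong (wt w A +_) (trans (wts-shift w As Q) (trans (cong (wts w Q +_) (we w)) (sym (wts-++ w Q))))

-- Rose trees representing rooted trees

Subset-ext : ∀ {n} {p q : Subset n} → (∀ {i} → i Subset.∈ p → i Subset.∈ q) → (∀ {i} → i Subset.∈ q → i Subset.∈ p) → p ≡ q
Subset-ext f g = Subset.⊆-antisym f g

T-ext : ∀ {a b} → (T a → T b) → (T b → T a) → a ≡ b
T-ext {true}  {true}  _ _ = refl
T-ext {true}  {false} f _ = ⊥-elim (f _)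
T-ext {false} {true}  _ g = ⊥-elim (g _)
T-ext {false} {false} _ _ = refl

Rep-Good : ∀ {n G t} → Rep {n} G t → Good n t
Rep-Good R = good ord simple bound
  where open Rep R

Rep-edge : ∀ {n G G′ t t′} → Rep {n} G t → Rep G′ t′ → G ≈ G′ → ∀ {p c} → Edge p c t → Edge p c t′
Rep-edge {G = G} {G′} R R′ (eqV , eqA , eqR) e
  with p , refl ← vertex (Rep.grep R) (Edge-parent e) | c , refl ← vertex (Rep.grep R) (Edge-child e)
  with ws , w , uq ← Edge⇒IsChild R e = IsChild⇒Edge R′ (ws , subst (λ r → RootedTree.Walk G′ r c _) eqR (walk w) , uq)
  where
  walk : ∀ {u v ws} → RootedTree.Walk G u v ws → RootedTree.Walk G′ u v ws
  walk (Graph.here u∈)  = Graph.here (subst (_ Subset.∈_) eqV u∈)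
  walk (Graph.step a w) = Graph.step (subst T (eqA _ _) a) (walk w)

≈-sym : ∀ {n} {G G′ : RootedTree n} → G ≈ G′ → G′ ≈ G
≈-sym {n} {G} {G′} = Setoid.sym (treeSetoid n) {G} {G′}

Rep-fun : ∀ {n G G′ t t′} → Rep {n} G t → Rep G′ t′ → G ≈ G′ → t ≡ t′
Rep-fun {G = G} {G′} R R′ eq@(_ , _ , eqR) = tree-ext (Rep.ord R) (Rep.ord R′) (Rep.simple R) (Rep.simple R′)
  (trans (sym (Rep.root≡ R)) (trans (cong toℕ eqR) (Rep.root≡ R′)))
  (Rep-edge R R′ eq) (Rep-edge R′ R (≈-sym {G = G} {G′} eq))

Rep-inj : ∀ {n G G′ t} → Rep {n} G t → Rep G′ t → G ≈ G′
Rep-inj R R′ =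
  Subset-ext (vert← R′ ∘ vert→ R) (vert← R ∘ vert→ R′) ,
  (λ u v → T-ext (adj R R′) (adj R′ R)) ,
  toℕ-injective (trans (root≡ R) (sym (root≡ R′)))
  where
  open Rep
  adj : ∀ {n G G′ t u v} → Rep {n} G t → Rep G′ t → RootedTree._~_ G u v → RootedTree._~_ G′ u v
  adj {G′ = G′} R R′ a = [ adj← R′ , RootedTree.~-sym G′ ∘ adj← R′ ]′ (adj→ R a)

Reps : ∀ {n} → List (RootedTree n) → List Tree → Set
Reps = Pointwise Rep

_≈ₗ_ : ∀ {n} → List (RootedTree n) → List (RootedTree n) → Set
_≈ₗ_ = Pointwise _≈_

Reps-fun : ∀ {n Gs Gs′ ts ts′} → Reps {n} Gs ts → Reps Gs′ ts′ → Gs ≈ₗ Gs′ → ts ≡ ts′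
Reps-fun []       []         []       = refl
Reps-fun (R ∷ Rs) (R′ ∷ Rs′) (e ∷ es) = cong₂ _∷_ (Rep-fun R R′ e) (Reps-fun Rs Rs′ es)

Reps-inj : ∀ {n Gs Gs′ ts} → Reps {n} Gs ts → Reps Gs′ ts → Gs ≈ₗ Gs′
Reps-inj []       []         = []
Reps-inj (R ∷ Rs) (R′ ∷ Rs′) = Rep-inj R R′ ∷ Reps-inj Rs Rs′

toTrees : ∀ {n} (Gs : List (RootedTree n)) → ∃ (Reps Gs)
toTrees []       = [] , []
toTrees (G ∷ Gs) = _ , toTree-Rep G ∷ proj₂ (toTrees Gs)

toRootedTrees : ∀ {n ts} → All (Good n) ts → ∃ λ Gs → Reps {n} Gs ts
toRootedTrees []       = [] , []
toRootedTrees (g ∷ gs) = _ , toRootedTree-Rep g ∷ proj₂ (toRootedTrees gs)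

Reps-++⁻ˡ : ∀ {n} Gs {Hs ts} → Reps {n} (Gs ++ Hs) ts → ∃₂ λ us vs → ts ≡ us ++ vs × Reps Gs us × Reps Hs vs
Reps-++⁻ˡ [] Rs = [] , _ , refl , [] , Rs
Reps-++⁻ˡ (G ∷ Gs) (R ∷ Rs) with us , vs , refl , Rs₁ , Rs₂ ← Reps-++⁻ˡ Gs Rs = _ ∷ us , vs , refl , R ∷ Rs₁ , Rs₂

Reps-++⁻ʳ : ∀ {n Gs} us {vs} → Reps {n} Gs (us ++ vs) → ∃₂ λ As Bs → Gs ≡ As ++ Bs × Reps As us × Reps Bs vs
Reps-++⁻ʳ [] Rs = [] , _ , refl , [] , Rs
Reps-++⁻ʳ (u ∷ us) (R ∷ Rs) with As , Bs , refl , Rs₁ , Rs₂ ← Reps-++⁻ʳ us Rs = _ ∷ As , Bs , refl , R ∷ Rs₁ , Rs₂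

Reps-All⁺ : ∀ {n} {P : RootedTree n → Set} {Q : Tree → Set} → (∀ {G t} → Rep G t → P G → Q t) →
  ∀ {Gs ts} → Reps Gs ts → All P Gs → All Q ts
Reps-All⁺ f []       []       = []
Reps-All⁺ f (R ∷ Rs) (p ∷ ps) = f R p ∷ Reps-All⁺ f Rs ps

Reps-All⁻ : ∀ {n} {P : RootedTree n → Set} {Q : Tree → Set} → (∀ {G t} → Rep G t → Q t → P G) →
  ∀ {Gs ts} → Reps Gs ts → All Q ts → All P Gs
Reps-All⁻ f []       []       = []
Reps-All⁻ f (R ∷ Rs) (q ∷ qs) = f R q ∷ Reps-All⁻ f Rs qs

Reps-Good : ∀ {n Gs ts} → Reps {n} Gs ts → All (Good n) ts
Reps-Good []       = []
Reps-Good (R ∷ Rs) = Rep-Good R ∷ Reps-Good Rs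

Min⁺ : ∀ {n G t} → Rep {n} G t → RootedTree.MinimallyRooted G → Min t
Min⁺ {G = G} {node r ts} R m = All.tabulate above-root
  where
  open Rep R
  above-root : ∀ {s} → s ∈ ts → r < top s
  above-root {s} s∈ with <-cmp r (top s)
  ... | tri< lt _ _ = lt
  ... | tri≈ _ refl _ = ⊥-elim (Simple-top simple (top∈ s∈))
  ... | tri> _ _ gt with c , eq ← vertex grep (In-kid (top∈ s∈)) = ⊥-elim (m (c ,
    Edge⇒IsChild R (subst (λ x → Edge x (toℕ c) (node r ts)) (sym root≡) (here s∈ (sym eq))) ,
    subst₂ _<_ (sym eq) (sym root≡) gt))

Min⁻ : ∀ {n G t} → Rep {n} G t → Min t → RootedTree.MinimallyRooted G
Min⁻ {t = node r ts} R m (c , ch , lt)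
  with s , s∈ , eq ← Sub-child (Rep.simple R) self (subst (λ x → Edge x (toℕ c) (node r ts)) (Rep.root≡ R) (IsChild⇒Edge R ch))
  = <-asym (All.lookup m s∈) (subst₂ _<_ (sym eq) (Rep.root≡ R) lt)

-- Multiplicity functions of vertex sets

-- `p` is the support of `f`, whose values are otherwise free. Unions thus become sums, and
-- disjointness becomes the bound 1 on a sum.
record Mult {n} (p : Subset n) (f : ℕ → ℕ) : Set where
  field
    ∈⇒    : ∀ {i} → i Subset.∈ p → 1 ≤ f (toℕ i)
    ⇒∈    : ∀ {i} → 1 ≤ f (toℕ i) → i Subset.∈ p
    bound : ∀ {x} → 1 ≤ f x → x < n

sums : List (ℕ → ℕ) → ℕ → ℕ
sums []       x = 0
sums (f ∷ fs) x = f x + sums fs x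

1≤-⊎ : ∀ a {b} → 1 ≤ a + b → 1 ≤ a ⊎ 1 ≤ b
1≤-⊎ zero    p = inj₂ p
1≤-⊎ (suc a) _ = inj₁ (s≤s z≤n)

Mult-⋃ : ∀ {n ps fs} → Pointwise Mult ps fs → Mult {n} (⋃ ps) (sums fs)
Mult-⋃ [] = record { ∈⇒ = λ i∈ → ⊥-elim (Subset.∉⊥ i∈) ; ⇒∈ = λ () ; bound = λ () }
Mult-⋃ {ps = p ∷ ps} {f ∷ fs} (m ∷ ms) = record
  { ∈⇒ = λ {i} i∈ → [ (λ j → ≤-trans (∈⇒ m j) (m≤m+n _ _)) , (λ j → ≤-trans (∈⇒ M j) (m≤n+m _ (f (toℕ i)))) ]′
      (Subset.x∈p∪q⁻ p (⋃ ps) i∈)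
  ; ⇒∈ = λ {i} le → Subset.x∈p∪q⁺ ([ inj₁ ∘ ⇒∈ m , inj₂ ∘ ⇒∈ M ]′ (1≤-⊎ (f (toℕ i)) le))
  ; bound = λ {x} le → [ bound m , bound M ]′ (1≤-⊎ (f x) le)
  }
  where
  open Mult
  M = Mult-⋃ ms

Disjoint : ∀ {n} → Subset n → Subset n → Set
Disjoint p q = Empty (p ∩ q)

Mult-simple : ∀ {n ps fs} → Pointwise (Mult {n}) ps fs → All (λ f → ∀ x → f x ≤ 1) fs → AllPairs Disjoint ps →
  ∀ x → sums fs x ≤ 1
Mult-simple [] _ _ x = z≤n
Mult-simple {n} {p ∷ ps} {f ∷ fs} (m ∷ ms) (u ∷ us) (d ∷ ds) x with f x in eq
... | zero = Mult-simple ms us ds x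
... | suc a = s≤s (subst (λ b → a + b ≤ 0) (sym rest) (≤-trans (≤-reflexive (+-identityʳ a)) (s≤s⁻¹ (subst (_≤ 1) eq (u x)))))
  where
  x<n : x < n
  x<n = Mult.bound m (subst (1 ≤_) (sym eq) (s≤s z≤n))
  pick : ∀ {ps fs i} → Pointwise (Mult {n}) ps fs → All (Disjoint p) ps → i Subset.∈ p → 1 ≤ sums fs (toℕ i) → ⊥
  pick {fs = g ∷ gs} (m′ ∷ ms′) (d ∷ ds) i∈ le with 1≤-⊎ (g _) le
  ... | inj₁ le′ = d (_ , Subset.x∈p∩q⁺ (i∈ , Mult.⇒∈ m′ le′))
  ... | inj₂ le′ = pick ms′ ds i∈ le′
  rest : sums fs x ≡ 0
  rest = n<1⇒n≡0 (≰⇒> λ le → pick ms d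
    (Mult.⇒∈ m {fromℕ< x<n} (subst (λ y → 1 ≤ f y) (sym (toℕ-fromℕ< x<n)) (subst (1 ≤_) (sym eq) (s≤s z≤n))))
    (subst (λ y → 1 ≤ sums fs y) (sym (toℕ-fromℕ< x<n)) le))

Mult-disjoint : ∀ {n ps fs} → Pointwise (Mult {n}) ps fs → (∀ x → sums fs x ≤ 1) → AllPairs Disjoint ps
Mult-disjoint [] _ = []
Mult-disjoint {n} {p ∷ ps} {f ∷ fs} (m ∷ ms) u = go ms (λ i∈ → λ le → 1≤-+ (Mult.∈⇒ m i∈) le (u _)) ∷
  Mult-disjoint ms (λ x → m+n≤o⇒n≤o (f x) (u x))
  where
  go : ∀ {qs gs} → Pointwise (Mult {n}) qs gs → (∀ {i} → i Subset.∈ p → ¬ 1 ≤ sums gs (toℕ i)) → All (Disjoint p) qs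
  go [] _ = []
  go {q ∷ qs} {g ∷ gs} (m′ ∷ ms′) h =
    (λ { (i , i∈) → let i∈p , i∈q = Subset.x∈p∩q⁻ p q i∈ in h i∈p (≤-trans (Mult.∈⇒ m′ i∈q) (m≤m+n _ _)) }) ∷
    go ms′ (λ {i} i∈ le → h i∈ (≤-trans le (m≤n+m _ (g (toℕ i)))))

Mult-cover⁺ : ∀ {n p f} → Mult {n} p f → (∀ x → f x ≤ 1) → p ≡ ⊤ → ∀ x → f x ≡ χ n x
Mult-cover⁺ {n} {f = f} m u refl x with x <? n
... | yes lt = trans (≤-antisym (u x) (subst (λ y → 1 ≤ f y) (toℕ-fromℕ< lt) (Mult.∈⇒ m Subset.∈⊤))) (sym (χ-< lt))
... | no ¬lt = trans (n<1⇒n≡0 (≰⇒> (¬lt ∘ Mult.bound m))) (sym (χ-≥ {n} (≮⇒≥ ¬lt)))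

Mult-cover⁻ : ∀ {n p f} → Mult {n} p f → (∀ x → f x ≡ χ n x) → p ≡ ⊤
Mult-cover⁻ m c = Subset-ext (λ _ → Subset.∈⊤)
  (λ {i} _ → Mult.⇒∈ m (≤-reflexive (sym (trans (c (toℕ i)) (χ-< (toℕ<n i))))))

Rep-Mult : ∀ {n G t} → Rep {n} G t → Mult (RootedTree.vertices G) (λ x → occ x t)
Rep-Mult R = record { ∈⇒ = pos ∘ vert→ ; ⇒∈ = vert← ∘ mk ; bound = bound ∘ mk }
  where open Rep R

occFun : Tree → ℕ → ℕ
occFun t x = occ x t

sums-occ : ∀ ts x → sums (map occFun ts) x ≡ occs x ts
sums-occ []       x = refl
sums-occ (t ∷ ts) x = cong (occ x t +_) (sums-occ ts x)

Reps-Mults : ∀ {n Gs ts} → Reps {n} Gs ts → Pointwise Mult (map RootedTree.vertices Gs) (map occFun ts)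
Reps-Mults []       = []
Reps-Mults (R ∷ Rs) = Rep-Mult R ∷ Reps-Mults Rs

Mult-resp : ∀ {n p f g} → (∀ x → f x ≡ g x) → Mult {n} p f → Mult p g
Mult-resp eq m = record
  { ∈⇒ = λ i∈ → subst (1 ≤_) (eq _) (∈⇒ i∈) ; ⇒∈ = λ le → ⇒∈ (subst (1 ≤_) (sym (eq _)) le)
  ; bound = λ le → bound (subst (1 ≤_) (sym (eq _)) le) }
  where open Mult m

vertexSet-Mult : ∀ {n Gs ts} → Reps {n} Gs ts → Mult (vertexSet Gs) (λ x → occs x ts)
vertexSet-Mult {ts = ts} Rs = Mult-resp (sums-occ ts) (Mult-⋃ (Reps-Mults Rs))

Reps-simple : ∀ {n Gs ts} → Reps {n} Gs ts → All (λ f → ∀ x → f x ≤ 1) (map occFun ts)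
Reps-simple []       = []
Reps-simple (R ∷ Rs) = once (Rep.simple R) ∷ Reps-simple Rs

disjoint⇒Simples : ∀ {n Gs ts} → Reps {n} Gs ts → AllPairs Disjoint (map RootedTree.vertices Gs) → Simples ts
disjoint⇒Simples {ts = ts} Rs d = mk λ x → subst (_≤ 1) (sums-occ ts x) (Mult-simple (Reps-Mults Rs) (Reps-simple Rs) d x)

Simples⇒disjoint : ∀ {n Gs ts} → Reps {n} Gs ts → Simples ts → AllPairs Disjoint (map RootedTree.vertices Gs)
Simples⇒disjoint {ts = ts} Rs u = Mult-disjoint (Reps-Mults Rs) λ x → subst (_≤ 1) (sym (sums-occ ts x)) (once u x)

Reps-nonempty : ∀ {n Gs ts} → Reps {n} Gs ts → All Nonempty (map RootedTree.vertices Gs)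
Reps-nonempty [] = []
Reps-nonempty {Gs = G ∷ _} (R ∷ Rs) = (RootedTree.root G , RootedTree.root∈ G) ∷ Reps-nonempty Rs

partition⇒Cover : ∀ {n Gs ts} → Reps {n} Gs ts → IsPartition (map RootedTree.vertices Gs) ⊤ → Cover n ts
partition⇒Cover Rs (_ , d , eq) = mk (Mult-cover⁺ (vertexSet-Mult Rs) (once (disjoint⇒Simples Rs d)) eq)

Cover⇒partition : ∀ {n Gs ts} → Reps {n} Gs ts → Cover n ts → IsPartition (map RootedTree.vertices Gs) ⊤
Cover⇒partition Rs c = Reps-nonempty Rs , Simples⇒disjoint Rs (Cover-Simples c) ,
  Mult-cover⁻ (vertexSet-Mult Rs) (covers c)

Cover-Good : ∀ {n ts} → Cover n ts → All Ord ts → All (Good n) ts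
Cover-Good c os = All.tabulate λ t∈ →
  good (All.lookup os t∈) (Simple-∈ (Cover-Simples c) t∈) (λ i → Cover-bound c (In-∈ t∈ i))

-- Cardinalities

sumTo : ℕ → (ℕ → ℕ) → ℕ
sumTo zero    f = 0
sumTo (suc n) f = f 0 + sumTo n (f ∘ suc)

sumTo-+ : ∀ n f g → sumTo n (λ x → f x + g x) ≡ sumTo n f + sumTo n g
sumTo-+ zero    f g = refl
sumTo-+ (suc n) f g = trans (cong (f 0 + g 0 +_) (sumTo-+ n (f ∘ suc) (g ∘ suc))) (+-swap (f 0) (g 0) _ _)

sumTo-cong : ∀ n {f g} → (∀ x → f x ≡ g x) → sumTo n f ≡ sumTo n g
sumTo-cong zero    eq = refl
sumTo-cong (suc n) eq = cong₂ _+_ (eq 0) (sumTo-cong n (eq ∘ suc))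

sumTo-0 : ∀ n {f} → (∀ x → f x ≡ 0) → sumTo n f ≡ 0
sumTo-0 zero    eq = refl
sumTo-0 (suc n) eq = cong₂ _+_ (eq 0) (sumTo-0 n (eq ∘ suc))

sumTo-δ : ∀ {n v} (w : ℕ → ℕ) → v < n → sumTo n (λ x → w x * δ x v) ≡ w v
sumTo-δ {suc n} {zero} w _ = trans (cong₂ _+_ (*-identityʳ (w 0)) (sumTo-0 n (λ x → *-zeroʳ (w (suc x))))) (+-identityʳ _)
sumTo-δ {suc n} {suc v} w (s≤s lt) = cong₂ _+_ (*-zeroʳ (w 0)) (sumTo-δ (w ∘ suc) lt)

-- Exchanges summation over nodes for summation over labels, the order in which `∣_∣` counts a
-- subset.
wt-sum  : ∀ {n} w t → (∀ {x} → In x t → x < n) → wt w t ≡ sumTo n (λ x → w x * occ x t)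
wts-sum : ∀ {n} w ts → (∀ {x} → Ins x ts → x < n) → wts w ts ≡ sumTo n (λ x → w x * occs x ts)
wt-sum {n} w (node v ts) b = trans (cong₂ _+_ (sym (sumTo-δ w (b (In-top (node v ts))))) (wts-sum w ts (b ∘ In-kid)))
  (trans (sym (sumTo-+ n _ _)) (sumTo-cong n λ x → sym (*-distribˡ-+ (w x) (δ x v) (occs x ts))))
wts-sum {n} w [] b = sym (sumTo-0 n λ x → *-zeroʳ (w x))
wts-sum {n} w (t ∷ ts) b = trans (cong₂ _+_ (wt-sum w t (b ∘ Ins-here)) (wts-sum w ts (b ∘ Ins-there)))
  (trans (sym (sumTo-+ n _ _)) (sumTo-cong n λ x → sym (*-distribˡ-+ (w x) (occ x t) (occs x ts))))

card-sum : ∀ {n} (p : Subset n) f → (∀ {i} → i Subset.∈ p → f (toℕ i) ≡ 1) → (∀ {i} → i Subset.∉ p → f (toℕ i) ≡ 0) →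
  ∣ p ∣ ≡ sumTo n f
card-sum Vec.[] f _ _ = refl
card-sum (inside Vec.∷ p) f f₁ f₀ =
  cong₂ _+_ (sym (f₁ Vec.here)) (card-sum p (f ∘ suc) (f₁ ∘ Vec.there) (λ i∉ → f₀ (i∉ ∘ Subset.drop-there)))
card-sum (outside Vec.∷ p) f f₁ f₀ =
  cong₂ _+_ (sym (f₀ λ ())) (card-sum p (f ∘ suc) (f₁ ∘ Vec.there) (λ i∉ → f₀ (i∉ ∘ Subset.drop-there)))

card-vertices : ∀ {n G t} → Rep {n} G t → ∣ RootedTree.vertices G ∣ ≡ size t
card-vertices {n} {G} {t} R = trans (card-sum _ (λ x → 1 * occ x t)
  (λ {i} i∈ → trans (*-identityˡ _) (≤-antisym (once simple (toℕ i)) (pos (vert→ i∈))))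
  (λ {i} i∉ → trans (*-identityˡ _) (¬In⇒0 {toℕ i} {t} (i∉ ∘ vert←))))
  (sym (wt-sum (λ _ → 1) t bound))
  where open Rep R

∈-specials⁺ : ∀ {n k} {i : Fin n} → toℕ i < k → i Subset.∈ specials k
∈-specials⁺ {k = k} {i} lt = ∈-tabulate⁺ (does-true (label i ≤? k) lt)

∈-specials⁻ : ∀ {n k} {i : Fin n} → i Subset.∈ specials k → toℕ i < k
∈-specials⁻ {k = k} {i} i∈ = does-true⁻ (label i ≤? k) (∈-tabulate⁻ i∈)

specialCount≡ : ∀ {n Gs ts} k → Reps {n} Gs ts → Simples ts → specialCount k Gs ≡ wts (χ k) ts
specialCount≡ {n} {Gs} {ts} k Rs u = trans (card-sum _ (λ x → χ k x * occs x ts)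
  (λ {i} i∈ → let i∈p , i∈s = Subset.x∈p∩q⁻ (vertexSet Gs) (specials k) i∈ in
    cong₂ _*_ (χ-< (∈-specials⁻ {i = i} i∈s)) (≤-antisym (once u (toℕ i)) (∈⇒ i∈p)))
  (λ {i} i∉ → off i i∉))
  (sym (wts-sum (χ k) ts (bound ∘ pos)))
  where
  open Mult (vertexSet-Mult Rs)
  off : ∀ i → i Subset.∉ vertexSet Gs ∩ specials k → χ k (toℕ i) * occs (toℕ i) ts ≡ 0
  off i i∉ with toℕ i <? k
  ... | no ¬lt = cong (_* occs (toℕ i) ts) (χ-≥ {k} (≮⇒≥ ¬lt))
  ... | yes lt = trans (cong (χ k (toℕ i) *_) (¬Ins⇒0 {toℕ i} {ts} λ j → i∉ (Subset.x∈p∩q⁺ (⇒∈ (pos j) , ∈-specials⁺ lt))))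
                       (*-zeroʳ (χ k (toℕ i)))

-- Maximal decreasing subtrees

md  : Tree → Tree
mdB : ℕ → List Tree → List Tree
md (node r cs) = node r (mdB r cs)
mdB r []       = []
mdB r (c ∷ cs) = if top c <ᵇ r then md c ∷ mdB r cs else mdB r cs

md-top : ∀ t → top (md t) ≡ top t
md-top (node r cs) = refl

-- `enc` and `md` descend into the same children, and each visited vertex contributes one piece and
-- one vertex.
length-enc  : ∀ t → length (enc t) ≡ size (md t)
length-encB : ∀ r cs → length (encB r cs) ≡ wts (λ _ → 1) (mdB r cs)
length-enc (node r cs) = cong suc (length-encB r cs)
length-encB r [] = refl
length-encB r (c ∷ cs) with top c <ᵇ r
... | true  = trans (length-++ (enc c)) (cong₂ _+_ (length-enc c) (length-encB r cs))
... | false = length-encB r cs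

wt-md  : ∀ w t → wt w (md t) ≤ wt w t
wts-md : ∀ w r cs → wts w (mdB r cs) ≤ wts w cs
wt-md w (node r cs) = +-monoʳ-≤ (w r) (wts-md w r cs)
wts-md w r [] = z≤n
wts-md w r (c ∷ cs) with top c <ᵇ r
... | true  = +-mono-≤ (wt-md w c) (wts-md w r cs)
... | false = ≤-trans (wts-md w r cs) (m≤n+m _ (wt w c))

∈-mdB⁻ : ∀ {s} r cs → s ∈ mdB r cs → ∃ λ c → c ∈ cs × top c < r × s ≡ md c
∈-mdB⁻ r (c ∷ cs) s∈ with top c <ᵇ r in eq | s∈
... | true  | here refl = c , here refl , <ᵇ-true {top c} eq , refl
... | true  | there s∈′ with c′ , c∈ , lt , e ← ∈-mdB⁻ r cs s∈′ = c′ , there c∈ , lt , e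
... | false | s∈′       with c′ , c∈ , lt , e ← ∈-mdB⁻ r cs s∈′ = c′ , there c∈ , lt , e

∈-mdB⁺ : ∀ {c r cs} → c ∈ cs → top c < r → md c ∈ mdB r cs
∈-mdB⁺ (here refl) lt rewrite <⇒<ᵇ-true lt = here refl
∈-mdB⁺ {r = r} {c′ ∷ cs} (there c∈) lt with top c′ <ᵇ r
... | true  = there (∈-mdB⁺ c∈ lt)
... | false = ∈-mdB⁺ c∈ lt

md-Ord  : ∀ {t} → Ord t → Ord (md t)
mdB-Ord : ∀ {r cs} → All Ord cs → All Ord (mdB r cs)
mdB-Asc : ∀ {r cs} → Asc cs → Asc (mdB r cs)
md-Ord (node a o) = node (mdB-Asc a) (mdB-Ord o)
mdB-Ord [] = []
mdB-Ord {r} {c ∷ cs} (o ∷ os) with top c <ᵇ r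
... | true  = md-Ord o ∷ mdB-Ord os
... | false = mdB-Ord os
mdB-Asc [] = []
mdB-Asc {r} {c ∷ cs} (a ∷ as) with top c <ᵇ r
... | false = mdB-Asc as
... | true  = All.tabulate (λ s∈ → let c′ , c∈ , _ , eq = ∈-mdB⁻ r cs s∈ in
    subst₂ _<_ (sym (md-top c)) (trans (sym (md-top c′)) (cong top (sym eq))) (All.lookup a c∈)) ∷ mdB-Asc as

md-Simple : ∀ {t} → Simple t → Simple (md t)
md-Simple {t} u = mk λ x → ≤-trans (wt-md (δ x) t) (once u x)

md-In : ∀ {x t} → In x (md t) → In x t
md-In {x} {t} (mk p) = mk (≤-trans p (wt-md (δ x) t))

md-Good : ∀ {n t} → Good n t → Good n (md t)
md-Good (good o u b) = good (md-Ord o) (md-Simple u) (b ∘ md-In)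

md-Edge⁻ : ∀ {p c} t → Edge p c (md t) → Edge p c t × c < p
md-Edge⁻ (node r cs) (here s∈ eq) with c′ , c∈ , lt , refl ← ∈-mdB⁻ r cs s∈
  with refl ← trans (sym (md-top c′)) eq = here c∈ refl , lt
md-Edge⁻ (node r cs) (there s∈ e) with c′ , c∈ , _ , refl ← ∈-mdB⁻ r cs s∈
  with e′ , lt ← md-Edge⁻ c′ e = there c∈ e′ , lt

md-Edge⁺ : ∀ {p c t} → Simple t → Edge p c t → c < p → In p (md t) → Edge p c (md t)
md-Edge⁺ u (here {s} s∈ refl) lt i = here (∈-mdB⁺ s∈ lt) (md-top s)
md-Edge⁺ {p} u (there {v} {s} {ts} s∈ e) lt i with In-node i
... | inj₁ refl = ⊥-elim (Simple-top u (In-∈ s∈ (Edge-parent e)))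
... | inj₂ j with _ , s′∈ , k ← Ins-∈ j with c′ , c′∈ , lt′ , refl ← ∈-mdB⁻ v ts s′∈
  with refl ← In-unique (Simple-kids u) s∈ c′∈ (Edge-parent e) (md-In {t = c′} k)
  = there (∈-mdB⁺ c′∈ lt′) (md-Edge⁺ (Simple-∈ (Simple-kids u) s∈) e lt k)

module _ {n} {G M : RootedTree n} {t} (R : Rep G t) (R′ : Rep M (md t)) where
  private
    module R = Rep R
    module R′ = Rep R′

  md-subtree : IsDecreasingSubtree M G
  md-subtree =
    ((λ v∈ → R.vert← (md-In {t = t} (R′.vert→ v∈))) ,
     (λ a → [ (λ e → R.adj← (proj₁ (md-Edge⁻ t e)))
            , (λ e → RootedTree.~-sym G (R.adj← (proj₁ (md-Edge⁻ t e)))) ]′ (R′.adj→ a))) ,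
    toℕ-injective (trans R′.root≡ (trans (md-top t) (sym R.root≡))) ,
    λ _ ch → proj₂ (md-Edge⁻ t (IsChild⇒Edge R′ ch))

  -- Gives a greatest decreasing subtree, not only a maximal one. Paths of `S` from the root are
  -- paths of `G`, so the edges of `S` are edges of `t` with smaller child; `md` keeps such an edge
  -- as soon as it keeps the parent.
  md-maximum : ∀ S → IsDecreasingSubtree S G → S ⊑ M
  md-maximum S ((V , A) , root≡ , dec↓) = (λ v∈ → R′.vert← (In-md (RS.vert→ v∈))) ,
    λ a → [ R′.adj← ∘ edge-md self root-md , RootedTree.~-sym M ∘ R′.adj← ∘ edge-md self root-md ]′ (RS.adj→ a)
    where
    s : Tree
    s = toTree S
    RS : Rep S s
    RS = toTree-Rep S
    module RS = Rep RS
    walk : ∀ {u v ws} → RootedTree.Walk S u v ws → RootedTree.Walk G u v ws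
    walk (Graph.here u∈)  = Graph.here (V u∈)
    walk (Graph.step a w) = Graph.step (A a) (walk w)
    S-edge : ∀ {p c} → Edge p c s → Edge p c t × c < p
    S-edge e with p , refl ← vertex RS.grep (Edge-parent e) | c , refl ← vertex RS.grep (Edge-child e)
      with ws , w , uq ← Edge⇒IsChild RS e =
      IsChild⇒Edge R (ws , subst (λ r → RootedTree.Walk G r c _) root≡ (walk w) , uq) ,
      dec↓ (RS.vert← (Edge-parent e) , c , ws , w , uq) (ws , w , uq)
    root-md : In (top s) (md t)
    root-md = subst (λ x → In x (md t)) (trans (md-top t) (trans (sym R.root≡) (trans (cong toℕ (sym root≡)) RS.root≡)))
      (In-top (md t))
    edge-md : ∀ {s′ p c} → Sub s′ s → In (top s′) (md t) → Edge p c s′ → Edge p c (md t)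
    edge-md q i e@(here s∈ eq) with e′ , lt ← S-edge (Sub-Edge q e) = md-Edge⁺ R.simple e′ lt i
    edge-md q i (there s∈ e) = edge-md (Sub-kid q s∈) (Edge-child (edge-md q i (here s∈ refl))) e
    In-md : ∀ {x} → In x s → In x (md t)
    In-md i with In-edge s i
    ... | inj₁ refl    = root-md
    ... | inj₂ (p , e) = Edge-child (edge-md self root-md e)

  md-IsMD : IsMD M G
  md-IsMD = md-subtree , λ S sub _ → md-maximum S sub

-- `M` lies in the tree of `md t` by `md-maximum`; since the latter is a decreasing subtree,
-- maximality of `M` gives the reverse inclusion.
MD-size : ∀ {n} {G M : RootedTree n} {t} → Rep G t → IsMD M G → ∣ RootedTree.vertices M ∣ ≡ length (enc t)
MD-size {M = M} {t} R (sub , max) = trans (cong ∣_∣ (Subset-ext (proj₁ below-M) (proj₁ above-M)))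
  (trans (card-vertices R′) (sym (length-enc t)))
  where
  R′ : Rep (toRootedTree (md-Good (Rep-Good R))) (md t)
  R′ = toRootedTree-Rep (md-Good (Rep-Good R))
  below-M = md-maximum R R′ M sub
  above-M = max (toRootedTree (md-Good (Rep-Good R))) (md-subtree R R′) below-M

MD-exists : ∀ {n} {G : RootedTree n} {t} → Rep G t → ∃ λ M → IsMD M G × ∣ RootedTree.vertices M ∣ ≡ length (enc t)
MD-exists {n} {G} {t} R = M , md-IsMD R R′ , MD-size {M = M} R (md-IsMD R R′)
  where
  M : RootedTree n
  M = toRootedTree (md-Good (Rep-Good R))
  R′ : Rep M (md t)
  R′ = toRootedTree-Rep (md-Good (Rep-Good R))

-- Good forests

-- With `c` the number of special vertices of `T₀`, the first `i` trees of `Q` together with `T₀`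
-- are the first `suc i` trees in `KGood`.
Luk⁺ : ∀ {k c Q} → Luk k c Q →
  (∀ i → i < length Q → suc i ≤ c + wts (χ k) (take i Q)) × c + wts (χ k) Q ≡ length Q
Luk⁺ done = (λ _ ()) , refl
Luk⁺ {k} (next {c} {M} {Q} l) with f , eq ← Luk⁺ l = g , cong suc (trans (sym (+-assoc c _ _)) eq)
  where
  g : ∀ i → i < suc (length Q) → suc i ≤ suc c + wts (χ k) (take i (M ∷ Q))
  g zero    _        = s≤s z≤n
  g (suc i) (s≤s lt) = s≤s (≤-trans (f i lt) (≤-reflexive (+-assoc c _ _)))

Luk⁻ : ∀ {k c Q} → (∀ i → i < length Q → suc i ≤ c + wts (χ k) (take i Q)) → c + wts (χ k) Q ≡ length Q → Luk k c Q
Luk⁻ {c = zero}  {[]}    f eq = done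
Luk⁻ {c = suc c} {[]}    f ()
Luk⁻ {c = zero}  {M ∷ Q} f eq = case f 0 (s≤s z≤n) of λ ()
Luk⁻ {c = suc c} {M ∷ Q} f eq = next (Luk⁻
  (λ i lt → ≤-trans (s≤s⁻¹ (f (suc i) (s≤s lt))) (≤-reflexive (sym (+-assoc c _ _))))
  (trans (+-assoc c _ _) (suc-injective eq)))

Reps-take : ∀ {n Gs ts} i → Reps {n} Gs ts → Reps (take i Gs) (take i ts)
Reps-take zero    _        = []
Reps-take (suc i) []       = []
Reps-take (suc i) (R ∷ Rs) = R ∷ Reps-take i Rs

Simples-take : ∀ {ts} i → Simples ts → Simples (take i ts)
Simples-take {ts} i u = Simples-++ˡ (take i ts) (subst Simples (sym (take++drop≡id i ts)) u)

wt-top : ∀ w t → w (top t) ≤ wt w t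
wt-top w (node v ts) = m≤m+n _ _

KGood⁺ : ∀ {n k Gs ts} → Reps {n} Gs ts → Simples ts → KGood k Gs → KG k ts
KGood⁺ {k = k} {G ∷ []} {t@(node x ts) ∷ []} (R ∷ []) u (inj₁ (v , eq , sp)) = go ts refl
  where
  only : ∀ {y} → In y t → y ≡ toℕ v
  only i with j , refl ← vertex (Rep.grep R) i = cong toℕ (Subset.x∈⁅y⁆⇒x≡y v (subst (j Subset.∈_) eq (Rep.vert← R i)))
  go : ∀ us → ts ≡ us → KG k [ node x ts ]
  go [] refl = single (subst (_< k) (sym (only (In-top t))) sp)
  go (s ∷ us) refl = ⊥-elim (Simple-top (Rep.simple R)
    (subst (λ y → Ins y ts) (trans (only (In-kid (top∈ (here refl)))) (sym (only (In-top t)))) (top∈ (here refl))))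
KGood⁺ {k = k} {G ∷ []} {t ∷ []} (R ∷ []) u (inj₂ ¬sp) = proper [] (subst (λ c → Luk k c []) (sym none) done)
  where
  none : wt (χ k) t ≡ 0
  none = n<1⇒n≡0 (≰⇒> λ le →
    let z , z<k , _ , i = count-exists k [ t ] {0} u (≤-trans le (m≤m+n _ 0))
        j = In-single i
        v , eq = vertex (Rep.grep R) j
    in ¬sp {v} (Rep.vert← R (subst (λ y → In y t) (sym eq) j)) (subst (_< k) (sym eq) z<k))
    where
    In-single : ∀ {y} → Ins y [ t ] → In y t
    In-single i with Ins-∷ t i
    ... | inj₁ j = j
    ... | inj₂ (mk ())
KGood⁺ {k = k} {G ∷ G₁ ∷ Gs} {t ∷ t₁ ∷ ts} (R ∷ Rs@(R₁ ∷ Rs′)) u (mins , f , eq) = proper (Reps-All⁺ Min⁺ Rs mins)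
  (Luk⁻ (λ i lt → ≤-trans (f i (subst (i <_) (cong suc (sym (Pointwise.Pointwise-length Rs′))) lt))
      (≤-reflexive (specialCount≡ k (Reps-take (suc i) (R ∷ Rs)) (Simples-take (suc i) u))))
    (trans (sym (specialCount≡ k (R ∷ Rs) u)) (trans eq (cong suc (Pointwise.Pointwise-length Rs′)))))

KGood⁻ : ∀ {n k Gs ts} → Reps {n} Gs ts → Simples ts → KG k ts → KGood k Gs
KGood⁻ {Gs = G ∷ []} (R ∷ []) u (single {z} z<k) with v , eq ← vertex (Rep.grep R) (In-top (node z [])) =
  inj₁ (v , Subset-ext
    (λ {i} i∈ → subst (Subset._∈ ⁅ v ⁆) (toℕ-injective (trans eq (sym (In-leaf (Rep.vert→ R i∈))))) (Subset.x∈⁅x⁆ v))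
    (λ {i} i∈ → subst (Subset._∈ RootedTree.vertices G) (sym (Subset.x∈⁅y⁆⇒x≡y v i∈))
      (Rep.vert← R (subst (λ x → In x (node z [])) (sym eq) (In-top (node z []))))) ,
    subst (_< _) (sym eq) z<k)
  where
  In-leaf : ∀ {x} → In x (node z []) → x ≡ z
  In-leaf i with In-node i
  ... | inj₁ e = e
  ... | inj₂ (mk ())
KGood⁻ {k = k} {G ∷ []} {t ∷ []} (R ∷ []) u (proper _ l) = inj₂ λ {v} v∈ sp → <⇒≱
  (≤-trans (s≤s z≤n) (count-mono [ t ] sp (Ins-here (Rep.vert→ R v∈))))
  (≤-reflexive (trans (+-identityʳ (wt (χ k) t)) (Luk-[] l)))
  where
  Luk-[] : ∀ {c} → Luk k c [] → c ≡ 0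
  Luk-[] done = refl
KGood⁻ {k = k} {G ∷ G₁ ∷ Gs} {t ∷ t₁ ∷ ts} (R ∷ Rs@(R₁ ∷ Rs′)) u (proper mins l) with f , eq ← Luk⁺ l =
  Reps-All⁻ Min⁻ Rs mins ,
  (λ i lt → ≤-trans (f i (subst (i <_) (cong suc (Pointwise.Pointwise-length Rs′)) lt))
    (≤-reflexive (sym (specialCount≡ k (Reps-take (suc i) (R ∷ Rs)) (Simples-take (suc i) u))))) ,
  trans (specialCount≡ k (R ∷ Rs) u) (trans eq (cong suc (sym (Pointwise.Pointwise-length Rs′))))

-- Bijections given by relations

-- Both round trips follow from `fun` and `inj`, applied to the two related pairs that `f` and `g`
-- provide, so the chosen images never have to be computed with.
relInverse : ∀ {a r b s p q c} (S : Setoid a r) (S′ : Setoid b s) {P : Setoid.Carrier S → Set p} {Q : Setoid.Carrier S′ → Set q}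
  (R : Setoid.Carrier S → Setoid.Carrier S′ → Set c) →
  (∀ x → P x → ∃ λ y → Q y × R x y) → (∀ y → Q y → ∃ λ x → P x × R x y) →
  (∀ {x x′ y y′} → P x → P x′ → Q y → Q y′ → R x y → R x′ y′ → Setoid._≈_ S x x′ → Setoid._≈_ S′ y y′) →
  (∀ {x x′ y y′} → P x → P x′ → Q y → Q y′ → R x y → R x′ y′ → Setoid._≈_ S′ y y′ → Setoid._≈_ S x x′) →
  Inverse (subsetoid S P) (subsetoid S′ Q)
relInverse S S′ R f g fun inj = record
  { to        = λ (x , p) → let y , q , _ = f x p in y , q
  ; from      = λ (y , q) → let x , p , _ = g y q in x , p
  ; to-cong   = λ { {x , p} {x′ , p′} eq → let _ , q , r = f x p ; _ , q′ , r′ = f x′ p′ in fun p p′ q q′ r r′ eq }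
  ; from-cong = λ { {y , q} {y′ , q′} eq → let _ , p , r = g y q ; _ , p′ , r′ = g y′ q′ in inj p p′ q q′ r r′ eq }
  ; inverse   =
      (λ { {y , q} {x , p} eq → let _ , q′ , r′ = f x p ; _ , p″ , r″ = g y q in fun p p″ q′ q r′ r″ eq }) ,
      (λ { {x , p} {y , q} eq → let _ , p′ , r′ = g y q ; _ , q″ , r″ = f x p in inj p′ p q q″ r′ r″ eq })
  }

Cyc-refl : ∀ {A : Set} (xs : List A) → Cyc xs xs
Cyc-refl xs = xs , [] , sym (++-identityʳ xs) , refl

cycSetoid : Set → Setoid _ _
cycSetoid A = record
  { Carrier = List A ; _≈_ = Cyc
  ; isEquivalence = record { refl = Cyc-refl _ ; sym = Cyc-sym ; trans = Cyc-trans } }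

-- Sets of rose trees

record IsT (n k : ℕ) (t : Tree) : Set where
  field
    ord    : Ord t
    cover  : Cover (suc n) [ t ]
    md-len : length (enc t) ≡ suc k

record IsA (n k : ℕ) (Ms : List Tree) : Set where
  field
    len   : length Ms ≡ suc k
    min   : All Min Ms
    ord   : All Ord Ms
    cover : Cover (suc n) Ms

record IsB (n k : ℕ) (Ts : List Tree) : Set where
  field
    cover   : Cover n Ts
    ord     : All Ord Ts
    {Us Vs} : List Tree
    split≡  : Ts ≡ Us ++ Vs
    len     : length Vs ≡ k
    min     : All Min Vs

enc-head : ∀ {t} → Ord t → ∃₂ λ N Q → enc t ≡ N ∷ Q × Below (top N) Q
enc-head (node _ o) = _ , _ , refl , encB-max o

Simple-[] : ∀ {n t} → Cover n [ t ] → Simple t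
Simple-[] c = Simple-∈ (Cover-Simples c) (here refl)

T↔A : ∀ n k → Inverse (subsetoid (setoid Tree) (IsT n k)) (subsetoid (cycSetoid Tree) (IsA n k))
T↔A n k = relInverse (setoid Tree) (cycSetoid Tree) (λ t Ms → Cyc Ms (enc t)) f g
  (λ { _ _ _ _ r r′ refl → Cyc-trans r (Cyc-sym r′) })
  (λ p p′ _ _ r r′ c → inj p p′ (Cyc-trans (Cyc-sym r) (Cyc-trans c r′)))
  where
  f : ∀ t → IsT n k t → ∃ λ Ms → IsA n k Ms × Cyc Ms (enc t)
  f t p = enc t , record
    { len = md-len ; min = enc-Min t ; ord = enc-Ord ord
    ; cover = Cover-resp {xs = [ t ]} (λ w → trans (+-identityʳ _) (sym (wts-enc w ord (Simple-[] cover)))) cover }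
    , Cyc-refl _
    where open IsT p
  g : ∀ Ms → IsA n k Ms → ∃ λ t → IsT n k t × Cyc Ms (enc t)
  g (M ∷ Ms) p with P , N , Q , eq , b ← max-split M Ms (Cover-Simples (IsA.cover p)) = result
    where
    open IsA p
    c : Cyc (M ∷ Ms) (N ∷ Q ++ P)
    c = P , N ∷ Q , eq , refl
    result : ∃ λ t → IsT n k t × Cyc (M ∷ Ms) (enc t)
    result with t , o , we , e ← dec-single (Cyc-All c min) (Cyc-All c ord)
             (Simples-resp (Cyc-wts c) (Cover-Simples cover)) b
      = t , record { ord = o
                   ; cover = Cover-resp (λ w → trans (Cyc-wts c w) (trans (sym (we w)) (sym (+-identityʳ (wt w t))))) cover
                   ; md-len = trans (cong length e) (trans (sym (Cyc-length c)) len) }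
      , subst (Cyc (M ∷ Ms)) (sym e) c
  g [] p = case IsA.len p of λ ()
  inj : ∀ {t t′} → IsT n k t → IsT n k t′ → Cyc (enc t) (enc t′) → t ≡ t′
  inj p p′ c with N , Q , e , b ← enc-head (IsT.ord p) | N′ , Q′ , e′ , b′ ← enc-head (IsT.ord p′) =
    enc-injective (IsT.ord p) (IsT.ord p′) (Simple-[] (IsT.cover p)) (Simple-[] (IsT.cover p′))
      (trans e (trans (Cyc-heads (λ x y → top y < top x) <-asym b b′ (subst₂ Cyc e e′ c)) (sym e′)))

record AB (n k : ℕ) (Ms Ts : List Tree) : Set where
  constructor ab
  field
    {M}     : Tree
    {Us Vs} : List Tree
    cyc     : Cyc Ms (M ∷ Vs)
    marking : Marked n Us M
    split≡  : Ts ≡ Us ++ Vs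
    len     : length Vs ≡ k

A↔B : ∀ n k → Inverse (subsetoid (cycSetoid Tree) (IsA n k)) (subsetoid (setoid (List Tree)) (IsB n k))
A↔B n k = relInverse (cycSetoid Tree) (setoid (List Tree)) (AB n k) f g fun inj
  where
  f : ∀ Ms → IsA n k Ms → ∃ λ Ts → IsB n k Ts × AB n k Ms Ts
  f Ms p = go (Ins-∈ (Cover-Ins cover (n<1+n n)))
    where
    open IsA p
    go : (∃ λ M → M ∈ Ms × In n M) → ∃ λ Ts → IsB n k Ts × AB n k Ms Ts
    go (M , M∈ , i) with a , c , eq ← ∈-∃++ M∈ = rotated (a , M ∷ c , eq , refl)
      where
      rotated : ∀ {Vs} → Cyc Ms (M ∷ Vs) → ∃ λ Ts → IsB n k Ts × AB n k Ms Ts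
      rotated {Vs} cyc with Cyc-All cyc ord | Cyc-All cyc min
      ... | oM ∷ oVs | mM ∷ mVs with Us , mk₁ ← Marked-forest oM (Simple-∈ (Cover-Simples cover) M∈) mM i =
        Us ++ Vs , record
          { cover = Cover-∷⁻ (Cover-resp weights cover)
          ; ord = All.++⁺ (Marked-All mk₁) oVs ; split≡ = refl ; len = lenV ; min = mVs }
        , ab cyc mk₁ refl lenV
        where
        lenV : length Vs ≡ k
        lenV = suc-injective (trans (sym (Cyc-length cyc)) len)
        weights : ∀ w → wts w Ms ≡ wts w (node n [] ∷ Us ++ Vs)
        weights w = trans (Cyc-wts cyc w) (trans (cong (_+ wts w Vs) (Marked-wt mk₁ w))
          (trans (+-assoc (w n + 0) _ _) (cong (w n + 0 +_) (sym (wts-++ w Us)))))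
  g : ∀ Ts → IsB n k Ts → ∃ λ Ms → IsA n k Ms × AB n k Ms Ts
  g Ts record { cover = cover ; ord = ord ; Us = Us ; Vs = Vs ; split≡ = refl ; len = len ; min = min }
    with M , mk₁ ← Marked-tree {n} {Us} (All.++⁻ˡ Us ord)
      (Simples-⊆ (λ w → +-monoʳ-≤ (w n + 0) (≤-trans (m≤m+n _ (wts w Vs)) (≤-reflexive (sym (wts-++ w Us)))))
        (Cover-Simples (Cover-∷ cover)))
    = M ∷ Vs , record
      { len = cong suc len ; min = Marked-Min mk₁ ∷ min ; ord = Marked-Ord mk₁ ∷ All.++⁻ʳ Us ord
      ; cover = Cover-resp (λ w → trans (cong (w n + 0 +_) (wts-++ w Us)) (trans (sym (+-assoc (w n + 0) _ _))
          (cong (_+ wts w Vs) (sym (Marked-wt mk₁ w))))) (Cover-∷ cover) }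
      , ab (Cyc-refl _) mk₁ refl len
  only : ∀ {Ms M Us Vs} → IsA n k Ms → Cyc Ms (M ∷ Vs) → Marked n Us M → All (λ y → In n M × ¬ In n y) Vs
  only p c m = All.tabulate λ y∈ → Marked-In m , λ i →
    Simples-∷ (Simples-resp (Cyc-wts c) (Cover-Simples (IsA.cover p))) (Marked-In m) (In-∈ y∈ i)
  fun : ∀ {Ms Ms′ Ts Ts′} → IsA n k Ms → IsA n k Ms′ → IsB n k Ts → IsB n k Ts′ → AB n k Ms Ts → AB n k Ms′ Ts′ →
    Cyc Ms Ms′ → Ts ≡ Ts′
  fun p p′ _ _ (ab c m refl _) (ab c′ m′ refl _) cyc
    with refl ← Cyc-heads (λ x y → In n x × ¬ In n y) (λ { (i , _) (_ , ¬i) → ¬i i }) (only p c m) (only p′ c′ m′)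
      (Cyc-trans (Cyc-sym c) (Cyc-trans cyc c′))
    = cong (_++ _) (Marked-inj m m′)
  inj : ∀ {Ms Ms′ Ts Ts′} → IsA n k Ms → IsA n k Ms′ → IsB n k Ts → IsB n k Ts′ → AB n k Ms Ts → AB n k Ms′ Ts′ →
    Ts ≡ Ts′ → Cyc Ms Ms′
  inj _ _ _ _ (ab {Us = Us} c m refl l) (ab {Us = Us′} c′ m′ eq l′) refl
    with refl , refl ← length-++-injective Us {c = Us′} eq (trans l (sym l′))
    with refl ← Marked-fun m m′ = Cyc-trans c (Cyc-sym c′)

record BC (k : ℕ) (Ts : List Tree) (Fs : List (List Tree)) : Set where
  constructor bc
  field
    {Us Vs} : List Tree
    split≡  : Ts ≡ Us ++ Vs
    len     : length Vs ≡ k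
    blocks  : Blocks k Us Vs Fs

B↔C : ∀ n k → k ≤ n → Inverse (subsetoid (setoid (List Tree)) (IsB n k)) (subsetoid (setoid (List (List Tree))) (IsC n k))
B↔C n k k≤n = relInverse (setoid (List Tree)) (setoid (List (List Tree))) (BC k) f g
  (λ _ _ _ _ → fun) (λ _ _ _ _ → inj)
  where
  f : ∀ Ts → IsB n k Ts → ∃ λ Fs → IsC n k Fs × BC k Ts Fs
  f Ts record { cover = cover ; ord = ord ; Us = Us ; Vs = Vs ; split≡ = refl ; len = len ; min = min }
    with unblocked {Fs} b gs os we ← block-up {k} _ Us Vs ≤-refl (All.++⁻ˡ Us ord) (All.++⁻ʳ Us ord) min (Cover-Simples cover)
      (trans len (sym (count-all cover k≤n)))
    = Fs , record { kgood = gs ; ord = os ; cover = Cover-resp we cover } , bc refl len b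
  g : ∀ Fs → IsC n k Fs → ∃ λ Ts → IsB n k Ts × BC k Ts Fs
  g Fs c with blocked {As} {Ms} b oA oM mM we le ← unblock (IsC.kgood c) (IsC.ord c) (Cover-Simples (IsC.cover c)) =
    As ++ Ms , record { cover = cov ; ord = All.++⁺ oA oM ; split≡ = refl ; len = lenM ; min = mM } , bc refl lenM b
    where
    cov : Cover n (As ++ Ms)
    cov = Cover-resp (sym ∘ we) (IsC.cover c)
    lenM : length Ms ≡ k
    lenM = trans le (count-all cov k≤n)
  fun : ∀ {Ts Ts′ Fs Fs′} → BC k Ts Fs → BC k Ts′ Fs′ → Ts ≡ Ts′ → Fs ≡ Fs′
  fun (bc {Us} refl l b) (bc {Us′} eq l′ b′) refl
    with refl , refl ← length-++-injective Us {c = Us′} eq (trans l (sym l′)) = Blocks-fun refl b b′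
  inj : ∀ {Ts Ts′ Fs Fs′} → BC k Ts Fs → BC k Ts′ Fs′ → Fs ≡ Fs′ → Ts ≡ Ts′
  inj (bc refl _ b) (bc refl _ b′) refl with refl , refl ← Blocks-inj b b′ = refl

C↔F : ∀ n k → k ≤ n → Inverse (subsetoid (setoid (List (List Tree))) (IsC n k)) (subsetoid (setoid Tree) (IsF n k))
C↔F n k k≤n = relInverse (setoid (List (List Tree))) (setoid Tree) (CF n k) (λ _ → C⇒F k≤n) (λ _ → F⇒C k≤n)
  (λ { _ _ _ _ r r′ refl → CF-fun r r′ }) (λ { _ _ _ _ r r′ refl → CF-inj r r′ })

B-bound : ∀ {n k Ts} → IsB n k Ts → k ≤ n
B-bound {n} record { cover = cover ; Us = Us ; Vs = Vs ; split≡ = refl ; len = refl } =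
  ≤-trans (length≤ Vs λ i → Cover-bound cover (In-++ʳ i))
    (≤-trans (≤-trans (m≤n+m _ (wts (χ n) Us)) (≤-reflexive (sym (wts-++ (χ n) Us)))) (≤-reflexive (count-all cover ≤-refl)))
  where
  In-++ʳ : ∀ {x} → Ins x Vs → Ins x (Us ++ Vs)
  In-++ʳ {x} (mk p) = mk (≤-trans (≤-trans p (m≤n+m _ (occs x Us))) (≤-reflexive (sym (wts-++ (δ x) Us))))
  length≤ : ∀ ts → (∀ {x} → Ins x ts → x < n) → length ts ≤ wts (χ n) ts
  length≤ [] _ = z≤n
  length≤ (t ∷ ts) b = +-mono-≤
    (≤-trans (≤-reflexive (sym (χ-< {n} (b (top∈ {t} (here refl)))))) (wt-top (χ n) t)) (length≤ ts (b ∘ Ins-there))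

F-bound : ∀ {n k t} → IsF n k t → k ≤ n
F-bound {n} {k} p = ≮⇒≥ λ lt → IsF.leaf p (proj₂ (IsF.nonleaf p lt))

B↔F : ∀ n k → Inverse (subsetoid (setoid (List Tree)) (IsB n k)) (subsetoid (setoid Tree) (IsF n k))
B↔F n k with k ≤? n
... | yes k≤n = Compose.inverse (B↔C n k k≤n) (C↔F n k k≤n)
-- Both sides are empty: more than `n` disjoint trees do not fit on `n` vertices, and for `n < k`
-- the leaf `n` would have to be a nonleaf.
... | no  k≰n = relInverse (setoid (List Tree)) (setoid Tree) (λ _ _ → ⊥)
  (λ _ p → ⊥-elim (k≰n (B-bound p))) (λ _ p → ⊥-elim (k≰n (F-bound p))) (λ _ _ _ _ ()) (λ _ _ _ _ ())

-- The five sets of the theorem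

Rep-cover⁺ : ∀ {n G t} → Rep {n} G t → RootedTree.vertices G ≡ ⊤ → Cover n [ t ]
Rep-cover⁺ R eq = mk λ x → trans (+-identityʳ _) (Mult-cover⁺ (Rep-Mult R) (once (Rep.simple R)) eq x)

Rep-cover⁻ : ∀ {n G t} → Rep {n} G t → Cover n [ t ] → RootedTree.vertices G ≡ ⊤
Rep-cover⁻ R c = Mult-cover⁻ (Rep-Mult R) λ x → trans (sym (+-identityʳ _)) (covers c x)

𝒯↔T : ∀ n k → Inverse (𝒯 n k) (subsetoid (setoid Tree) (IsT n k))
𝒯↔T n k = relInverse (treeSetoid (suc n)) (setoid Tree) Rep
  (λ G (eq , M , md , card) → let R = toTree-Rep G in toTree G ,
    record { ord = Rep.ord R ; cover = Rep-cover⁺ R eq ; md-len = trans (sym (MD-size {M = M} R md)) card } , R)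
  (λ t p → let open IsT p ; R = toRootedTree-Rep (All.head (Cover-Good cover (ord ∷ []))) ; M , md , card = MD-exists R in
    _ , (Rep-cover⁻ R cover , M , md , trans card md-len) , R)
  (λ _ _ _ _ → Rep-fun) (λ { _ _ _ _ R R′ refl → Rep-inj R R′ })

module _ {n : ℕ} where
  open Rotation (treeSetoid n) using (rotate; rotateBy; _↻_)

  rotate-Cyc : ∀ {xs ys} → Cyc xs ys → Cyc xs (rotate ys)
  rotate-Cyc ([]    , []    , eq   , refl) = [] , [] , eq , refl
  rotate-Cyc (x ∷ a , []    , eq   , refl) = [ x ] , a , trans eq (++-identityʳ (x ∷ a)) , refl
  rotate-Cyc (a     , y ∷ b , refl , refl) = a ++ [ y ] , b , sym (++-assoc a [ y ] b) , ++-assoc b a [ y ]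

  rotateBy-Cyc : ∀ m xs → Cyc xs (rotateBy m xs)
  rotateBy-Cyc zero    xs = Cyc-refl xs
  rotateBy-Cyc (suc m) xs = rotate-Cyc (rotateBy-Cyc m xs)

  rotateBy-suc : ∀ m xs → rotateBy (suc m) xs ≡ rotateBy m (rotate xs)
  rotateBy-suc zero    xs = refl
  rotateBy-suc (suc m) xs = cong rotate (rotateBy-suc m xs)

  rotateBy-length : ∀ xs ys → rotateBy (length xs) (xs ++ ys) ≡ ys ++ xs
  rotateBy-length []       ys = sym (++-identityʳ ys)
  rotateBy-length (x ∷ xs) ys = trans (rotateBy-suc (length xs) (x ∷ xs ++ ys))
    (trans (cong (rotateBy (length xs)) (++-assoc xs ys [ x ]))
    (trans (rotateBy-length xs (ys ++ [ x ])) (++-assoc ys [ x ] xs)))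

  ↻⇒Cyc : ∀ {Gs Gs′ Ms Ms′} → Reps Gs Ms → Reps Gs′ Ms′ → Gs ↻ Gs′ → Cyc Ms Ms′
  ↻⇒Cyc {Gs} Rs Rs′ (m , es) with a , b , refl , eq ← rotateBy-Cyc m Gs
    with us , vs , refl , Ra , Rb ← Reps-++⁻ˡ a Rs
    = us , vs , refl , sym (Reps-fun (Pointwise.++⁺ Rb Ra) Rs′ (subst (_≈ₗ _) eq es))

  Cyc⇒↻ : ∀ {Gs Gs′ Ms Ms′} → Reps Gs Ms → Reps Gs′ Ms′ → Cyc Ms Ms′ → Gs ↻ Gs′
  Cyc⇒↻ Rs Rs′ (a , b , refl , refl) with As , Bs , refl , Ra , Rb ← Reps-++⁻ʳ a Rs
    = length As , subst (_≈ₗ _) (sym (rotateBy-length As Bs)) (Reps-inj (Pointwise.++⁺ Rb Ra) Rs′)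

𝒜↔A : ∀ n k → Inverse (𝒜 n k) (subsetoid (cycSetoid Tree) (IsA n k))
𝒜↔A n k = relInverse (Rotation.cycleSetoid (treeSetoid (suc n))) (cycSetoid Tree) Reps
  (λ Gs (len , mins , part) → let ts , Rs = toTrees Gs in ts , record
    { len = trans (sym (Pointwise.Pointwise-length Rs)) len ; min = Reps-All⁺ Min⁺ Rs mins
    ; ord = All.map Good.ord (Reps-Good Rs) ; cover = partition⇒Cover Rs part } , Rs)
  (λ Ms p → let open IsA p ; Gs , Rs = toRootedTrees (Cover-Good cover ord) in
    Gs , (trans (Pointwise.Pointwise-length Rs) len , Reps-All⁻ Min⁻ Rs min , Cover⇒partition Rs cover) , Rs)
  (λ _ _ _ _ → ↻⇒Cyc) (λ _ _ _ _ → Cyc⇒↻)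

ℬ↔B : ∀ n k → Inverse (ℬ n k) (subsetoid (setoid (List Tree)) (IsB n k))
ℬ↔B n k = relInverse (Pointwise.setoid (treeSetoid n)) (setoid (List Tree)) Reps f g
  (λ _ _ _ _ → Reps-fun) (λ { _ _ _ _ Rs Rs′ refl → Reps-inj Rs Rs′ })
  where
  f : ∀ Gs → (IsOrderedForest ⊤ Gs ×
    ∃ λ Us → ∃ λ Vs → Gs ≡ Us ++ Vs × length Vs ≡ k × All RootedTree.MinimallyRooted Vs) → ∃ λ ts → IsB n k ts × Reps Gs ts
  f _ (part , Us , Vs , refl , len , mins)
    with us , Ru ← toTrees Us | vs , Rv ← toTrees Vs
    = us ++ vs , record
      { cover = partition⇒Cover (Pointwise.++⁺ Ru Rv) part
      ; ord = All.map Good.ord (Reps-Good (Pointwise.++⁺ Ru Rv))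
      ; split≡ = refl ; len = trans (sym (Pointwise.Pointwise-length Rv)) len ; min = Reps-All⁺ Min⁺ Rv mins }
    , Pointwise.++⁺ Ru Rv
  g : ∀ ts → IsB n k ts → ∃ λ Gs → (IsOrderedForest ⊤ Gs ×
    ∃ λ Us → ∃ λ Vs → Gs ≡ Us ++ Vs × length Vs ≡ k × All RootedTree.MinimallyRooted Vs) × Reps Gs ts
  g _ record { cover = cover ; ord = ord ; Us = us ; Vs = vs ; split≡ = refl ; len = len ; min = min }
    with Gs , Rs ← toRootedTrees (Cover-Good cover ord)
    with As , Bs , refl , Ra , Rb ← Reps-++⁻ʳ us Rs
    = As ++ Bs , (Cover⇒partition Rs cover , As , Bs , refl , trans (Pointwise.Pointwise-length Rb) len ,
      Reps-All⁻ Min⁻ Rb min) , Rs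

ForestReps : ∀ {n} → List (List (RootedTree n)) → List (List Tree) → Set
ForestReps = Pointwise Reps

ForestReps-fun : ∀ {n Fs Fs′ fs fs′} → ForestReps {n} Fs fs → ForestReps Fs′ fs′ → Pointwise _≈ₗ_ Fs Fs′ → fs ≡ fs′
ForestReps-fun []       []         []       = refl
ForestReps-fun (R ∷ Rs) (R′ ∷ Rs′) (e ∷ es) = cong₂ _∷_ (Reps-fun R R′ e) (ForestReps-fun Rs Rs′ es)

ForestReps-inj : ∀ {n Fs Fs′ fs} → ForestReps {n} Fs fs → ForestReps Fs′ fs → Pointwise _≈ₗ_ Fs Fs′
ForestReps-inj []       []         = []
ForestReps-inj (R ∷ Rs) (R′ ∷ Rs′) = Reps-inj R R′ ∷ ForestReps-inj Rs Rs′

occsFun : List Tree → ℕ → ℕ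
occsFun ts x = occs x ts

sums-occs : ∀ fs x → sums (map occsFun fs) x ≡ occs x (concat fs)
sums-occs []       x = refl
sums-occs (f ∷ fs) x = trans (cong (occs x f +_) (sums-occs fs x)) (sym (wts-++ (δ x) f))

ForestReps-Mults : ∀ {n Fs fs} → ForestReps {n} Fs fs → Pointwise Mult (map vertexSet Fs) (map occsFun fs)
ForestReps-Mults []       = []
ForestReps-Mults (R ∷ Rs) = vertexSet-Mult R ∷ ForestReps-Mults Rs

IsForest : ∀ {n} → ℕ → List (RootedTree n) → Set
IsForest k F = IsOrderedForest (vertexSet F) F × KGood k F

forests⁺ : ∀ {n k} (Fs : List (List (RootedTree n))) → All (IsForest k) Fs →
  ∃ λ fs → ForestReps Fs fs × All (KG k) fs × All (All Ord) fs × All (λ f → ∀ x → f x ≤ 1) (map occsFun fs)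
forests⁺ [] [] = [] , [] , [] , [] , []
forests⁺ (F ∷ Fs) (((_ , d , _) , kg) ∷ ps) with f , R ← toTrees F | fs , Rs , gs , os , us ← forests⁺ Fs ps =
  f ∷ fs , R ∷ Rs , KGood⁺ R (disjoint⇒Simples R d) kg ∷ gs , All.map Good.ord (Reps-Good R) ∷ os ,
  once (disjoint⇒Simples R d) ∷ us

forests⁻ : ∀ {n k} fs → All (KG k) fs → All (All (Good n)) fs → Simples (concat fs) →
  ∃ λ (Fs : List (List (RootedTree n))) → ForestReps Fs fs × All (IsForest k) Fs × All Nonempty (map vertexSet Fs)
forests⁻ [] [] [] _ = [] , [] , [] , []
forests⁻ (f ∷ fs) (g ∷ gs) (o ∷ os) u
  with F , R ← toRootedTrees o | Fs , Rs , ps , ns ← forests⁻ fs gs os (Simples-++ʳ f u) =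
  F ∷ Fs , R ∷ Rs ,
  ((Reps-nonempty R , Simples⇒disjoint R (Simples-++ˡ f u) , refl) , KGood⁻ R (Simples-++ˡ f u) g) ∷ ps ,
  nonempty R g ∷ ns
  where
  nonempty : ∀ {n k F f} → Reps {n} F f → KG k f → Nonempty (vertexSet F)
  nonempty {F = G ∷ _} (_ ∷ _) _ = RootedTree.root G , Subset.x∈p∪q⁺ (inj₁ (RootedTree.root∈ G))

𝒞↔C : ∀ n k → Inverse (𝒞 n k) (subsetoid (setoid (List (List Tree))) (IsC n k))
𝒞↔C n k = relInverse (Pointwise.setoid (Pointwise.setoid (treeSetoid n))) (setoid (List (List Tree))) ForestReps f g
  (λ _ _ _ _ → ForestReps-fun) (λ { _ _ _ _ Rs Rs′ refl → ForestReps-inj Rs Rs′ })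
  where
  f : ∀ Fs → All (IsForest k) Fs × IsPartition (map vertexSet Fs) ⊤ → ∃ λ fs → IsC n k fs × ForestReps Fs fs
  f Fs (ps , _ , d , eq) with fs , Rs , gs , os , us ← forests⁺ Fs ps = fs , record
    { kgood = gs ; ord = os
    ; cover = mk λ x → trans (sym (sums-occs fs x))
        (Mult-cover⁺ (Mult-⋃ (ForestReps-Mults Rs)) (Mult-simple (ForestReps-Mults Rs) us d) eq x) } , Rs
  g : ∀ fs → IsC n k fs → ∃ λ Fs → (All (IsForest k) Fs × IsPartition (map vertexSet Fs) ⊤) × ForestReps Fs fs
  g fs c
    with Fs , Rs , ps , ns ← forests⁻ fs (IsC.kgood c) (All.concat⁻ (Cover-Good (IsC.cover c) (All.concat⁺ (IsC.ord c))))
      (Cover-Simples (IsC.cover c))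
    = Fs , (ps , ns ,
      Mult-disjoint (ForestReps-Mults Rs) (λ x → subst (_≤ 1) (sym (sums-occs fs x)) (once (Cover-Simples (IsC.cover c)) x)) ,
      Mult-cover⁻ (Mult-⋃ (ForestReps-Mults Rs)) (λ x → trans (sums-occs fs x) (covers (IsC.cover c) x))) , Rs

ℱ↔F : ∀ n k → Inverse (ℱ n k) (subsetoid (setoid Tree) (IsF n k))
ℱ↔F n k = relInverse (treeSetoid (suc n)) (setoid Tree) Rep f g
  (λ _ _ _ _ → Rep-fun) (λ { _ _ _ _ R R′ refl → Rep-inj R R′ })
  where
  open RootedTree using (vertices; Leaf; Nonleaf)
  f : ∀ G → (vertices G ≡ ⊤ × Leaf G (fromℕ n) × (∀ v → Special k v → Nonleaf G v)) → ∃ λ t → IsF n k t × Rep G t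
  f G (eq , (_ , childless) , nonl) = t , record
    { ord = Rep.ord R ; cover = Rep-cover⁺ R eq ; leaf = leaf ; nonleaf = nonleaf } , R
    where
    t : Tree
    t = toTree G
    R : Rep G t
    R = toTree-Rep G
    leaf : ∀ {c} → ¬ Edge n c t
    leaf e with c , refl ← vertex (Rep.grep R) (Edge-child e) =
      childless (c , Edge⇒IsChild R (subst (λ x → Edge x (toℕ c) t) (sym (toℕ-fromℕ n)) e))
    nonleaf : ∀ {v} → v < k → ∃ λ c → Edge v c t
    nonleaf {v} lt with v <? suc n
    ... | yes v<n with _ , c , ch ← nonl (fromℕ< v<n) (subst (_< k) (sym (toℕ-fromℕ< v<n)) lt) =
      toℕ c , subst (λ x → Edge x (toℕ c) t) (toℕ-fromℕ< v<n) (IsChild⇒Edge R ch)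
    -- In `IsF` the label `v` ranges over all numbers below `k`. One beyond the vertices would make
    -- `n` special, although `n` is a leaf.
    ... | no v≮n = ⊥-elim (childless (proj₂ (nonl (fromℕ n)
      (subst (_< k) (sym (toℕ-fromℕ n)) (≤-trans (≮⇒≥ v≮n) (<⇒≤ lt))))))
  g : ∀ t → IsF n k t → ∃ λ G → (vertices G ≡ ⊤ × Leaf G (fromℕ n) × (∀ v → Special k v → Nonleaf G v)) × Rep G t
  g t p = G , (eq , (∈V , λ (c , ch) → leaf (subst (λ x → Edge x (toℕ c) t) (toℕ-fromℕ n) (IsChild⇒Edge R ch))) ,
    λ v sp → ∈V , nonl v (nonleaf sp)) , R
    where
    open IsF p
    G : RootedTree (suc n)
    G = toRootedTree (All.head (Cover-Good cover (ord ∷ [])))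
    R : Rep G t
    R = toRootedTree-Rep (All.head (Cover-Good cover (ord ∷ [])))
    eq : vertices G ≡ ⊤
    eq = Rep-cover⁻ R cover
    ∈V : ∀ {v} → v Subset.∈ vertices G
    ∈V {v} = subst (v Subset.∈_) (sym eq) Subset.∈⊤
    nonl : ∀ v → (∃ λ c → Edge (toℕ v) c t) → ∃ λ c → RootedTree.IsChild G c v
    nonl v (c , e) with c′ , refl ← vertex (Rep.grep R) (Edge-child e) = c′ , Edge⇒IsChild R e

theorem1p3 : ∀ (n k : ℕ) →
    Inverse (𝒯 n k) (𝒜 n k) ×
    Inverse (𝒜 n k) (ℬ n k) ×
    Inverse (ℬ n k) (ℱ n k) ×
    (k ≤ n → Inverse (ℬ n k) (𝒞 n k))
theorem1p3 n k =
  through (𝒯↔T n k) (T↔A n k) (𝒜↔A n k) ,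
  through (𝒜↔A n k) (A↔B n k) (ℬ↔B n k) ,
  through (ℬ↔B n k) (B↔F n k) (ℱ↔F n k) ,
  λ k≤n → through (ℬ↔B n k) (B↔C n k k≤n) (𝒞↔C n k)
  where
  through : ∀ {a b c d p q r s} {A : Setoid a p} {B : Setoid b q} {C : Setoid c r} {D : Setoid d s} →
    Inverse A B → Inverse B C → Inverse D C → Inverse A D
  through f g h = Compose.inverse f (Compose.inverse g (Symmetry.inverse h))
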